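{- Let $G$ be a controllable simple graph on $n$ vertices, and let $d_1\mid d_2\mid\cdots\mid d_n$ be the invariant factors (over $\mathbb{Z}$) of its walk matrix $W(G)$. Suppose $d_{\lceil n/2\rceil}=1$ and $d_{n-1}=2$. Let $d_n=2^{m_1}\prod_{i=2}^k p_i^{m_i}$ be the prime factorization of $d_n$, where $p_2,\ldots,p_k$ are distinct odd primes. Then $G$ has at most $$m_1\left(\prod_{i=2}^k\left(\left\lfloor \tfrac{m_i}{2}\right\rfloor+1\right)\right)-1$$ generalized cospectral mates.
   Context: For a graph $G$ with adjacency matrix $A$, the walk matrix is $W(G)=[e,Ae,\ldots,A^{n-1}e]$ where $e$ is the all-ones vector; $G$ is controllable if $W(G)$ is nonsingular. The invariant factors are the diagonal entries of the Smith normal form of $W(G)$ over $\mathbb{Z}$, taken positive. Two graphs $G,H$ are generalized cospectral if $G$ and $H$ have the same adjacency spectrum and their complements $\overline G,\overline H$ have the same adjacency spectrum. A generalized cospectral mate of $G$ is a graph generalized cospectral with $G$ but not isomorphic to $G$ (counted up to isomorphism). -}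

module Defs where

open import Data.Nat as ℕ using (ℕ; zero; suc; _≤_; ⌈_/2⌉; _∸_; _^_)
open import Data.Nat.Divisibility using (_∣_)
open import Data.Nat.Primality using (Prime)
open import Data.Integer as ℤ using (ℤ; +_; -_)
open import Data.Fin using (Fin; zero; suc; toℕ; punchIn; _≟_)
open import Data.Fin.Permutation using (Permutation′; _⟨$⟩ʳ_)
open import Data.Bool using (Bool; true; false; if_then_else_)
open import Data.List using (List; []; _∷_; map; length)
open import Data.Nat.ListAction using (product)
open import Data.List.Relation.Unary.All using (All)
open import Data.List.Relation.Unary.AllPairs using (AllPairs)
open import Data.List.Relation.Unary.Unique.Propositional using (Unique)
open import Data.Product using (Σ; _×_; _,_; proj₁)
open import Relation.Binary.PropositionalEquality using (_≡_)
open import Relation.Nullary using (¬_; does)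

record Graph (n : ℕ) : Set where
  field
    adj    : Fin n → Fin n → Bool
    sym    : ∀ i j → adj i j ≡ adj j i
    irrefl : ∀ i → adj i i ≡ false
open Graph public

Mat : ℕ → Set
Mat n = Fin n → Fin n → ℤ

adjMat : ∀ {n} → Graph n → Mat n
adjMat G i j = if adj G i j then + 1 else + 0

complAdjMat : ∀ {n} → Graph n → Mat n
complAdjMat G i j =
  if does (i ≟ j) then + 0 else (if adj G i j then + 0 else + 1)

Isomorphic : ∀ {n} → Graph n → Graph n → Set
Isomorphic {n} G H =
  Σ (Permutation′ n) λ σ → ∀ i j → adj H (σ ⟨$⟩ʳ i) (σ ⟨$⟩ʳ j) ≡ adj G i j

sumFin : ∀ {n} → (Fin n → ℤ) → ℤ
sumFin {zero}  f = + 0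
sumFin {suc n} f = f zero ℤ.+ sumFin (λ i → f (suc i))

_·_ : ∀ {n} → Mat n → Mat n → Mat n
(M · N) i j = sumFin (λ k → M i k ℤ.* N k j)

idMat : ∀ {n} → Mat n
idMat i j = if does (i ≟ j) then + 1 else + 0

diagMat : ∀ {n} → (Fin n → ℕ) → Mat n
diagMat d i j = if does (i ≟ j) then + (d i) else + 0

mulVec : ∀ {n} → Mat n → (Fin n → ℤ) → (Fin n → ℤ)
mulVec M v i = sumFin (λ k → M i k ℤ.* v k)

powE : ∀ {n} → Mat n → ℕ → (Fin n → ℤ)
powE M zero    = λ _ → + 1
powE M (suc k) = mulVec M (powE M k)

walkMat : ∀ {n} → Graph n → Mat n
walkMat G i j = powE (adjMat G) (toℕ j) i

module Det {R : Set} (0r 1r : R) (_+_ _*_ : R → R → R) (neg : R → R) where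
  det : ∀ {n} → (Fin n → Fin n → R) → R
  det {zero}  M = 1r
  det {suc n} M = go M
    where
    alt : ∀ {m} → Fin m → R → R
    alt zero    x = x
    alt (suc zero) x = neg x
    alt (suc (suc j)) x = alt j x
    go : (Fin (suc n) → Fin (suc n) → R) → R
    go M = sumR (λ j → alt j (M zero j * det (λ r c → M (suc r) (punchIn j c))))
      where
      sumR : ∀ {m} → (Fin m → R) → R
      sumR {zero}  f = 0r
      sumR {suc m} f = f zero + sumR (λ i → f (suc i))

detℤ : ∀ {n} → Mat n → ℤ
detℤ = Det.det (+ 0) (+ 1) ℤ._+_ ℤ._*_ -_

Controllable : ∀ {n} → Graph n → Set
Controllable G = ¬ (detℤ (walkMat G) ≡ + 0)

Unimodular : ∀ {n} → Mat n → Set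
Unimodular {n} U = Σ (Mat n) λ U' → (∀ i j → (U · U') i j ≡ idMat i j)
                                  × (∀ i j → (U' · U) i j ≡ idMat i j)

-- d (0-indexed: d i is d_{i+1}) is the list of invariant factors of M,
-- i.e. the diagonal of the Smith normal form of M over ℤ, taken nonnegative
IsInvariantFactors : ∀ {n} → Mat n → (Fin n → ℕ) → Set
IsInvariantFactors {n} M d =
  Σ (Mat n) λ U → Σ (Mat n) λ V →
    Unimodular U × Unimodular V ×
    (∀ i j → ((U · M) · V) i j ≡ diagMat d i j) ×
    (∀ (i : Fin n) (j : Fin n) → suc (toℕ i) ≡ toℕ j → d i ∣ d j)

-- Polynomials over ℤ (coefficient lists, lowest degree first)

Poly : Set
Poly = List ℤ

padd : Poly → Poly → Poly
padd []       q        = q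
padd (a ∷ p)  []       = a ∷ p
padd (a ∷ p)  (b ∷ q)  = (a ℤ.+ b) ∷ padd p q

pmul : Poly → Poly → Poly
pmul []      q = []
pmul (a ∷ p) q = padd (map (a ℤ.*_) q) (+ 0 ∷ pmul p q)

pneg : Poly → Poly
pneg = map -_

coeff : Poly → ℕ → ℤ
coeff []      k       = + 0
coeff (a ∷ p) zero    = a
coeff (a ∷ p) (suc k) = coeff p k

detP : ∀ {n} → (Fin n → Fin n → Poly) → Poly
detP = Det.det [] (+ 1 ∷ []) padd pmul pneg

charPoly : ∀ {n} → Mat n → Poly
charPoly M = detP (λ i j → (- M i j) ∷ (if does (i ≟ j) then + 1 else + 0) ∷ [])

Cospectral : ∀ {n} → Mat n → Mat n → Set
Cospectral M N = ∀ k → coeff (charPoly M) k ≡ coeff (charPoly N) k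

GenCospectral : ∀ {n} → Graph n → Graph n → Set
GenCospectral G H = Cospectral (adjMat G) (adjMat H)
                  × Cospectral (complAdjMat G) (complAdjMat H)

IsGCMate : ∀ {n} → Graph n → Graph n → Set
IsGCMate G H = GenCospectral G H × ¬ Isomorphic G H

-- G has at most N generalized cospectral mates (up to isomorphism):
-- every list of pairwise non-isomorphic mates has length ≤ N
AtMostMates : ∀ {n} → Graph n → ℕ → Set
AtMostMates {n} G N =
  (Hs : List (Graph n)) → All (IsGCMate G) Hs →
  AllPairs (λ H H' → ¬ Isomorphic H H') Hs → length Hs ≤ N

Odd : ℕ → Set
Odd p = ¬ (2 ∣ p)

bound : ℕ → List (ℕ × ℕ) → ℕ
bound m₁ ps = m₁ ℕ.* product (map (λ { (p , m) → ℕ._/_ m 2 ℕ.+ 1 }) ps) ∸ 1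

{-# OPTIONS --safe #-}

-- A generalized cospectral mate H of G has the same walk counts e·Aᵏe, so W(G) and W(H) have the same
-- Gram matrix and P = δ W(H) W(G)⁻¹ (with δ = d_n) is an integer matrix satisfying P Pᵀ = δ², P e = δ e and
-- P A(G) = A(H) P. The rows of P/δ span a unimodular lattice L′ inside the dual of the walk lattice. Because
-- d_{n-1} = 2, the quotient (L′ + ℤⁿ)/ℤⁿ is cyclic up to 2-torsion; a parity argument that needs d_{⌈n/2⌉} = 1
-- shows that its 2-torsion has rank at most one, so it is cyclic, of order ℓ say, and determined by ℓ.
-- Since e is a characteristic vector of every such lattice, ℓ determines L′ itself, hence H up to isomorphism.
-- Finally ℓ² divides 2 d_n, and ℓ is odd if 4 does not divide d_n, which leaves at most
-- m₁ ∏ (⌊mᵢ/2⌋ + 1) values for ℓ, one of them (ℓ = 1) taken by G.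

module Submission where

import Data.Nat.Properties as ℕ
import Data.Nat.Divisibility as ℕ
import Data.Integer.Properties as ℤ
import Data.Integer.Divisibility.Signed as ℤS
import Algebra.Solver.Ring
import Data.Nat.Induction as ℕ
import Defs
import Data.Nat.Divisibility as ℕᵈ
import Data.Nat.Solver
import Data.Nat.DivMod as ℕ
import Data.List.Properties as List
open import Data.Nat as ℕ using (ℕ; zero; suc; _≤_; ⌈_/2⌉; _∸_)
open import Data.Nat.GCD using (module GCD; module Bézout)
open import Data.Integer as ℤ using (ℤ; 0ℤ; 1ℤ)
open import Data.Product using (Σ; _×_; _,_; proj₁; proj₂)
open import Data.Sum using (_⊎_; inj₁; inj₂)
open import Relation.Binary.PropositionalEquality
open import Relation.Nullary using (¬_; yes; no; Dec)
open import Relation.Nullary.Decidable using (map′; dec⇒maybe)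
open import Algebra.Solver.Ring.AlmostCommutativeRing using (fromCommutativeRing; _-Raw-AlmostCommutative⟶_)
open import Algebra.Bundles using (CommutativeRing)
open import Algebra.Structures using (IsCommutativeRing)
open import Level using (0ℓ)
open import Defs using (Mat; idMat; Graph; adj; adjMat; complAdjMat; Poly; padd; pmul; pneg; coeff; detP; charPoly; Cospectral; GenCospectral; module Det; walkMat; powE; diagMat; IsInvariantFactors; Isomorphic; Odd; Controllable; AtMostMates; IsGCMate; bound)
open import Data.Fin as Fin using (Fin; zero; suc; toℕ; punchIn; fromℕ; fromℕ<; inject≤; inject₁)
open import Function using (_∘_)
open import Data.Fin.Properties using (punchInᵢ≢i; any?; toℕ<n; toℕ-fromℕ<; toℕ-injective; toℕ-inject≤; inject≤-injective; toℕ-inject₁; toℕ-fromℕ; all?)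
open import Data.Vec.Functional using (insertAt)
open import Data.Vec.Functional.Properties using (insertAt-lookup; insertAt-punchIn; insertAt-removeAt)
open import Data.Bool using (true; false; if_then_else_)
open import Data.List using ([]; _∷_; map; List; _++_; length; upTo; cartesianProductWith)
open import Data.Empty using (⊥-elim)
open import Data.Fin.Induction using (>-weakInduction)
open import Data.Fin.Permutation using (permutation)
open import Data.Nat.Primality using (Prime; prime⇒nonZero; prime⇒nonTrivial; prime⇒irreducible; prime[2]; euclidsLemma)
open import Data.Nat.ListAction using (product)
open import Data.List.Membership.Propositional using (_∈_)
open import Data.List.Membership.Propositional.Properties using (∈-upTo⁺; ∈-map⁺; ∈-cartesianProductWith⁺; ∈-∃++; ∈-++⁺ˡ; ∈-++⁺ʳ; ∈-++⁻)
open import Data.List.Relation.Unary.Any using (here; there)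
open import Data.List.Relation.Unary.All as All using (All; []; _∷_)
open import Data.List.Relation.Unary.AllPairs using (AllPairs; []; _∷_)
open import Data.List.Relation.Unary.Unique.Propositional using (Unique)

-- Everything in the parity argument rests on the evenness of walk counts. If 2 t = δ z represents a
-- 2-torsion class, z is orthogonal modulo 2 to all A^k e, and d_⌈n/2⌉ = 1 forces z ≡ A^ε f(A) e
-- modulo 2, where ε is the parity of n and deg f < ⌊n/2⌋. Modulo 4 the numbers z · A^k z are then
-- linear in f: they are the products of A^(ε+k) e with p(A) e for p = x^ε f(x²). Integrality of L′
-- thus makes p and x p, up to an even correction, null vectors of Wᵀ W modulo 4. As d_{n-1} = 2
-- leaves at most two independent ones modulo 2, f is unique modulo 2. When two mates of the same
-- level are compared, the difference of suitable generators may lie in neither lattice; only (x -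
-- μ) p is known to be null, μ being the scalar by which A acts on the cyclic quotient. Hence the
-- general combinations (c₀ + c₁ x) p. The bound on ℓ² uses this scalar too: a walk combination of
-- degree below n - 1 that A - μ maps into ℓ times the walk lattice is itself ℓ times a walk
-- combination. Lattices are scaled by δ and characteristic polynomials are evaluated at integers,
-- so all computations stay in ℤ.

module ℕS = Data.Nat.Solver.+-*-Solver

-- The integer operations unfold on open terms; opaque copies keep conversion checking feasible.

infix  8 -_
infixl 7 _*_
infixl 6 _+_ _-_

opaque
  _+_ _*_ : ℤ → ℤ → ℤ
  _+_ = ℤ._+_
  _*_ = ℤ._*_
  -_ : ℤ → ℤ
  -_ = ℤ.-_

_-_ : ℤ → ℤ → ℤ
x - y = x + - y

opaque
  unfolding _+_
  isCommutativeRing : IsCommutativeRing _≡_ _+_ _*_ -_ 0ℤ 1ℤ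
  isCommutativeRing = ℤ.+-*-isCommutativeRing

ℤ-ring : CommutativeRing 0ℓ 0ℓ
ℤ-ring = record { isCommutativeRing = isCommutativeRing }

open CommutativeRing ℤ-ring public
  using (+-assoc; +-comm; *-assoc; *-comm; +-identityˡ; +-identityʳ; *-identityˡ; *-identityʳ)
  renaming (distribˡ to *-distribˡ-+; distribʳ to *-distribʳ-+; zeroˡ to *-zeroˡ; zeroʳ to *-zeroʳ; -‿inverseʳ to +-inverseʳ; -‿inverseˡ to +-inverseˡ)

private
  module R = CommutativeRing ℤ.+-*-commutativeRing

  opaque
    unfolding _+_
    +-homo : ∀ x y → x R.+ y ≡ x + y
    +-homo x y = refl
    *-homo : ∀ x y → x R.* y ≡ x * y
    *-homo x y = refl
    neg-homo : ∀ x → R.- x ≡ - x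
    neg-homo x = refl

  coefficients : R.rawRing -Raw-AlmostCommutative⟶ fromCommutativeRing ℤ-ring
  coefficients = record
    { ⟦_⟧ = λ x → x ; +-homo = +-homo ; *-homo = *-homo ; -‿homo = neg-homo ; 0-homo = refl ; 1-homo = refl }

open Algebra.Solver.Ring R.rawRing (fromCommutativeRing ℤ-ring) coefficients (λ x y → dec⇒maybe (x ℤ.≟ y)) public
  using (solve; con; _:=_; _:+_; _:*_; _:-_; :-_)

-- Divisibility, parity and Bezout identities in ℤ.

2ℤ 4ℤ : ℤ
2ℤ = ℤ.+ 2
4ℤ = ℤ.+ 4

infix 4 _∣_
record _∣_ (k z : ℤ) : Set where
  constructor divides
  field
    quotient : ℤ
    equality : z ≡ quotient * k

∣-refl : ∀ {k} → k ∣ k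
∣-refl {k} = divides 1ℤ (sym (*-identityˡ k))

∣0 : ∀ {k} → k ∣ 0ℤ
∣0 {k} = divides 0ℤ (sym (*-zeroˡ k))

∣-trans : ∀ {i j k} → i ∣ j → j ∣ k → i ∣ k
∣-trans {i} (divides a refl) (divides b refl) = divides (b * a) (sym (*-assoc b a i))

∣m∣n⇒∣m+n : ∀ {i m n} → i ∣ m → i ∣ n → i ∣ m + n
∣m∣n⇒∣m+n {i} (divides a refl) (divides b refl) = divides (a + b) (sym (*-distribʳ-+ i a b))

∣m⇒∣-m : ∀ {i m} → i ∣ m → i ∣ - m
∣m⇒∣-m {i} (divides a refl) = divides (- a) (lem a i)
  where
  lem : ∀ a i → - (a * i) ≡ - a * i
  lem = solve 2 (λ a i → :- (a :* i) := :- a :* i) refl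

∣m∣n⇒∣m-n : ∀ {i m n} → i ∣ m → i ∣ n → i ∣ m - n
∣m∣n⇒∣m-n p q = ∣m∣n⇒∣m+n p (∣m⇒∣-m q)

∣n⇒∣m*n : ∀ {i} m {n} → i ∣ n → i ∣ m * n
∣n⇒∣m*n {i} m (divides a refl) = divides (m * a) (sym (*-assoc m a i))

∣m⇒∣m*n : ∀ {i m} n → i ∣ m → i ∣ m * n
∣m⇒∣m*n {i} {m} n p = subst (i ∣_) (*-comm n m) (∣n⇒∣m*n n p)

∣m*n : ∀ m {n} → n ∣ m * n
∣m*n m = divides m refl

∣n*m : ∀ m {n} → n ∣ n * m
∣n*m m {n} = divides m (*-comm n m)

*-mono-∣ : ∀ {i j k l} → i ∣ j → k ∣ l → i * k ∣ j * l
*-mono-∣ {i} {k = k} (divides a refl) (divides b refl) = divides (a * b) (lem a i b k)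
  where
  lem : ∀ a i b k → (a * i) * (b * k) ≡ (a * b) * (i * k)
  lem = solve 4 (λ a i b k → (a :* i) :* (b :* k) := (a :* b) :* (i :* k)) refl

0∣⇒≡0 : ∀ {x} → 0ℤ ∣ x → x ≡ 0ℤ
0∣⇒≡0 (divides a refl) = *-zeroʳ a

opaque
  unfolding _+_

  *-cancelˡ : ∀ c {a b} → c ≢ 0ℤ → c * a ≡ c * b → a ≡ b
  *-cancelˡ c {a} {b} c≢0 = ℤ.*-cancelˡ-≡ c a b {{ℤ.≢-nonZero c≢0}}

  *≡0 : ∀ c {a} → c ≢ 0ℤ → c * a ≡ 0ℤ → a ≡ 0ℤ
  *≡0 c {a} c≢0 eq with ℤ.i*j≡0⇒i≡0∨j≡0 c eq
  ... | inj₁ p with () ← c≢0 p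
  ... | inj₂ p = p

  ∣⇒∣ₛ : ∀ {i j} → i ∣ j → i ℤS.∣ j
  ∣⇒∣ₛ (divides q eq) = ℤS.divides q eq

  ∣ₛ⇒∣ : ∀ {i j} → i ℤS.∣ j → i ∣ j
  ∣ₛ⇒∣ (ℤS.divides q eq) = divides q eq

  pos-+ : ∀ m n → ℤ.+ (m ℕ.+ n) ≡ ℤ.+ m + ℤ.+ n
  pos-+ = ℤ.pos-+

  pos-* : ∀ m n → ℤ.+ (m ℕ.* n) ≡ ℤ.+ m * ℤ.+ n
  pos-* = ℤ.pos-*

  abs-* : ∀ x y → ℤ.∣ x * y ∣ ≡ ℤ.∣ x ∣ ℕ.* ℤ.∣ y ∣
  abs-* = ℤ.abs-*

  square-abs : ∀ y → y * y ≡ ℤ.+ (ℤ.∣ y ∣ ℕ.* ℤ.∣ y ∣)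
  square-abs (ℤ.+ k) = sym (ℤ.pos-* k k)
  square-abs ℤ.-[1+ k ] = refl

NonNegative : ℤ → Set
NonNegative x = Σ ℕ λ m → x ≡ ℤ.+ m

square-nonneg : ∀ x → NonNegative (x * x)
square-nonneg x = ℤ.∣ x ∣ ℕ.* ℤ.∣ x ∣ , square-abs x

nonneg-+ : ∀ {x y} → NonNegative x → NonNegative y → NonNegative (x + y)
nonneg-+ (m , refl) (k , refl) = m ℕ.+ k , sym (pos-+ m k)

nonneg-+≡0 : ∀ {x y} → NonNegative x → NonNegative y → x + y ≡ 0ℤ → x ≡ 0ℤ × y ≡ 0ℤ
nonneg-+≡0 (m , refl) (k , refl) eq = cong ℤ.+_ (ℕ.m+n≡0⇒m≡0 m nat) , cong ℤ.+_ (ℕ.m+n≡0⇒n≡0 m nat)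
  where
  nat : m ℕ.+ k ≡ 0
  nat = ℤ.+-injective (trans (pos-+ m k) eq)

square≡0 : ∀ x → x * x ≡ 0ℤ → x ≡ 0ℤ
square≡0 x eq with x ℤ.≟ 0ℤ
... | yes p = p
... | no  p = *≡0 x p eq

infix 4 _∣?_
_∣?_ : ∀ i j → Dec (i ∣ j)
i ∣? j = map′ ∣ₛ⇒∣ ∣⇒∣ₛ (i ℤS.∣? j)

pos-∣ : ∀ {m n} → m ℕ.∣ n → ℤ.+ m ∣ ℤ.+ n
pos-∣ p = ∣ₛ⇒∣ (ℤS.∣ᵤ⇒∣ p)

∣-pos : ∀ {m n} → ℤ.+ m ∣ ℤ.+ n → m ℕ.∣ n
∣-pos p = ℤS.∣⇒∣ᵤ (∣⇒∣ₛ p)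

∣-cancelˡ : ∀ c {a b} → c ≢ 0ℤ → c * a ∣ c * b → a ∣ b
∣-cancelˡ c {a} {b} c≢0 (divides q eq) = divides q (*-cancelˡ c c≢0 (trans eq (lem q c a)))
  where
  lem : ∀ q c a → q * (c * a) ≡ c * (q * a)
  lem = solve 3 (λ q c a → q :* (c :* a) := c :* (q :* a)) refl

abs∣ : ∀ {i j} → i ∣ j → ℤ.∣ i ∣ ℕ.∣ ℤ.∣ j ∣
abs∣ {i} (divides q refl) = ℕ.divides ℤ.∣ q ∣ (abs-* q i)

∣-small : ∀ {i x} → i ∣ x → ℤ.∣ x ∣ ℕ.< ℤ.∣ i ∣ → x ≡ 0ℤ
∣-small {x = x} p lt with ℤ.∣ x ∣ in eq
... | zero  = ℤ.∣i∣≡0⇒i≡0 eq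
... | suc k with () ← ℕ.<⇒≱ lt (ℕ.∣⇒≤ (subst (_ ℕ.∣_) eq (abs∣ p)))

∣-all : ∀ {x} → (∀ k → ℤ.+ suc k ∣ x) → x ≡ 0ℤ
∣-all {x} p = ∣-small (p ℤ.∣ x ∣) ℕ.≤-refl

opaque
  unfolding _+_
  *-pred : ∀ k y → ℤ.+ suc k * ℤ.+ suc (suc y) - 1ℤ ≡ ℤ.+ (suc y ℕ.+ k ℕ.* suc (suc y))
  *-pred k y = refl

-- At y = |x| + 2 the modulus already exceeds |x|. These are the moduli for which k + 1 is
-- invertible with inverse y.
∣-pred-all : ∀ {x} k → (∀ y → ℤ.+ suc k * y - 1ℤ ∣ x) → x ≡ 0ℤ
∣-pred-all {x} k p = ∣-small (subst (_∣ x) (*-pred k ℤ.∣ x ∣) (p (ℤ.+ suc (suc ℤ.∣ x ∣)))) (ℕ.s≤s (ℕ.m≤m+n _ _))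

-1* : ∀ x → - 1ℤ * x ≡ - x
-1* = solve 1 (λ x → :- con 1ℤ :* x := :- x) refl

x-y≡0⇒x≡y : ∀ {x y} → x - y ≡ 0ℤ → x ≡ y
x-y≡0⇒x≡y {x} {y} p = trans (sym (lem x y)) (trans (cong (_+ y) p) (+-identityˡ y))
  where
  lem : ∀ x y → x - y + y ≡ x
  lem = solve 2 (λ x y → x :- y :+ y := x) refl

Oddℤ : ℤ → Set
Oddℤ x = 2ℤ ∣ x - 1ℤ

odd*even : ∀ {x y} → Oddℤ x → 2ℤ ∣ x * y → 2ℤ ∣ y
odd*even {x} {y} p q = subst (2ℤ ∣_) (lem x y) (∣m∣n⇒∣m-n q (∣m⇒∣m*n y p))
  where
  lem : ∀ x y → x * y - (x - 1ℤ) * y ≡ y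
  lem = solve 2 (λ x y → x :* y :- (x :- con 1ℤ) :* y := y) refl

opaque
  unfolding _+_
  parity : ∀ x → 2ℤ ∣ x ⊎ Oddℤ x
  parity (ℤ.+ zero) = inj₁ (divides 0ℤ refl)
  parity (ℤ.+ suc zero) = inj₂ (divides 0ℤ refl)
  parity (ℤ.+ suc (suc n)) with parity (ℤ.+ n)
  ... | inj₁ p = inj₁ (∣m∣n⇒∣m+n (divides 1ℤ refl) p)
  ... | inj₂ p = inj₂ (subst (2ℤ ∣_) (lem (ℤ.+ n)) (∣m∣n⇒∣m+n (divides 1ℤ refl) p))
    where
    lem : ∀ x → 2ℤ + (x - 1ℤ) ≡ 2ℤ + x - 1ℤ
    lem = solve 1 (λ x → con 2ℤ :+ (x :- con 1ℤ) := con 2ℤ :+ x :- con 1ℤ) refl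
  parity ℤ.-[1+ zero ] = inj₂ (divides (ℤ.-[1+ 0 ]) refl)
  parity ℤ.-[1+ suc zero ] = inj₁ (divides (ℤ.-[1+ 0 ]) refl)
  parity ℤ.-[1+ suc (suc n) ] with parity ℤ.-[1+ n ]
  ... | inj₁ p = inj₁ (∣m∣n⇒∣m+n (divides {2ℤ} {ℤ.-[1+ 1 ]} ℤ.-[1+ 0 ] refl) p)
  ... | inj₂ p = inj₂ (∣m∣n⇒∣m+n (divides {2ℤ} {ℤ.-[1+ 1 ]} ℤ.-[1+ 0 ] refl) p)

  odd-not-even : ∀ {x} → Oddℤ x → ¬ 2ℤ ∣ x
  odd-not-even {x} p q with ∣-pos {2} {1} (subst (2ℤ ∣_) (lem x) (∣m∣n⇒∣m-n q p))
    where
    lem : ∀ x → x - (x - 1ℤ) ≡ 1ℤ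
    lem = solve 1 (λ x → x :- (x :- con 1ℤ) := con 1ℤ) refl
  ... | r with ℕ.s≤s () ← ℕ.∣⇒≤ r

not-even⇒odd : ∀ {x} → ¬ 2ℤ ∣ x → Oddℤ x
not-even⇒odd {x} p with parity x
... | inj₁ q with () ← p q
... | inj₂ q = q

odd-* : ∀ {x y} → Oddℤ x → Oddℤ y → Oddℤ (x * y)
odd-* {x} {y} p q = subst (2ℤ ∣_) (lem x y) (∣m∣n⇒∣m+n (∣m⇒∣m*n y p) q)
  where
  lem : ∀ x y → (x - 1ℤ) * y + (y - 1ℤ) ≡ x * y - 1ℤ
  lem = solve 2 (λ x y → (x :- con 1ℤ) :* y :+ (y :- con 1ℤ) := x :* y :- con 1ℤ) refl

square-parity : ∀ x → 2ℤ ∣ x * x - x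
square-parity x with parity x
... | inj₁ p = subst (2ℤ ∣_) (lem x) (∣m⇒∣m*n (x - 1ℤ) p)
  where
  lem : ∀ x → x * (x - 1ℤ) ≡ x * x - x
  lem = solve 1 (λ x → x :* (x :- con 1ℤ) := x :* x :- x) refl
... | inj₂ p = subst (2ℤ ∣_) (lem x) (∣m⇒∣m*n x p)
  where
  lem : ∀ x → (x - 1ℤ) * x ≡ x * x - x
  lem = solve 1 (λ x → (x :- con 1ℤ) :* x := x :* x :- x) refl

-- The cofactors are coprime even for a = b = 0, so the rows (x, y) and (b′, - a′) always form a
-- unimodular change of basis; the second row annihilates (a, b).
record Bezout (a b : ℤ) : Set where
  field
    g a′ b′ x y : ℤ
    a≡ : a ≡ a′ * g
    b≡ : b ≡ b′ * g
    coprime : x * a′ + y * b′ ≡ 1ℤ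
  g≡ : g ≡ x * a + y * b
  g≡ = sym (trans (cong₂ (λ p q → x * p + y * q) a≡ b≡) (trans (lem x a′ y b′ g) (trans (cong (_* g) coprime) (*-identityˡ g))))
    where
    lem : ∀ x a y b g → x * (a * g) + y * (b * g) ≡ (x * a + y * b) * g
    lem = solve 5 (λ x a y b g → x :* (a :* g) :+ y :* (b :* g) := (x :* a :+ y :* b) :* g) refl

private
  sign-abs : ∀ x → Σ ℤ λ s → x ≡ s * ℤ.+ ℤ.∣ x ∣ × s * x ≡ ℤ.+ ℤ.∣ x ∣
  sign-abs (ℤ.+ n) = 1ℤ , sym (*-identityˡ _) , *-identityˡ _
  sign-abs ℤ.-[1+ n ] = - 1ℤ , trans neg (sym (-1* (ℤ.+ suc n))) , trans (cong (- 1ℤ *_) neg) (trans (-1* _) (neg-neg _))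
    where
    opaque
      unfolding _+_
      neg : ℤ.-[1+ n ] ≡ - (ℤ.+ suc n)
      neg = refl
    neg-neg : ∀ x → - - x ≡ x
    neg-neg = solve 1 (λ x → :- :- x := x) refl

bezout : ∀ a b → Bezout a b
bezout a b with sign-abs a | sign-abs b | Bézout.lemma ℤ.∣ a ∣ ℤ.∣ b ∣
... | s , a≡ , sa≡ | t , b≡ , tb≡ | Bézout.result zero gcd id = record { g = 0ℤ ; a′ = 1ℤ ; b′ = 0ℤ ; x = 1ℤ ; y = 0ℤ
  ; a≡ = trans (zero-abs a (proj₁ (GCD.commonDivisor gcd))) (sym (*-zeroʳ 1ℤ)) ; b≡ = trans (zero-abs b (proj₂ (GCD.commonDivisor gcd))) (sym (*-zeroʳ 0ℤ)) ; coprime = one }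
  where
  zero-abs : ∀ x → 0 ℕ.∣ ℤ.∣ x ∣ → x ≡ 0ℤ
  zero-abs x p = ℤ.∣i∣≡0⇒i≡0 (ℕ.0∣⇒≡0 p)
  opaque
    unfolding _+_
    one : 1ℤ * 1ℤ + 0ℤ * 0ℤ ≡ 1ℤ
    one = refl
... | s , a≡ , sa≡ | t , b≡ , tb≡ | Bézout.result (suc d) gcd id with GCD.commonDivisor gcd
... | ℕ.divides p p≡ , ℕ.divides q q≡ = record { g = ℤ.+ suc d ; a′ = s * ℤ.+ p ; b′ = t * ℤ.+ q ; x = s * proj₁ uv ; y = t * proj₁ (proj₂ uv)
  ; a≡ = eqa ; b≡ = eqb
  ; coprime = *-cancelˡ (ℤ.+ suc d) (λ ()) (trans (lem (ℤ.+ suc d) s t (proj₁ uv) (proj₁ (proj₂ uv)) (ℤ.+ p) (ℤ.+ q))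
      (trans (cong₂ (λ X Y → s * (proj₁ uv * X) + t * (proj₁ (proj₂ uv) * Y)) (sym eqa) (sym eqb)) (trans (lem₂ s t (proj₁ uv) (proj₁ (proj₂ uv)) a b)
        (trans (cong₂ (λ X Y → proj₁ uv * X + proj₁ (proj₂ uv) * Y) sa≡ tb≡) (trans (sym (proj₂ (proj₂ uv))) (sym (*-identityʳ _)))))))  }
  where
  eqa : a ≡ (s * ℤ.+ p) * ℤ.+ suc d
  eqa = trans a≡ (trans (cong (λ z → s * ℤ.+ z) p≡) (trans (cong (s *_) (pos-* p (suc d))) (sym (*-assoc s _ _))))
  eqb : b ≡ (t * ℤ.+ q) * ℤ.+ suc d
  eqb = trans b≡ (trans (cong (λ z → t * ℤ.+ z) q≡) (trans (cong (t *_) (pos-* q (suc d))) (sym (*-assoc t _ _))))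
  lem : ∀ g s t u v p q → g * ((s * u) * (s * p) + (t * v) * (t * q)) ≡ s * (u * ((s * p) * g)) + t * (v * ((t * q) * g))
  lem = solve 7 (λ g s t u v p q → g :* ((s :* u) :* (s :* p) :+ (t :* v) :* (t :* q)) := s :* (u :* ((s :* p) :* g)) :+ t :* (v :* ((t :* q) :* g))) refl
  lem₂ : ∀ s t u v a b → s * (u * a) + t * (v * b) ≡ u * (s * a) + v * (t * b)
  lem₂ = solve 6 (λ s t u v a b → s :* (u :* a) :+ t :* (v :* b) := u :* (s :* a) :+ v :* (t :* b)) refl
  rearr : ∀ {m n k l} i j → ℤ.+ m + ℤ.+ n * i ≡ k * l → j ≡ - ℤ.+ n → ℤ.+ m ≡ k * l + j * i
  rearr {m} {n} {k} {l} i j eq refl = trans (lem₃ (ℤ.+ m) (ℤ.+ n) i) (cong (_+ - ℤ.+ n * i) eq)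
    where
    lem₃ : ∀ m n i → m ≡ (m + n * i) + - n * i
    lem₃ = solve 3 (λ m n i → m := (m :+ n :* i) :+ :- n :* i) refl
  uv : Σ ℤ λ u → Σ ℤ λ v → ℤ.+ suc d ≡ u * ℤ.+ ℤ.∣ a ∣ + v * ℤ.+ ℤ.∣ b ∣
  A = ℤ.+ ℤ.∣ a ∣
  B = ℤ.+ ℤ.∣ b ∣
  fromId : Bézout.Identity (suc d) ℤ.∣ a ∣ ℤ.∣ b ∣ → Σ ℤ λ u → Σ ℤ λ v → ℤ.+ suc d ≡ u * A + v * B
  fromId (Bézout.+- x y eq) = ℤ.+ x , - ℤ.+ y , rearr {suc d} {y} {ℤ.+ x} {A} B (- ℤ.+ y) (trans (cong (ℤ.+ suc d +_) (sym (pos-* y _))) (trans (sym (pos-+ (suc d) _)) (trans (cong ℤ.+_ eq) (pos-* x _)))) refl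
  fromId (Bézout.-+ x y eq) = - ℤ.+ x , ℤ.+ y , trans (rearr {suc d} {x} {ℤ.+ y} {B} A (- ℤ.+ x) (trans (cong (ℤ.+ suc d +_) (sym (pos-* x _))) (trans (sym (pos-+ (suc d) _)) (trans (cong ℤ.+_ eq) (pos-* y _)))) refl) (+-comm _ _)
  uv = fromId id

infixr 8 _^_
_^_ : ℤ → ℕ → ℤ
x ^ zero  = 1ℤ
x ^ suc n = x * x ^ n

^-nonzero : ∀ {x} n → x ≢ 0ℤ → x ^ n ≢ 0ℤ
^-nonzero zero p ()
^-nonzero {x} (suc n) p eq = ^-nonzero n p (*≡0 x p eq)

2≢0 : 2ℤ ≢ 0ℤ
2≢0 ()

private
  two-adic-fuel : ∀ m x → x ≢ 0ℤ → ℤ.∣ x ∣ ℕ.≤ m → Σ ℕ λ j → Σ ℤ λ o → Oddℤ o × x ≡ 2ℤ ^ j * o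
  two-adic-fuel m x x≢0 le with parity x
  ... | inj₂ odd = 0 , x , odd , sym (*-identityˡ x)
  two-adic-fuel zero x x≢0 le | inj₁ _ with () ← x≢0 (ℤ.∣i∣≡0⇒i≡0 (ℕ.n≤0⇒n≡0 le))
  two-adic-fuel (suc m) x x≢0 le | inj₁ (divides y refl) with two-adic-fuel m y y≢0 smaller
    where
    y≢0 : y ≢ 0ℤ
    y≢0 eq = x≢0 (trans (cong (_* 2ℤ) eq) (*-zeroˡ 2ℤ))
    abs≢0 : ℤ.∣ y ∣ ≢ 0
    abs≢0 eq = y≢0 (ℤ.∣i∣≡0⇒i≡0 eq)
    smaller : ℤ.∣ y ∣ ℕ.≤ m
    smaller = ℕ.≤-pred (ℕ.<-≤-trans (ℕ.m<m*n ℤ.∣ y ∣ 2 {{ℕ.≢-nonZero abs≢0}} (ℕ.s≤s (ℕ.s≤s ℕ.z≤n))) (subst (ℕ._≤ suc m) (abs-* y 2ℤ) le))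
  ... | j , o , odd , eq = suc j , o , odd , trans (cong (_* 2ℤ) eq) (lem (2ℤ ^ j) o)
    where
    lem : ∀ p o → p * o * 2ℤ ≡ 2ℤ * p * o
    lem = solve 2 (λ p o → p :* o :* con 2ℤ := con 2ℤ :* p :* o) refl

two-adic : ∀ x → x ≢ 0ℤ → Σ ℕ λ j → Σ ℤ λ o → Oddℤ o × x ≡ 2ℤ ^ j * o
two-adic x x≢0 = two-adic-fuel ℤ.∣ x ∣ x x≢0 ℕ.≤-refl

-- Integer vectors, finite sums and the action of matrices.

V : ℕ → Set
V n = Fin n → ℤ

opaque
  sumFin : ∀ {n} → V n → ℤ
  sumFin {zero}  f = 0ℤ
  sumFin {suc n} f = f zero + sumFin (f ∘ suc)

opaque
  unfolding sumFin

  sum-suc : ∀ {n} (f : V (suc n)) → sumFin f ≡ f zero + sumFin (f ∘ suc)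
  sum-suc f = refl

  sum-nil : (f : V 0) → sumFin f ≡ 0ℤ
  sum-nil f = refl

  sum-cong : ∀ {n} {f g : V n} → f ≗ g → sumFin f ≡ sumFin g
  sum-cong {zero}  p = refl
  sum-cong {suc n} p = cong₂ _+_ (p zero) (sum-cong (p ∘ suc))

  +-interchange : ∀ a b c d → (a + b) + (c + d) ≡ (a + c) + (b + d)
  +-interchange = solve 4 (λ a b c d → (a :+ b) :+ (c :+ d) := (a :+ c) :+ (b :+ d)) refl

  sum-+ : ∀ {n} (f g : V n) → sumFin (λ i → f i + g i) ≡ sumFin f + sumFin g
  sum-+ {zero}  f g = sym (+-identityˡ 0ℤ)
  sum-+ {suc n} f g = trans (cong ((f zero + g zero) +_) (sum-+ (f ∘ suc) (g ∘ suc))) (+-interchange (f zero) (g zero) _ _)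

  sum-* : ∀ {n} c (f : V n) → sumFin (λ i → c * f i) ≡ c * sumFin f
  sum-* {zero}  c f = sym (*-zeroʳ c)
  sum-* {suc n} c f = trans (cong (c * f zero +_) (sum-* c (f ∘ suc))) (sym (*-distribˡ-+ c (f zero) _))

  sum-0 : ∀ n → sumFin {n} (λ _ → 0ℤ) ≡ 0ℤ
  sum-0 zero    = refl
  sum-0 (suc n) = trans (+-identityˡ _) (sum-0 n)

  sum-zero : ∀ {n} {f : V n} → (∀ i → f i ≡ 0ℤ) → sumFin f ≡ 0ℤ
  sum-zero {n} p = trans (sum-cong p) (sum-0 n)

  sum-swap : ∀ {m n} (f : Fin m → Fin n → ℤ) →
    sumFin (λ i → sumFin (λ j → f i j)) ≡ sumFin (λ j → sumFin (λ i → f i j))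
  sum-swap {zero}  {n} f = sym (sum-0 n)
  sum-swap {suc m} f = trans (cong (sumFin (f zero) +_) (sum-swap (f ∘ suc))) (sym (sum-+ (f zero) _))

  sum-∣ : ∀ {n m} {f : V n} → (∀ i → m ∣ f i) → m ∣ sumFin f
  sum-∣ {zero}  p = ∣0
  sum-∣ {suc n} p = ∣m∣n⇒∣m+n (p zero) (sum-∣ (p ∘ suc))

  sum-pick : ∀ {n} (i : Fin n) (f : V n) → sumFin (λ j → idMat i j * f j) ≡ f i
  sum-pick {suc n} zero f = trans (cong₂ _+_ (*-identityˡ (f zero)) (sum-zero (λ i → *-zeroˡ (f (suc i))))) (+-identityʳ _)
  sum-pick (suc i) f = trans (cong (_+ sumFin (λ j → idMat i j * f (suc j))) (*-zeroˡ (f zero)))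
    (trans (+-identityˡ _) (sum-pick i (f ∘ suc)))

id-sym : ∀ {n} (i j : Fin n) → idMat i j ≡ idMat j i
id-sym zero    zero    = refl
id-sym zero    (suc j) = refl
id-sym (suc i) zero    = refl
id-sym (suc i) (suc j) = id-sym i j

id-diag : ∀ {n} (i : Fin n) → idMat i i ≡ 1ℤ
id-diag zero    = refl
id-diag (suc i) = id-diag i

id-off : ∀ {n} {i j : Fin n} → i ≢ j → idMat i j ≡ 0ℤ
id-off {i = zero}  {zero}  p with () ← p refl
id-off {i = zero}  {suc j} p = refl
id-off {i = suc i} {zero}  p = refl
id-off {i = suc i} {suc j} p = id-off (p ∘ cong suc)

dot : ∀ {n} → V n → V n → ℤ
dot x y = sumFin (λ i → x i * y i)

lc : ∀ {n} → ℤ → V n → ℤ → V n → V n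
lc a x b y i = a * x i + b * y i

dot-cong : ∀ {n} {x x′ y y′ : V n} → x ≗ x′ → y ≗ y′ → dot x y ≡ dot x′ y′
dot-cong p q = sum-cong (λ i → cong₂ _*_ (p i) (q i))

dot-congʳ : ∀ {n} (x : V n) {y y′ : V n} → y ≗ y′ → dot x y ≡ dot x y′
dot-congʳ x q = sum-cong (λ i → cong (x i *_) (q i))

dot-congˡ : ∀ {n} {x x′ : V n} (y : V n) → x ≗ x′ → dot x y ≡ dot x′ y
dot-congˡ y p = sum-cong (λ i → cong (_* y i) (p i))

dot-comm : ∀ {n} (x y : V n) → dot x y ≡ dot y x
dot-comm x y = sum-cong (λ i → *-comm (x i) (y i))

lc-term : ∀ a x b y z → (a * x + b * y) * z ≡ a * (x * z) + b * (y * z)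
lc-term = solve 5 (λ a x b y z → (a :* x :+ b :* y) :* z := a :* (x :* z) :+ b :* (y :* z)) refl

dot-lcˡ : ∀ {n} a (x : V n) b y z → dot (lc a x b y) z ≡ a * dot x z + b * dot y z
dot-lcˡ {n} a x b y z = trans (sum-cong (λ i → lc-term a (x i) b (y i) (z i)))
  (trans (sum-+ {n} _ _) (cong₂ _+_ (sum-* {n} a _) (sum-* {n} b _)))

dot-lcʳ : ∀ {n} (z : V n) a x b y → dot z (lc a x b y) ≡ a * dot z x + b * dot z y
dot-lcʳ z a x b y = trans (dot-comm z _) (trans (dot-lcˡ a x b y z)
  (cong₂ (λ p q → a * p + b * q) (dot-comm x z) (dot-comm y z)))

*-swap : ∀ a b c → a * (b * c) ≡ b * (a * c)
*-swap = solve 3 (λ a b c → a :* (b :* c) := b :* (a :* c)) refl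

dot-*ˡ : ∀ {n} a (x y : V n) → dot (λ i → a * x i) y ≡ a * dot x y
dot-*ˡ {n} a x y = trans (sum-cong (λ i → *-assoc a (x i) (y i))) (sum-* {n} a _)

dot-*ʳ : ∀ {n} (x : V n) a y → dot x (λ i → a * y i) ≡ a * dot x y
dot-*ʳ {n} x a y = trans (sum-cong (λ i → *-swap (x i) a (y i))) (sum-* {n} a _)

dot-∣ : ∀ {n m} (x : V n) {y} → (∀ i → m ∣ y i) → m ∣ dot x y
dot-∣ x p = sum-∣ (λ i → ∣n⇒∣m*n (x i) (p i))

dot-sumʳ : ∀ {m n} (z : V n) (c : V m) (y : Fin m → V n) →
  dot z (λ i → sumFin (λ k → c k * y k i)) ≡ sumFin (λ k → c k * dot z (y k))
dot-sumʳ {m} {n} z c y = trans (sum-cong (λ i → sym (sum-* {m} (z i) _)))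
  (trans (sum-swap {n} {m} _) (sum-cong (λ k → trans (sum-cong (λ i → *-swap (z i) (c k) (y k i))) (sum-* {n} (c k) _))))

mulVec : ∀ {m n} → (Fin m → Fin n → ℤ) → V n → V m
mulVec M v i = dot (M i) v

infixl 20 _ᵀ
_ᵀ : ∀ {m n} → (Fin m → Fin n → ℤ) → Fin n → Fin m → ℤ
(M ᵀ) i j = M j i

mulVec-cong : ∀ {m n} (M : Fin m → Fin n → ℤ) {x y} → x ≗ y → mulVec M x ≗ mulVec M y
mulVec-cong M p i = sum-cong (λ k → cong (M i k *_) (p k))

mulVec-congˡ : ∀ {m n} {M N : Fin m → Fin n → ℤ} → (∀ i j → M i j ≡ N i j) → ∀ x → mulVec M x ≗ mulVec N x
mulVec-congˡ p x i = sum-cong (λ k → cong (_* x k) (p i k))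

mulVec-lc : ∀ {m n} (M : Fin m → Fin n → ℤ) a x b y → mulVec M (lc a x b y) ≗ lc a (mulVec M x) b (mulVec M y)
mulVec-lc M a x b y i = dot-lcʳ (M i) a x b y

mulVec-* : ∀ {m n} (M : Fin m → Fin n → ℤ) a x → mulVec M (λ i → a * x i) ≗ λ i → a * mulVec M x i
mulVec-* M a x i = dot-*ʳ (M i) a x

dot-mulVec : ∀ {m n} (x : V m) (M : Fin m → Fin n → ℤ) y → dot x (mulVec M y) ≡ dot (mulVec (M ᵀ) x) y
dot-mulVec {m} {n} x M y = trans (sum-cong (λ i → sym (sum-* {n} (x i) _))) (trans (sum-swap {m} {n} _)
  (sum-cong (λ k → trans (sum-cong (λ i → lem (x i) (M i k) (y k)))
     (trans (sum-* {m} (y k) _) (*-comm (y k) (mulVec (M ᵀ) x k))))))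
  where
  lem : ∀ a b c → a * (b * c) ≡ c * (b * a)
  lem = solve 3 (λ a b c → a :* (b :* c) := c :* (b :* a)) refl

mulVec-∘ : ∀ {l m n} (M : Fin l → Fin m → ℤ) (N : Fin m → Fin n → ℤ) x →
  mulVec (λ i j → sumFin (λ k → M i k * N k j)) x ≗ mulVec M (mulVec N x)
mulVec-∘ M N x i = sym (trans (dot-mulVec (M i) N x) (sum-cong (λ k → cong (_* x k)
  (sum-cong (λ j → *-comm (N j k) (M i j))))))

mulVec-id : ∀ {n} (x : V n) → mulVec idMat x ≗ x
mulVec-id x i = sum-pick i x

mulVec-∣ : ∀ {k n m} (M : Fin k → Fin n → ℤ) {x} → (∀ i → m ∣ x i) → ∀ i → m ∣ mulVec M x i
mulVec-∣ M p i = dot-∣ (M i) p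

mulVec-unit : ∀ {m n} (M : Fin m → Fin n → ℤ) j → mulVec M (idMat j) ≗ λ i → M i j
mulVec-unit M j i = trans (dot-comm (M i) (idMat j)) (sum-pick j (M i))

opaque
  unfolding sumFin

  sum-nonneg : ∀ {n} {f : V n} → (∀ i → NonNegative (f i)) → NonNegative (sumFin f)
  sum-nonneg {zero}  h = 0 , refl
  sum-nonneg {suc n} h = nonneg-+ (h zero) (sum-nonneg (h ∘ suc))

  sum-nonneg≡0 : ∀ {n} {f : V n} → (∀ i → NonNegative (f i)) → sumFin f ≡ 0ℤ → ∀ i → f i ≡ 0ℤ
  sum-nonneg≡0 h eq zero    = proj₁ (nonneg-+≡0 (h zero) (sum-nonneg (h ∘ suc)) eq)
  sum-nonneg≡0 h eq (suc i) = sum-nonneg≡0 (h ∘ suc) (proj₂ (nonneg-+≡0 (h zero) (sum-nonneg (h ∘ suc)) eq)) i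

unit-dot : ∀ {n} (i : Fin n) (x : V n) → dot (idMat i) x ≡ x i
unit-dot i x = sum-pick i x

dot-ext : ∀ {n} {x y : V n} → (∀ z → dot z x ≡ dot z y) → x ≗ y
dot-ext {x = x} {y} h i = trans (sym (unit-dot i x)) (trans (h (idMat i)) (unit-dot i y))

dot-mulVecᵀ : ∀ {m n} (x : V n) (M : Fin m → Fin n → ℤ) y → dot x (mulVec (M ᵀ) y) ≡ dot (mulVec M x) y
dot-mulVecᵀ x M y = dot-mulVec x (M ᵀ) y

ᵀ-inverse : ∀ {n} (M N : Mat n) → (∀ x → mulVec M (mulVec N x) ≗ x) → ∀ x → mulVec (N ᵀ) (mulVec (M ᵀ) x) ≗ x
ᵀ-inverse M N h x = dot-ext (λ z → trans (dot-mulVecᵀ z N _) (trans (dot-mulVecᵀ (mulVec N z) M x) (dot-cong (h z) (λ _ → refl))))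

-- Determinants: Laplace expansion and column operations.

opaque
  unfolding sumFin

  sum-punchIn : ∀ {n} (j : Fin (suc n)) (f : V (suc n)) → sumFin f ≡ f j + sumFin (λ c → f (punchIn j c))
  sum-punchIn zero f = refl
  sum-punchIn {suc n} (suc j) f = trans (cong (f zero +_) (sum-punchIn j (f ∘ suc))) (swap3 (f zero) (f (suc j)) (sumFin (λ c → f (suc (punchIn j c)))))
    where
    swap3 : ∀ a b c → a + (b + c) ≡ b + (a + c)
    swap3 = solve 3 (λ a b c → a :+ (b :+ c) := b :+ (a :+ c)) refl

sgn : ∀ {n} → Fin n → ℤ
sgn zero    = 1ℤ
sgn (suc j) = - sgn j

opaque
  -- The expansion of `Det.det` with an explicit sign and the global `sumFin`, so that the lemmas on
  -- sums apply; `eval-det` links the two.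
  D : ∀ {n} → Mat n → ℤ
  D {zero}  M = 1ℤ
  D {suc n} M = sumFin (λ j → sgn j * (M zero j * D (λ r c → M (suc r) (punchIn j c))))

opaque
  unfolding D

  D-nil : (M : Mat 0) → D M ≡ 1ℤ
  D-nil M = refl

  D-suc : ∀ {n} (M : Mat (suc n)) → D M ≡ sumFin (λ j → sgn j * (M zero j * D (λ r c → M (suc r) (punchIn j c))))
  D-suc M = refl

minor : ∀ {n} → Mat (suc n) → Fin (suc n) → Mat n
minor M j r c = M (suc r) (punchIn j c)

D-cong : ∀ {n} {M N : Mat n} → (∀ i j → M i j ≡ N i j) → D M ≡ D N
D-cong {zero}  {M} {N} p = trans (D-nil M) (sym (D-nil N))
D-cong {suc n} {M} {N} p = trans (D-suc M) (trans (sum-cong (λ j → cong (sgn j *_) (cong₂ _*_ (p zero j) (D-cong (λ r c → p (suc r) (punchIn j c)))))) (sym (D-suc N)))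

D-cong-mod : ∀ {n m} {M N : Mat n} → (∀ i j → m ∣ M i j - N i j) → m ∣ D M - D N
D-cong-mod {zero}  {m} {M} {N} p = subst (m ∣_) (sym (trans (cong₂ _-_ (D-nil M) (D-nil N)) (+-inverseʳ 1ℤ))) ∣0
D-cong-mod {suc n} {m} {M} {N} p = subst (m ∣_) (trans (sum-+ (t M) (λ j → - t N j)) (sym (cong₂ _+_ (D-suc M) (trans (cong -_ (D-suc N)) (trans (sym (-1* _)) (trans (sym (sum-* (- 1ℤ) (t N))) (sum-cong (λ j → -1* (t N j)))))))))
  (sum-∣ λ j → subst (m ∣_) (split (sgn j) (M zero j) (N zero j) (D (minor M j)) (D (minor N j)))
    (∣n⇒∣m*n (sgn j) (∣m∣n⇒∣m+n (∣m⇒∣m*n (D (minor M j)) (p zero j)) (∣n⇒∣m*n (N zero j) (D-cong-mod {M = minor M j} {minor N j} (λ r c → p (suc r) (punchIn j c)))))))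
  where
  t : Mat (suc n) → Fin (suc n) → ℤ
  t M j = sgn j * (M zero j * D (minor M j))
  split : ∀ s a b x y → s * ((a - b) * x + b * (x - y)) ≡ s * (a * x) + - (s * (b * y))
  split = solve 5 (λ s a b x y → s :* ((a :- b) :* x :+ b :* (x :- y)) := s :* (a :* x) :+ :- (s :* (b :* y))) refl

D-scale : ∀ {n} s (M : Mat n) → D (λ i j → s * M i j) ≡ s ^ n * D M
D-scale {zero}  s M = trans (D-nil _) (sym (trans (*-identityˡ _) (D-nil M)))
D-scale {suc n} s M = trans (D-suc _) (trans (sum-cong (λ j → trans (cong (λ x → sgn j * (s * M zero j * x)) (D-scale s (minor M j)))
    (shuffle (sgn j) s (M zero j) (s ^ n) (D (minor M j))))) (trans (sum-* (s * s ^ n) _) (cong (s * s ^ n *_) (sym (D-suc M)))))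
  where
  shuffle : ∀ σ s a p x → σ * (s * a * (p * x)) ≡ s * p * (σ * (a * x))
  shuffle = solve 5 (λ σ s a p x → σ :* (s :* a :* (p :* x)) := s :* p :* (σ :* (a :* x))) refl

D-id : ∀ n → D (idMat {n}) ≡ 1ℤ
D-id zero    = D-nil _
D-id (suc n) = trans (D-suc {n} idMat) (trans (sum-cong (λ j → *-swap (sgn j) (idMat zero j) (D (minor {n} idMat j))))
  (trans (sum-pick zero (λ j → sgn j * D (minor {n} idMat j))) (trans (*-identityˡ _) (D-id n))))

-- The expansion runs along the first row, so column rules need an induction of their own: one
-- column `v` is singled out and the others are kept as `N : Cols n`.
Cols : ℕ → Set
Cols n = Fin (suc n) → Fin n → ℤ

ins : ∀ {n} → Fin (suc n) → V (suc n) → Cols n → Mat (suc n)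
ins j v N r = insertAt (N r) j (v r)

dropCol : ∀ {n} → Fin (suc n) → Cols (suc n) → Cols n
dropCol c N r k = N (suc r) (punchIn c k)

-- The position of column j once the column punchIn j c has been deleted.
shifted : ∀ {n} → Fin (suc (suc n)) → Fin (suc n) → Fin (suc n)
shifted zero    c       = zero
shifted (suc j) zero    = j
shifted {suc n} (suc j) (suc c) = suc (shifted j c)
shifted {zero} (suc zero) (suc ())

insertAt-shifted : ∀ {n} (xs : V (suc n)) j x c k →
  insertAt xs j x (punchIn (punchIn j c) k) ≡ insertAt (xs ∘ punchIn c) (shifted j c) x k
insertAt-shifted xs zero x c zero = refl
insertAt-shifted xs zero x c (suc k) = refl
insertAt-shifted xs (suc j) x zero k = refl
insertAt-shifted {suc n} xs (suc j) x (suc c) zero = refl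
insertAt-shifted {suc n} xs (suc j) x (suc c) (suc k) = insertAt-shifted (xs ∘ suc) j x c k

sgn-shifted : ∀ {n} (j : Fin (suc (suc n))) c → sgn (punchIn j c) * sgn (shifted j c) ≡ sgn j * sgn (Fin.suc c)
sgn-shifted zero c = *-comm (- sgn c) 1ℤ
sgn-shifted (suc j) zero = lem (sgn j)
  where
  lem : ∀ x → 1ℤ * x ≡ - x * - 1ℤ
  lem = solve 1 (λ x → con 1ℤ :* x := :- x :* :- con 1ℤ) refl
sgn-shifted {suc n} (suc j) (suc c) = trans (lem (sgn (punchIn j c)) _) (trans (sgn-shifted j c) (sym (lem (sgn j) (- sgn c))))
  where
  lem : ∀ x y → - x * - y ≡ x * y
  lem = solve 2 (λ x y → :- x :* :- y := x :* y) refl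
sgn-shifted {zero} (suc zero) (suc ())

D-ins : ∀ {n} j (v : V (suc n)) (N : Cols n) → D (ins j v N) ≡
  sgn j * (v zero * D (N ∘ suc)) + sumFin (λ c → sgn (punchIn j c) * (N zero c * D (λ r k → ins j v N (suc r) (punchIn (punchIn j c) k))))
D-ins j v N = trans (D-suc (ins j v N)) (trans (sum-punchIn j _) (cong₂ _+_
  (cong (sgn j *_) (cong₂ _*_ (insertAt-lookup (N zero) j (v zero)) (D-cong (λ r c → insertAt-punchIn (N (suc r)) j (v (suc r)) c))))
  (sum-cong (λ c → cong (λ x → sgn (punchIn j c) * (x * D (λ r k → ins j v N (suc r) (punchIn (punchIn j c) k)))) (insertAt-punchIn (N zero) j (v zero) c)))))

D-ins-suc : ∀ {n} j (v : V (suc (suc n))) (N : Cols (suc n)) → D (ins j v N) ≡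
  sgn j * (v zero * D (N ∘ suc)) + sumFin (λ c → sgn (punchIn j c) * (N zero c * D (ins (shifted j c) (v ∘ suc) (dropCol c N))))
D-ins-suc j v N = trans (D-ins j v N) (cong (sgn j * (v zero * D (N ∘ suc)) +_)
  (sum-cong λ c → cong (λ x → sgn (punchIn j c) * (N zero c * x)) (D-cong (λ r → insertAt-shifted (N (suc r)) j (v (suc r)) c))))

D-move : ∀ {n} j (v : V (suc n)) (N : Cols n) → D (ins j v N) ≡ sgn j * D (ins zero v N)
D-move {zero} zero v N = sym (*-identityˡ _)
D-move {suc n} j v N = trans (D-ins-suc j v N) (trans (cong (sgn j * x +_)
    (trans (sum-cong (λ c → trans (cong (λ y → sgn (punchIn j c) * (N zero c * y)) (D-move (shifted j c) (v ∘ suc) (dropCol c N)))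
        (trans (collect (sgn (punchIn j c)) (N zero c) (sgn (shifted j c)) (d c))
          (trans (cong (_* (N zero c * d c)) (sgn-shifted j c)) (*-assoc (sgn j) _ _)))))
      (sum-* {suc n} (sgn j) _)))
    (trans (factor (sgn j) x _) (cong (sgn j *_) (sym (D-ins-suc zero v N)))))
  where
  x = v zero * D (N ∘ suc)
  d : Fin (suc n) → ℤ
  d c = D (ins zero (v ∘ suc) (dropCol c N))
  collect : ∀ a b c d → a * (b * (c * d)) ≡ a * c * (b * d)
  collect = solve 4 (λ a b c d → a :* (b :* (c :* d)) := a :* c :* (b :* d)) refl
  factor : ∀ s x y → s * x + s * y ≡ s * (1ℤ * x + y)
  factor = solve 3 (λ s x y → s :* x :+ s :* y := s :* (con 1ℤ :* x :+ y)) refl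

D-lin : ∀ {n} a (v : V (suc n)) b w (N : Cols n) → D (ins zero (lc a v b w) N) ≡ a * D (ins zero v N) + b * D (ins zero w N)
D-lin {zero} a v b w N = trans (base (lc a v b w)) (sym (cong₂ (λ p q → a * p + b * q) (base v) (base w)))
  where
  lem : ∀ x → 1ℤ * (x * 1ℤ) + 0ℤ ≡ x
  lem = solve 1 (λ x → con 1ℤ :* (x :* con 1ℤ) :+ con 0ℤ := x) refl
  base : ∀ v → D (ins zero v N) ≡ v zero
  base v = trans (D-ins zero v N) (trans (cong₂ (λ p q → 1ℤ * (v zero * p) + q) (D-nil _) (sum-nil _)) (lem (v zero)))
D-lin {suc n} a v b w N = trans (D-ins-suc zero (lc a v b w) N) (trans (cong (1ℤ * ((a * v zero + b * w zero) * x) +_)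
    (trans (sum-cong (λ c → trans (cong (λ y → sgn (Fin.suc c) * (N zero c * y)) (D-lin a (v ∘ suc) b (w ∘ suc) (dropCol c N))) (distr (sgn (Fin.suc c)) (N zero c) a _ b _)))
    (trans (sum-+ {suc n} _ _) (cong₂ _+_ (sum-* {suc n} a (tm v)) (sum-* {suc n} b (tm w))))))
    (trans (regroup a (v zero) b (w zero) x (sumFin (tm v)) (sumFin (tm w)))
      (cong₂ (λ p q → a * p + b * q) (sym (D-ins-suc zero v N)) (sym (D-ins-suc zero w N)))))
  where
  x = D (N ∘ suc)
  tm : V (suc (suc n)) → Fin (suc n) → ℤ
  tm v c = sgn (Fin.suc c) * (N zero c * D (ins zero (v ∘ suc) (dropCol c N)))
  distr : ∀ s m a p b q → s * (m * (a * p + b * q)) ≡ a * (s * (m * p)) + b * (s * (m * q))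
  distr = solve 6 (λ s m a p b q → s :* (m :* (a :* p :+ b :* q)) := a :* (s :* (m :* p)) :+ b :* (s :* (m :* q))) refl
  regroup : ∀ a v b w x p q → 1ℤ * ((a * v + b * w) * x) + (a * p + b * q) ≡ a * (1ℤ * (v * x) + p) + b * (1ℤ * (w * x) + q)
  regroup = solve 7 (λ a v b w x p q → con 1ℤ :* ((a :* v :+ b :* w) :* x) :+ (a :* p :+ b :* q) := a :* (con 1ℤ :* (v :* x) :+ p) :+ b :* (con 1ℤ :* (w :* x) :+ q)) refl

D-ins-cong : ∀ {n} {v w : V (suc n)} (N : Cols n) → v ≗ w → D (ins zero v N) ≡ D (ins zero w N)
D-ins-cong N p = D-cong λ { r zero → p r ; r (suc c) → refl }

-- The first two terms of the first-row expansion cancel; every later minor still begins with the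
-- two equal columns, so induction applies.
D-equal₀₁ : ∀ {n} (v : V (suc (suc n))) (N : Cols (suc n)) → (∀ r → N r zero ≡ v r) → D (ins zero v N) ≡ 0ℤ
D-equal₀₁ {n} v N p = trans (D-ins-suc zero v N) (trans (cong (1ℤ * (v zero * D (N ∘ suc)) +_) (sum-suc {n} _)) (trans (cong₂ (λ x y → 1ℤ * (v zero * D (N ∘ suc)) + (- 1ℤ * (x * y) + rest)) (p zero)
    (D-cong {M = ins zero (v ∘ suc) (dropCol zero N)} {N ∘ suc} λ { r zero → sym (p (suc r)) ; r (suc c) → refl }))
    (trans (cong (λ y → 1ℤ * (v zero * D (N ∘ suc)) + (- 1ℤ * (v zero * D (N ∘ suc)) + y)) (sum-zero (rest0 N p))) (cancel (v zero * D (N ∘ suc))))))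
  where
  rest = sumFin (λ c → sgn (Fin.suc (Fin.suc c)) * (N zero (suc c) * D (ins zero (v ∘ suc) (dropCol (suc c) N))))
  cancel : ∀ x → 1ℤ * x + (- 1ℤ * x + 0ℤ) ≡ 0ℤ
  cancel = solve 1 (λ x → con 1ℤ :* x :+ (:- con 1ℤ :* x :+ con 0ℤ) := con 0ℤ) refl
  rest0 : ∀ {n} {v : V (suc (suc n))} (N : Cols (suc n)) → (∀ r → N r zero ≡ v r) → ∀ c → sgn (Fin.suc (Fin.suc c)) * (N zero (suc c) * D (ins zero (v ∘ suc) (dropCol (suc c) N))) ≡ 0ℤ
  rest0 {suc n} {v} N p c = trans (cong (λ x → sgn (Fin.suc (Fin.suc c)) * (N zero (suc c) * x)) (D-equal₀₁ (v ∘ suc) (dropCol (suc c) N) (λ r → p (suc r))))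
    (trans (cong (sgn (Fin.suc (Fin.suc c)) *_) (*-zeroʳ (N zero (suc c)))) (*-zeroʳ (sgn (Fin.suc (Fin.suc c)))))

swapIn : ∀ {n} → Fin (suc n) → V (suc (suc n)) → Cols (suc n) → Cols (suc n)
swapIn k v N r = insertAt (λ c → N r (punchIn k c)) zero (v r)

ins-swap : ∀ {n} k (v : V (suc (suc n))) (N : Cols (suc n)) i j → ins zero v N i j ≡ ins (suc k) (λ r → N r k) (swapIn k v N) i j
ins-swap k v N i zero = refl
ins-swap k v N i (suc j) = sym (insertAt-removeAt (N i) k j)

D-equal : ∀ {n} k (v : V (suc n)) (N : Cols n) → (∀ r → N r k ≡ v r) → D (ins zero v N) ≡ 0ℤ
D-equal {suc n} k v N p = trans (D-cong (ins-swap k v N)) (trans (D-move (suc k) _ (swapIn k v N))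
  (trans (cong (- sgn k *_) (D-equal₀₁ _ (swapIn k v N) (λ r → sym (p r)))) (*-zeroʳ (- sgn k))))

D-ins-sum : ∀ {m n} (x : V m) (y : Fin m → V (suc n)) (N : Cols n) →
  D (ins zero (λ r → sumFin (λ k → x k * y k r)) N) ≡ sumFin (λ k → x k * D (ins zero (y k) N))
D-ins-sum {zero} x y N = trans (D-ins-cong N (λ r → trans (sum-nil _) (sym (lem 0ℤ)))) (trans (D-lin 0ℤ (λ _ → 0ℤ) 0ℤ (λ _ → 0ℤ) N)
    (trans (lem (D (ins zero (λ _ → 0ℤ) N))) (sym (sum-nil _))))
  where
  lem : ∀ x → 0ℤ * x + 0ℤ * x ≡ 0ℤ
  lem = solve 1 (λ x → con 0ℤ :* x :+ con 0ℤ :* x := con 0ℤ) refl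
D-ins-sum {suc m} x y N = trans (D-ins-cong N (λ r → trans (sum-suc {m} _) (cong (x zero * y zero r +_) (sym (*-identityˡ _)))))
  (trans (D-lin (x zero) (y zero) 1ℤ _ N) (trans (cong (x zero * D (ins zero (y zero) N) +_) (trans (*-identityˡ _) (D-ins-sum (x ∘ suc) (y ∘ suc) N))) (sym (sum-suc {m} _))))

D-ins-+comb : ∀ {n} (v : V (suc n)) (N : Cols n) x → D (ins zero (λ r → v r + sumFin (λ k → x k * N r k)) N) ≡ D (ins zero v N)
D-ins-+comb v N x = trans (D-ins-cong N (λ r → sym (cong₂ _+_ (*-identityˡ (v r)) (*-identityˡ _))))
  (trans (D-lin 1ℤ v 1ℤ _ N) (trans (cong₂ _+_ (*-identityˡ _) (trans (*-identityˡ _) (trans (D-ins-sum x (λ k r → N r k) N)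
    (sum-zero (λ k → trans (cong (x k *_) (D-equal k (λ r → N r k) N (λ _ → refl))) (*-zeroʳ (x k))))))) (+-identityʳ _)))

-- Changing one coordinate at a time reduces `D-rank-one` to a single column operation. Closure
-- under `≗` is assumed because vectors are functions, compared pointwise.
vec-ind : ∀ {n} (P : V n → Set) → (∀ {x y} → x ≗ y → P x → P y) → P (λ _ → 0ℤ) →
  (∀ w k c → P w → P (λ j → w j + idMat k j * c)) → ∀ w → P w
vec-ind {zero}  P resp p0 step w = resp (λ ()) p0
vec-ind {suc n} P resp p0 step w = resp (λ { zero → lem₁ (w zero) ; (suc j) → lem₂ (w (suc j)) (w zero) }) (step _ zero (w zero)
    (vec-ind (λ u → P (insertAt u zero 0ℤ)) (λ p → resp λ { zero → refl ; (suc j) → p j })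
      (resp (λ { zero → refl ; (suc j) → refl }) p0)
      (λ u k c q → resp (λ { zero → lem₃ c ; (suc j) → refl }) (step (insertAt u zero 0ℤ) (suc k) c q)) (w ∘ suc)))
  where
  lem₁ : ∀ x → 0ℤ + 1ℤ * x ≡ x
  lem₁ = solve 1 (λ x → con 0ℤ :+ con 1ℤ :* x := x) refl
  lem₂ : ∀ x y → x + 0ℤ * y ≡ x
  lem₂ = solve 2 (λ x y → x :+ con 0ℤ :* y := x) refl
  lem₃ : ∀ x → 0ℤ + 0ℤ * x ≡ 0ℤ
  lem₃ = solve 1 (λ x → con 0ℤ :+ con 0ℤ :* x := con 0ℤ) refl

D-rank-one : ∀ {n} (v : V (suc n)) (N : Cols n) w → D (ins zero v (λ r k → N r k + v r * w k)) ≡ D (ins zero v N)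
D-rank-one {n} v N = vec-ind _ (λ {x} {y} p q → trans (D-cong {M = ins zero v (λ r k → N r k + v r * y k)} {ins zero v (λ r k → N r k + v r * x k)} λ { r zero → refl ; r (suc k) → cong (λ z → N r k + v r * z) (sym (p k)) }) q)
    (D-cong {M = ins zero v (λ r k → N r k + v r * 0ℤ)} {ins zero v N} λ { r zero → refl ; r (suc k) → trans (cong (N r k +_) (*-zeroʳ (v r))) (+-identityʳ _) })
    (λ w k c q → trans (D-cong {M = ins zero v (λ r j → N r j + v r * (w j + idMat k j * c))} {ins zero v (λ r j → (N r j + v r * w j) + v r * (idMat k j * c))}
        λ { r zero → refl ; r (suc j) → assoc (N r j) (v r) (w j) (idMat k j * c) }) (trans (single v (λ r j → N r j + v r * w j) k c) q))
  where
  assoc : ∀ a b c d → a + b * (c + d) ≡ (a + b * c) + b * d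
  assoc = solve 4 (λ a b c d → a :+ b :* (c :+ d) := (a :+ b :* c) :+ b :* d) refl
  single : ∀ {n} (v : V (suc n)) (N : Cols n) k c → D (ins zero v (λ r j → N r j + v r * (idMat k j * c))) ≡ D (ins zero v N)
  -- Column k is brought to the front, where linearity splits off a multiple of `v`; that part has
  -- two equal columns.
  single {suc n} v N k c = trans (D-cong (ins-swap k v N′)) (trans (D-move (suc k) _ (swapIn k v N′))
      (trans (cong (- sgn k *_) (trans (D-cong {M = ins zero (λ r → N′ r k) (swapIn k v N′)} {ins zero (lc 1ℤ (λ r → N r k) c v) (swapIn k v N)} entries)
        (trans (D-lin 1ℤ _ c v (swapIn k v N)) (cong (λ z → 1ℤ * D (ins zero (λ r → N r k) (swapIn k v N)) + c * z) (D-equal₀₁ v (swapIn k v N) (λ _ → refl))))))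
      (trans (tidy (- sgn k) (D (ins zero (λ r → N r k) (swapIn k v N))) c) (sym (trans (D-cong (ins-swap k v N)) (D-move (suc k) _ (swapIn k v N)))))))
    where
    N′ : Cols (suc n)
    N′ r j = N r j + v r * (idMat k j * c)
    tidy : ∀ s x c → s * (1ℤ * x + c * 0ℤ) ≡ s * x
    tidy = solve 3 (λ s x c → s :* (con 1ℤ :* x :+ c :* con 0ℤ) := s :* x) refl
    diag : ∀ a b c → a + b * (1ℤ * c) ≡ 1ℤ * a + c * b
    diag = solve 3 (λ a b c → a :+ b :* (con 1ℤ :* c) := con 1ℤ :* a :+ c :* b) refl
    off : ∀ a b c → a + b * (0ℤ * c) ≡ a
    off = solve 3 (λ a b c → a :+ b :* (con 0ℤ :* c) := a) refl
    entries : ∀ i j → ins zero (λ r → N′ r k) (swapIn k v N′) i j ≡ ins zero (lc 1ℤ (λ r → N r k) c v) (swapIn k v N) i j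
    entries i zero = trans (cong (λ z → N i k + v i * (z * c)) (id-diag k)) (diag (N i k) (v i) c)
    entries i (suc zero) = refl
    entries i (suc (suc j)) = trans (cong (λ z → N i (punchIn k j) + v i * (z * c)) (id-off (λ eq → punchInᵢ≢i k j (sym eq)))) (off (N i (punchIn k j)) (v i) c)

-- Bordering M by a row and a column turns the rank-one perturbation of M into a column operation,
-- and an approximate solution x of M x = e (modulo c) into another.
D-+const : ∀ {n} (M : Mat n) s (x : V n) c y → (∀ r → 1ℤ - mulVec M x r ≡ c * y r) →
  c ∣ D (λ i j → M i j + s) - (1ℤ + s * sumFin x) * D M
D-+const {n} M s x c y h = subst (c ∣_) (sym difference) (sum-∣ (λ k → ∣n⇒∣m*n (sgn (Fin.suc k)) (∣n⇒∣m*n (- s) (minors M x y h k))))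
  where
  -- The border: a row of entries - s on top of M. Together with a first column of ones it has the
  -- determinant that is computed in two ways.
  N : ∀ {n} → Mat n → Cols n
  N M zero    k = - s
  N M (suc r) k = M r k
  ones : ∀ {n} → V n
  ones _ = 1ℤ
  v : ∀ {n} → Mat n → V n → V (suc n)
  v M x r = 1ℤ + sumFin (λ k → - x k * N M r k)
  mn : ∀ {n} → Mat n → V n → Fin n → Mat n
  mn M x k r j = ins zero (v M x) (N M) (suc r) (punchIn (suc k) j)
  sums : ∀ x s → - x * - s ≡ s * x
  sums = solve 2 (λ x s → :- x :* :- s := s :* x) refl
  neg : ∀ x y → - x * y ≡ - 1ℤ * (y * x)
  neg = solve 2 (λ x y → :- x :* y := :- con 1ℤ :* (y :* x)) refl
  v0 : v M x zero ≡ 1ℤ + s * sumFin x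
  v0 = cong (1ℤ +_) (trans (sum-cong (λ k → sums (x k) s)) (sum-* {n} s x))
  minors : ∀ {n} (M : Mat n) (x y : V n) → (∀ r → 1ℤ - mulVec M x r ≡ c * y r) → ∀ k → c ∣ D (mn M x k)
  minors {suc n} M x y h k = subst (c ∣_) (sym (trans (D-cong {M = mn M x k} {ins zero (lc c y 0ℤ y) (dropCol k (N M))} entries) (D-lin c y 0ℤ y (dropCol k (N M)))))
      (∣m∣n⇒∣m+n (∣m⇒∣m*n _ ∣-refl) (subst (c ∣_) (sym (*-zeroˡ _)) ∣0))
    where
    pad : ∀ c y → c * y ≡ c * y + 0ℤ * y
    pad = solve 2 (λ c y → c :* y := c :* y :+ con 0ℤ :* y) refl
    entries : ∀ r j → mn M x k r j ≡ ins zero (lc c y 0ℤ y) (dropCol k (N M)) r j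
    entries r zero = trans (cong (1ℤ +_) (trans (sum-cong (λ j → neg (x j) (M r j))) (trans (sum-* {suc n} (- 1ℤ) _) (-1* _))))
      (trans (h r) (pad c (y r)))
    entries r (suc j) = refl
  tail = sumFin (λ k → sgn (Fin.suc k) * (- s * D (mn M x k)))
  -- Adding s times the column of ones to the others clears the top row and turns M into M + s J.
  lhs : D (ins zero ones (λ r k → N M r k + 1ℤ * s)) ≡ D (λ i j → M i j + s)
  lhs = trans (D-ins zero ones (λ r k → N M r k + 1ℤ * s)) (trans (cong₂ _+_ (trans (*-identityˡ _) (trans (*-identityˡ _)
    (D-cong (λ i j → cong (M i j +_) (*-identityˡ s))))) (sum-zero (λ k → vanish s (sgn (Fin.suc k)) _))) (+-identityʳ _))
    where
    vanish : ∀ s a b → a * ((- s + 1ℤ * s) * b) ≡ 0ℤ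
    vanish = solve 3 (λ s a b → a :* ((:- s :+ con 1ℤ :* s) :* b) := con 0ℤ) refl
  -- Subtracting x_k times the other columns from the column of ones leaves 1 + s (e · x) on top and
  -- e - M x = c y below it, so all minors but the first vanish modulo c.
  rhs : D (ins zero (v M x) (N M)) ≡ (1ℤ + s * sumFin x) * D M + tail
  rhs = trans (D-ins zero (v M x) (N M)) (cong (_+ tail) (trans (*-identityˡ _) (cong (_* D M) v0)))
  difference : D (λ i j → M i j + s) - (1ℤ + s * sumFin x) * D M ≡ tail
  difference = trans (cong (_- (1ℤ + s * sumFin x) * D M) (trans (sym lhs) (trans (D-rank-one ones (N M) (λ _ → s)) (trans (sym (D-ins-+comb ones (N M) (λ k → - x k))) rhs))))
    (cancel _ tail)
    where
    cancel : ∀ a b → a + b - a ≡ b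
    cancel = solve 2 (λ a b → a :+ b :- a := b) refl

-- The given determinant and characteristic polynomial, evaluated at integers.

module _ {R : Set} (0r 1r : R) (_⊕_ : R → R → R) (neg : R → R) where

  -- Recursion by two, like the sign function inside `Det.det`, so that both sides reduce in step.
  altSum : ∀ {m} → (Fin m → R) → R
  altSum {zero}        F = 0r
  altSum {suc zero}    F = F zero ⊕ 0r
  altSum {suc (suc m)} F = F zero ⊕ (neg (F (suc zero)) ⊕ altSum (λ j → F (suc (suc j))))

  private
    -- With the first projection as multiplication, the minors disappear and the determinant is its
    -- own alternating sum over the first row.
    first : R → R → R
    first a b = a

    withFirstRow : ∀ {n} (a b : R) (F : Fin n → R) → Fin (suc (suc n)) → Fin (suc (suc n)) → R
    withFirstRow a b F i zero          = a
    withFirstRow a b F i (suc zero)    = b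
    withFirstRow a b F i (suc (suc j)) = F j

    -- The summation inside Det.det is a local function without a name. Its general
    -- instance, the underscore in the type of local-sum, is recovered by unification
    -- from the with-abstraction in local-sum-instance.
    mutual
      local-sum : ∀ {k} (M : Fin (suc k) → Fin (suc k) → R) (_⊛_ : R → R → R) {w} (F : Fin w → R) → _ ≡ altSum F

      local-sum-instance : ∀ {n} (a b : R) (F : Fin n → R) →
        Det.det 0r 1r _⊕_ first neg (withFirstRow a b F) ≡ (a ⊕ (neg b ⊕ altSum F))
      local-sum-instance {n} a b F with first | suc n | withFirstRow a b F
      ... | _⊛_ | k | M = cong (λ x → a ⊕ (neg b ⊕ x)) (local-sum M _⊛_ F)

      local-sum M _⊛_ {zero}        F = refl
      local-sum M _⊛_ {suc zero}    F = refl
      local-sum M _⊛_ {suc (suc w)} F = cong (λ x → F zero ⊕ (neg (F (suc zero)) ⊕ x)) (local-sum M _⊛_ (λ j → F (suc (suc j))))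

  det-suc : ∀ (_⊛_ : R → R → R) {n : ℕ} (M : Fin (suc n) → Fin (suc n) → R) →
    Det.det 0r 1r _⊕_ _⊛_ neg M ≡ altSum (λ j → M zero j ⊛ Det.det 0r 1r _⊕_ _⊛_ neg (λ r c → M (suc r) (punchIn j c)))
  det-suc _⊛_ {zero}  M = refl
  det-suc _⊛_ {suc n} M = cong (λ x → F zero ⊕ (neg (F (suc zero)) ⊕ x)) (local-sum M _⊛_ (λ j → F (suc (suc j))))
    where
    F : Fin (suc (suc n)) → R
    F j = M zero j ⊛ Det.det 0r 1r _⊕_ _⊛_ neg (λ r c → M (suc r) (punchIn j c))

eval : ℤ → Poly → ℤ
eval t []      = 0ℤ
eval t (a ∷ p) = a + t * eval t p

opaque
  unfolding _+_

  eval-padd : ∀ t p q → eval t (padd p q) ≡ eval t p + eval t q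
  eval-padd t []      q       = sym (+-identityˡ _)
  eval-padd t (a ∷ p) []      = sym (+-identityʳ _)
  eval-padd t (a ∷ p) (b ∷ q) = trans (cong (λ x → a + b + t * x) (eval-padd t p q)) (lem a b t (eval t p) (eval t q))
    where
    lem : ∀ a b t x y → a + b + t * (x + y) ≡ (a + t * x) + (b + t * y)
    lem = solve 5 (λ a b t x y → a :+ b :+ t :* (x :+ y) := (a :+ t :* x) :+ (b :+ t :* y)) refl

  eval-map : ∀ t a p → eval t (map (a ℤ.*_) p) ≡ a * eval t p
  eval-map t a []      = sym (*-zeroʳ a)
  eval-map t a (b ∷ p) = trans (cong (λ x → a * b + t * x) (eval-map t a p)) (lem a b t (eval t p))
    where
    lem : ∀ a b t x → a * b + t * (a * x) ≡ a * (b + t * x)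
    lem = solve 4 (λ a b t x → a :* b :+ t :* (a :* x) := a :* (b :+ t :* x)) refl

  eval-pneg : ∀ t p → eval t (pneg p) ≡ - eval t p
  eval-pneg t []      = refl
  eval-pneg t (b ∷ p) = trans (cong (λ x → - b + t * x) (eval-pneg t p)) (lem b t (eval t p))
    where
    lem : ∀ b t x → - b + t * - x ≡ - (b + t * x)
    lem = solve 3 (λ b t x → :- b :+ t :* :- x := :- (b :+ t :* x)) refl

eval-pmul : ∀ t p q → eval t (pmul p q) ≡ eval t p * eval t q
eval-pmul t []      q = sym (*-zeroˡ _)
eval-pmul t (a ∷ p) q = trans (eval-padd t (map (a ℤ.*_) q) (0ℤ ∷ pmul p q))
  (trans (cong₂ (λ x y → x + (0ℤ + t * y)) (eval-map t a q) (eval-pmul t p q)) (lem a (eval t q) t (eval t p)))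
  where
  lem : ∀ a y t x → a * y + (0ℤ + t * (x * y)) ≡ (a + t * x) * y
  lem = solve 4 (λ a y t x → a :* y :+ (con 0ℤ :+ t :* (x :* y)) := (a :+ t :* x) :* y) refl

eval-cong : ∀ t p q → (∀ k → coeff p k ≡ coeff q k) → eval t p ≡ eval t q
eval-cong t []      []      h = refl
eval-cong t []      (b ∷ q) h = sym (trans (cong₂ (λ x y → x + t * y) (sym (h 0)) (sym (eval-cong t [] q (h ∘ suc)))) (lem t))
  where
  lem : ∀ t → 0ℤ + t * 0ℤ ≡ 0ℤ
  lem = solve 1 (λ t → con 0ℤ :+ t :* con 0ℤ := con 0ℤ) refl
eval-cong t (a ∷ p) []      h = trans (cong₂ (λ x y → x + t * y) (h 0) (eval-cong t p [] (h ∘ suc))) (lem t)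
  where
  lem : ∀ t → 0ℤ + t * 0ℤ ≡ 0ℤ
  lem = solve 1 (λ t → con 0ℤ :+ t :* con 0ℤ := con 0ℤ) refl
eval-cong t (a ∷ p) (b ∷ q) h = cong₂ (λ x y → x + t * y) (h 0) (eval-cong t p q (h ∘ suc))

eval-altSum : ∀ t {m} (F : Fin m → Poly) → eval t (altSum [] (1ℤ ∷ []) padd pneg F) ≡ sumFin (λ j → sgn j * eval t (F j))
eval-altSum t {zero} F = sym (sum-nil _)
eval-altSum t {suc zero} F = trans (eval-padd t (F zero) []) (trans (cong₂ _+_ (sym (*-identityˡ _)) (sym (sum-nil _))) (sym (sum-suc {0} _)))
eval-altSum t {suc (suc m)} F = trans (eval-padd t (F zero) _) (trans (cong (eval t (F zero) +_)
    (trans (eval-padd t (pneg (F (suc zero))) _) (cong₂ _+_ (eval-pneg t (F (suc zero))) (eval-altSum t (λ j → F (suc (suc j)))))))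
  (trans (cong₂ _+_ (sym (*-identityˡ _)) (trans (cong₂ _+_ (sym (-1* _)) (sum-cong (λ j → cong (_* eval t (F (suc (suc j)))) (sym (neg-neg (sgn j)))))) (sym (sum-suc {m} _)))) (sym (sum-suc {suc m} _))))
  where
  neg-neg : ∀ x → - - x ≡ x
  neg-neg = solve 1 (λ x → :- :- x := x) refl

eval-det : ∀ t {n} (M : Fin n → Fin n → Poly) → eval t (detP M) ≡ D (λ i j → eval t (M i j))
eval-det t {zero}  M = trans (lem t) (sym (D-nil _))
  where
  lem : ∀ t → 1ℤ + t * 0ℤ ≡ 1ℤ
  lem = solve 1 (λ t → con 1ℤ :+ t :* con 0ℤ := con 1ℤ) refl
eval-det t {suc n} M = trans (cong (eval t) (det-suc [] (1ℤ ∷ []) padd pneg pmul M)) (trans (eval-altSum t _)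
  (trans (sum-cong (λ j → cong (sgn j *_) (trans (eval-pmul t (M zero j) _) (cong (eval t (M zero j) *_) (eval-det t (λ r c → M (suc r) (punchIn j c)))))))
    (sym (D-suc _))))

opaque
  unfolding _+_

  eval-charPoly : ∀ t {n} (A : Mat n) → eval t (charPoly A) ≡ D (λ i j → - A i j + t * idMat i j)
  eval-charPoly t A = trans (eval-det t _) (D-cong (λ i j → cong (λ x → - A i j + t * x) (entry t (idMat i j))))
    where
    entry : ∀ t x → x + t * 0ℤ ≡ x
    entry = solve 2 (λ t x → x :+ t :* con 0ℤ := x) refl

cospectral-D : ∀ {n} {A B : Mat n} → Cospectral A B → ∀ t → D (λ i j → - A i j + t * idMat i j) ≡ D (λ i j → - B i j + t * idMat i j)
cospectral-D {A = A} {B} h t = trans (sym (eval-charPoly t A)) (trans (eval-cong t (charPoly A) (charPoly B) h) (eval-charPoly t B))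

-- Generalized cospectral graphs have equal walk counts.

pow : ∀ {n} → Mat n → ℕ → V n
pow A zero    = λ _ → 1ℤ
pow A (suc k) = mulVec A (pow A k)

walks : ∀ {n} → Mat n → ℕ → ℤ
walks A k = sumFin (pow A k)

-- I - s A, whose determinant is the reversed characteristic polynomial and whose inverse, expanded
-- in powers of s, generates the walks.
resolvent : ∀ {n} → Mat n → ℤ → Mat n
resolvent A s i j = idMat i j - s * A i j

-- Modulo s t - 1 the integers s and t are inverse to each other, so det (t I - A) determines
-- det (I - s A); as t is arbitrary, the congruences are equalities.
D-resolvent : ∀ {n} (A B : Mat n) → (∀ t → D (λ i j → - A i j + t * idMat i j) ≡ D (λ i j → - B i j + t * idMat i j)) →
  ∀ k → D (resolvent A (ℤ.+ suc k)) ≡ D (resolvent B (ℤ.+ suc k))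
D-resolvent {n} A B h k = x-y≡0⇒x≡y (∣-pred-all k (λ t → subst (s * t - 1ℤ ∣_) (telescope _ _ _)
    (∣m∣n⇒∣m-n (congruence B t) (subst (λ x → s * t - 1ℤ ∣ s ^ n * x - D (resolvent A s)) (h t) (congruence A t)))))
  where
  s = ℤ.+ suc k
  telescope : ∀ x a b → (x - b) - (x - a) ≡ a - b
  telescope = solve 3 (λ x a b → (x :- b) :- (x :- a) := a :- b) refl
  congruence : ∀ (A : Mat n) t → s * t - 1ℤ ∣ s ^ n * D (λ i j → - A i j + t * idMat i j) - D (resolvent A s)
  congruence A t = subst (λ x → s * t - 1ℤ ∣ x - D (resolvent A s)) (D-scale s _)
    (D-cong-mod (λ i j → divides (idMat i j) (lem s t (A i j) (idMat i j))))
    where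
    lem : ∀ s t a d → s * (- a + t * d) - (d - s * a) ≡ d * (s * t - 1ℤ)
    lem = solve 4 (λ s t a d → s :* (:- a :+ t :* d) :- (d :- s :* a) := d :* (s :* t :- con 1ℤ)) refl

compl-entry : ∀ {n} (G : Graph n) i j t → - complAdjMat G i j + t * idMat i j ≡ (t + 1ℤ) * idMat i j + adjMat G i j - 1ℤ
compl-entry G i j t with i Fin.≟ j
... | yes refl rewrite Graph.irrefl G i = lem t
  where
  lem : ∀ t → - 0ℤ + t * 1ℤ ≡ (t + 1ℤ) * 1ℤ + 0ℤ - 1ℤ
  lem = solve 1 (λ t → :- con 0ℤ :+ t :* con 1ℤ := (t :+ con 1ℤ) :* con 1ℤ :+ con 0ℤ :- con 1ℤ) refl
... | no _ with adj G i j
... | true = lem t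
  where
  lem : ∀ t → - 0ℤ + t * 0ℤ ≡ (t + 1ℤ) * 0ℤ + 1ℤ - 1ℤ
  lem = solve 1 (λ t → :- con 0ℤ :+ t :* con 0ℤ := (t :+ con 1ℤ) :* con 0ℤ :+ con 1ℤ :- con 1ℤ) refl
... | false = lem t
  where
  lem : ∀ t → - 1ℤ + t * 0ℤ ≡ (t + 1ℤ) * 0ℤ + 0ℤ - 1ℤ
  lem = solve 1 (λ t → :- con 1ℤ :+ t :* con 0ℤ := (t :+ con 1ℤ) :* con 0ℤ :+ con 0ℤ :- con 1ℤ) refl

-- The complement has matrix J - I - A. Its characteristic matrix at t = - y - 1, multiplied by - s,
-- is s y I - s A + s J, which is I - s A + s J modulo s y - 1.
D-resolvent+ : ∀ {n} (G H : Graph n) → Cospectral (complAdjMat G) (complAdjMat H) →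
  ∀ k → D (λ i j → resolvent (adjMat G) (ℤ.+ suc k) i j + ℤ.+ suc k) ≡ D (λ i j → resolvent (adjMat H) (ℤ.+ suc k) i j + ℤ.+ suc k)
D-resolvent+ {n} G H h k = x-y≡0⇒x≡y (∣-pred-all k (λ y → subst (s * y - 1ℤ ∣_) (telescope _ _ _)
    (∣m∣n⇒∣m-n (congruence H y) (subst (λ x → s * y - 1ℤ ∣ (- s) ^ n * x - D (λ i j → resolvent (adjMat G) s i j + s)) (cospectral-D h (- y - 1ℤ)) (congruence G y)))))
  where
  s = ℤ.+ suc k
  telescope : ∀ x a b → (x - b) - (x - a) ≡ a - b
  telescope = solve 3 (λ x a b → (x :- b) :- (x :- a) := a :- b) refl
  congruence : ∀ (G : Graph n) y → s * y - 1ℤ ∣ (- s) ^ n * D (λ i j → - complAdjMat G i j + (- y - 1ℤ) * idMat i j) - D (λ i j → resolvent (adjMat G) s i j + s)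
  congruence G y = subst (λ x → s * y - 1ℤ ∣ x - D (λ i j → resolvent (adjMat G) s i j + s)) (D-scale (- s) _)
    (D-cong-mod (λ i j → divides (idMat i j) (trans (cong (λ x → - s * x - (resolvent (adjMat G) s i j + s)) (compl-entry G i j (- y - 1ℤ)))
      (lem s y (adjMat G i j) (idMat i j)))))
    where
    lem : ∀ s y a d → - s * ((- y - 1ℤ + 1ℤ) * d + a - 1ℤ) - (d - s * a + s) ≡ d * (s * y - 1ℤ)
    lem = solve 4 (λ s y a d → :- s :* ((:- y :- con 1ℤ :+ con 1ℤ) :* d :+ a :- con 1ℤ) :- (d :- s :* a :+ s) := d :* (s :* y :- con 1ℤ)) refl

-- The truncated Neumann series of the inverse of I - s A applied to e; K terms leave the error s^K
-- A^K e.
geometric : ∀ {n} → Mat n → ℤ → ℕ → V n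
geometric A s zero    = λ _ → 0ℤ
geometric A s (suc K) = lc 1ℤ (geometric A s K) (s ^ K) (pow A K)

resolvent-geometric : ∀ {n} (A : Mat n) s K r → 1ℤ - mulVec (resolvent A s) (geometric A s K) r ≡ s ^ K * pow A K r
resolvent-geometric {n} A s K r = trans (cong (λ x → 1ℤ - x) (apply (geometric A s K))) (main K)
  where
  apply : ∀ x → mulVec (resolvent A s) x r ≡ x r - s * mulVec A x r
  apply x = trans (sum-cong (λ k → lem (idMat r k) s (A r k) (x k))) (trans (sum-+ (λ k → idMat r k * x k) _)
    (cong₂ _+_ (sum-pick r x) (trans (sum-* (- s) _) (neg s _))))
    where
    lem : ∀ d s a x → (d - s * a) * x ≡ d * x + - s * (a * x)
    lem = solve 4 (λ d s a x → (d :- s :* a) :* x := d :* x :+ :- s :* (a :* x)) refl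
    neg : ∀ a b → - a * b ≡ - (a * b)
    neg = solve 2 (λ a b → :- a :* b := :- (a :* b)) refl
  main : ∀ K → 1ℤ - (geometric A s K r - s * mulVec A (geometric A s K) r) ≡ s ^ K * pow A K r
  main zero = trans (cong (λ x → 1ℤ - (0ℤ - s * x)) (sum-zero (λ k → *-zeroʳ (A r k)))) (lem s)
    where
    lem : ∀ s → 1ℤ - (0ℤ - s * 0ℤ) ≡ 1ℤ * 1ℤ
    lem = solve 1 (λ s → con 1ℤ :- (con 0ℤ :- s :* con 0ℤ) := con 1ℤ :* con 1ℤ) refl
  main (suc K) = trans (cong (λ x → 1ℤ - (lc 1ℤ (geometric A s K) (s ^ K) (pow A K) r - s * x)) (mulVec-lc A 1ℤ (geometric A s K) (s ^ K) (pow A K) r))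
    (trans (lem s (geometric A s K r) (s ^ K) (pow A K r) (mulVec A (geometric A s K) r) (pow A (suc K) r))
      (trans (cong (λ x → x - s ^ K * pow A K r + s * s ^ K * pow A (suc K) r) (main K)) (cancel (s ^ K * pow A K r) _)))
    where
    lem : ∀ s g p x a b → 1ℤ - (1ℤ * g + p * x - s * (1ℤ * a + p * b)) ≡ (1ℤ - (g - s * a)) - p * x + s * p * b
    lem = solve 6 (λ s g p x a b → con 1ℤ :- (con 1ℤ :* g :+ p :* x :- s :* (con 1ℤ :* a :+ p :* b)) := (con 1ℤ :- (g :- s :* a)) :- p :* x :+ s :* p :* b) refl
    cancel : ∀ x y → x - x + y ≡ y
    cancel = solve 2 (λ x y → x :- x :+ y := y) refl

sum-lc : ∀ {n} a (x : V n) b y → sumFin (lc a x b y) ≡ a * sumFin x + b * sumFin y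
sum-lc a x b y = trans (sum-+ _ _) (cong₂ _+_ (sum-* a x) (sum-* b y))

-- Modulo s^K the second determinant is the first times 1 + s Σ s^k walks_k, summed over k < K. If
-- all counts below k agree, s divides the difference of the k-th counts for every s > 0.
walks-equal : ∀ {n} (A B : Mat n) →
  (∀ k → D (resolvent A (ℤ.+ suc k)) ≡ D (resolvent B (ℤ.+ suc k))) →
  (∀ k → D (λ i j → resolvent A (ℤ.+ suc k) i j + ℤ.+ suc k) ≡ D (λ i j → resolvent B (ℤ.+ suc k) i j + ℤ.+ suc k)) →
  ∀ k → walks A k ≡ walks B k
walks-equal {n} A B h₁ h₂ = ℕ.<-rec _ step
  where
  σ : Mat n → ℤ → ℕ → ℤ
  σ A s K = sumFin (geometric A s K)
  σ-suc : ∀ A s K → σ A s (suc K) ≡ σ A s K + s ^ K * walks A K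
  σ-suc A s K = trans (sum-lc 1ℤ (geometric A s K) (s ^ K) (pow A K)) (cong (_+ s ^ K * walks A K) (*-identityˡ _))
  step : ∀ k → (∀ {i} → i ℕ.< k → walks A i ≡ walks B i) → walks A k ≡ walks B k
  step k ih = x-y≡0⇒x≡y (∣-all (λ m → divisible (ℤ.+ suc m) (λ ()) (h₁ m) (h₂ m)))
    where
    σ-eq : ∀ s j → j ℕ.≤ k → σ A s j ≡ σ B s j
    σ-eq s zero    _  = refl
    σ-eq s (suc j) lt = trans (σ-suc A s j) (trans (cong₂ (λ x y → x + s ^ j * y) (σ-eq s j (ℕ.<⇒≤ lt)) (ih lt)) (sym (σ-suc B s j)))
    divisible : ∀ s → s ≢ 0ℤ → D (resolvent A s) ≡ D (resolvent B s) →
      D (λ i j → resolvent A s i j + s) ≡ D (λ i j → resolvent B s i j + s) → s ∣ walks A k - walks B k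
    divisible s s≢0 e₁ e₂ = subst (s ∣_) (final ψ Δ) (∣m∣n⇒∣m-n
        (subst (s ∣_) (head Δ Δ′ s ψ) (∣m∣n⇒∣m-n c₃ (∣n*m (Δ′ * ψ))))
        (∣m⇒∣m*n Δ ψ≡1))
      where
      ψ = D (resolvent B s)
      Δ = walks A k - walks B k
      Δ′ = walks A (suc k) - walks B (suc k)
      -- Modulo s the resolvent is the identity, which lets the factor ψ be removed at the end.
      ψ≡1 : s ∣ ψ - 1ℤ
      ψ≡1 = subst (λ x → s ∣ ψ - x) (D-id n) (D-cong-mod (λ i j → divides (- B i j) (lem (idMat i j) s (B i j))))
        where
        lem : ∀ d s b → d - s * b - d ≡ - b * s
        lem = solve 3 (λ d s b → d :- s :* b :- d := :- b :* s) refl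
      -- The k-th count enters with the factor s^(k+1); one more power of s in the modulus leaves a
      -- congruence modulo s after cancellation.
      K = suc (suc k)
      approx : ∀ A → s ^ K ∣ D (λ i j → resolvent A s i j + s) - (1ℤ + s * σ A s K) * D (resolvent A s)
      approx A = D-+const (resolvent A s) s (geometric A s K) (s ^ K) (pow A K) (resolvent-geometric A s K)
      c₁ : s ^ K ∣ s * (σ A s K - σ B s K) * ψ
      c₁ = subst (s ^ K ∣_) (lem _ s (σ A s K) (σ B s K) ψ) (∣m∣n⇒∣m-n (approx B)
          (subst₂ (λ x y → s ^ K ∣ x - (1ℤ + s * σ A s K) * y) e₂ e₁ (approx A)))
        where
        lem : ∀ X s a b ψ → (X - (1ℤ + s * b) * ψ) - (X - (1ℤ + s * a) * ψ) ≡ s * (a - b) * ψ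
        lem = solve 5 (λ X s a b ψ → (X :- (con 1ℤ :+ s :* b) :* ψ) :- (X :- (con 1ℤ :+ s :* a) :* ψ) := s :* (a :- b) :* ψ) refl
      expand : ∀ A → σ A s K ≡ σ A s k + s ^ k * walks A k + s * s ^ k * walks A (suc k)
      expand A = trans (σ-suc A s (suc k)) (cong (_+ s * s ^ k * walks A (suc k)) (σ-suc A s k))
      c₂ : s ^ suc k * s ∣ s ^ suc k * ((Δ + s * Δ′) * ψ)
      c₂ = subst₂ _∣_ (*-comm s _) (trans (cong₂ (λ x y → s * (x - y) * ψ) (trans (expand A) (cong (λ x → x + s ^ k * walks A k + s * s ^ k * walks A (suc k)) (σ-eq s k ℕ.≤-refl))) (expand B))
          (lem s (σ B s k) (s ^ k) (walks A k) (walks A (suc k)) (walks B k) (walks B (suc k)) ψ)) c₁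
        where
        lem : ∀ s x p a a′ b b′ ψ → s * ((x + p * a + s * p * a′) - (x + p * b + s * p * b′)) * ψ ≡ s * p * ((a - b + s * (a′ - b′)) * ψ)
        lem = solve 8 (λ s x p a a′ b b′ ψ → s :* ((x :+ p :* a :+ s :* p :* a′) :- (x :+ p :* b :+ s :* p :* b′)) :* ψ := s :* p :* ((a :- b :+ s :* (a′ :- b′)) :* ψ)) refl
      c₃ : s ∣ (Δ + s * Δ′) * ψ
      c₃ = ∣-cancelˡ (s ^ suc k) (^-nonzero (suc k) s≢0) c₂
      head : ∀ Δ Δ′ s ψ → (Δ + s * Δ′) * ψ - s * (Δ′ * ψ) ≡ Δ * ψ
      head = solve 4 (λ Δ Δ′ s ψ → (Δ :+ s :* Δ′) :* ψ :- s :* (Δ′ :* ψ) := Δ :* ψ) refl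
      final : ∀ ψ Δ → Δ * ψ - (ψ - 1ℤ) * Δ ≡ Δ
      final = solve 2 (λ ψ Δ → Δ :* ψ :- (ψ :- con 1ℤ) :* Δ := Δ) refl

genCospectral⇒walks : ∀ {n} (G H : Graph n) → GenCospectral G H → ∀ k → walks (adjMat G) k ≡ walks (adjMat H) k
genCospectral⇒walks G H (c , c̄) = walks-equal (adjMat G) (adjMat H) (D-resolvent _ _ (cospectral-D c)) (D-resolvent+ G H c̄)

-- The scaled orthogonal matrix between two graphs with equal walk counts.

Symmetric : ∀ {n} → Mat n → Set
Symmetric A = ∀ i j → A i j ≡ A j i

dot-sym : ∀ {n} {A : Mat n} → Symmetric A → ∀ x y → dot x (mulVec A y) ≡ dot (mulVec A x) y
dot-sym {A = A} s x y = trans (dot-mulVec x A y) (dot-cong (mulVec-congˡ (λ i j → s j i) x) (λ _ → refl))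

ones : ∀ {n} → V n
ones _ = 1ℤ

sum≡dot : ∀ {n} (x : V n) → sumFin x ≡ dot ones x
sum≡dot x = sum-cong (λ i → sym (*-identityˡ (x i)))

walk : ∀ {n} → Mat n → Mat n
walk A i j = pow A (toℕ j) i

iter : ∀ {n} → Mat n → ℕ → V n → V n
iter A zero    x = x
iter A (suc k) x = mulVec A (iter A k x)

iter-cong : ∀ {n} (A : Mat n) k {x y} → x ≗ y → iter A k x ≗ iter A k y
iter-cong A zero    p = p
iter-cong A (suc k) p = mulVec-cong A (iter-cong A k p)

iter-lc : ∀ {n} (A : Mat n) k a x b y → iter A k (lc a x b y) ≗ lc a (iter A k x) b (iter A k y)
iter-lc A zero    a x b y i = refl
iter-lc A (suc k) a x b y i = trans (mulVec-cong A (iter-lc A k a x b y) i) (mulVec-lc A a (iter A k x) b (iter A k y) i)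

iter-comm : ∀ {n} (A : Mat n) k x → iter A k (mulVec A x) ≗ mulVec A (iter A k x)
iter-comm A zero    x i = refl
iter-comm A (suc k) x i = mulVec-cong A (iter-comm A k x) i

iter-pow : ∀ {n} (A : Mat n) k i → iter A k (pow A i) ≗ pow A (k ℕ.+ i)
iter-pow A zero    i _ = refl
iter-pow A (suc k) i = mulVec-cong A (iter-pow A k i)

dot-iter : ∀ {n} {A : Mat n} → Symmetric A → ∀ k x y → dot x (iter A k y) ≡ dot (iter A k x) y
dot-iter s zero x y = refl
dot-iter {A = A} s (suc k) x y = trans (dot-sym s x _) (trans (dot-iter s k (mulVec A x) y) (dot-cong (iter-comm A k x) (λ _ → refl)))

dot-pow : ∀ {n} {A : Mat n} → Symmetric A → ∀ i j → dot (pow A i) (pow A j) ≡ walks A (i ℕ.+ j)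
dot-pow {A = A} s i j = trans (dot-cong (λ k → trans (cong (λ m → pow A m k) (sym (ℕ.+-identityʳ i))) (sym (iter-pow A i 0 k))) (λ _ → refl))
  (trans (sym (dot-iter s i ones (pow A j))) (trans (sym (sum≡dot _)) (sum-cong (iter-pow A i j))))

dot-gram : ∀ {m n} (M N : Fin m → Fin n → ℤ) x y →
  dot (mulVec M x) (mulVec N y) ≡ sumFin (λ i → x i * sumFin (λ j → y j * dot (λ k → M k i) (λ k → N k j)))
dot-gram M N x y = trans (sym (dot-mulVecᵀ x M (mulVec N y))) (sum-cong (λ i → cong (x i *_)
  (trans (dot-congʳ (λ k → M k i) (λ k → dot-comm (N k) y)) (dot-sumʳ (λ k → M k i) y (λ j k → N k j)))))

-- P is δ times the rational orthogonal matrix conjugating A into B.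
record Mate {n} (A B : Mat n) (δ : ℤ) : Set where
  field
    P   : Mat n
    PᵀP : ∀ x → mulVec (P ᵀ) (mulVec P x) ≗ λ i → δ * δ * x i
    PPᵀ : ∀ x → mulVec P (mulVec (P ᵀ) x) ≗ λ i → δ * δ * x i
    Pe  : ∀ i → mulVec P ones i ≡ δ
    PA  : ∀ x → mulVec P (mulVec A x) ≗ mulVec B (mulVec P x)

-- PᵀP = c makes c - PPᵀ a matrix whose entries have square sum zero.
left-orthogonal⇒right : ∀ {n} (P : Mat n) c → (∀ k l → dot (λ i → P i k) (λ i → P i l) ≡ c * idMat k l) →
  ∀ i j → dot (P i) (P j) ≡ c * idMat i j
left-orthogonal⇒right {n} P c h i j = sym (x-y≡0⇒x≡y (square≡0 _
    (sum-nonneg≡0 (λ j → square-nonneg (E i j)) (sum-nonneg≡0 (λ i → sum-nonneg (λ j → square-nonneg (E i j))) total i) j)))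
  where
  E : Mat n
  E i j = c * idMat i j - dot (P i) (P j)
  sum₂ : (Fin n → Fin n → ℤ) → ℤ
  sum₂ f = sumFin (λ i → sumFin (f i))
  sum₂-lc : ∀ a f b g → sum₂ (λ i j → a * f i j + b * g i j) ≡ a * sum₂ f + b * sum₂ g
  sum₂-lc a f b g = trans (sum-cong (λ i → trans (sum-+ _ _) (cong₂ _+_ (sum-* a (f i)) (sum-* b (g i)))))
    (trans (sum-+ _ _) (cong₂ _+_ (sum-* a _) (sum-* b _)))
  trace : ∀ (f : Fin n → Fin n → ℤ) → sum₂ (λ i j → idMat i j * f i j) ≡ sumFin (λ i → f i i)
  trace f = sum-cong (λ i → sum-pick i (f i))
  Gr Gc : Fin n → Fin n → ℤ
  Gr i j = dot (P i) (P j)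
  Gc k l = dot (λ i → P i k) (λ i → P i l)
  trace-eq : sumFin (λ i → Gr i i) ≡ sumFin (λ k → Gc k k)
  trace-eq = sum-swap (λ i k → P i k * P i k)
  square-expand : ∀ (P : Mat n) → sum₂ (λ i j → dot (P i) (P j) * dot (P i) (P j)) ≡
    sum₂ (λ i j → sum₂ (λ k l → P i k * P j k * (P i l * P j l)))
  square-expand P = sum-cong λ i → sum-cong λ j → trans (sym (sum-* (dot (P i) (P j)) _))
    (sum-cong (λ k → trans (*-comm (dot (P i) (P j)) _) (sym (sum-* (P i k * P j k) _))))
  swap₄ : sum₂ (λ i j → sum₂ (λ k l → P i k * P j k * (P i l * P j l))) ≡ sum₂ (λ k l → sum₂ (λ i j → P i k * P j k * (P i l * P j l)))
  swap₄ = trans (sum-cong (λ i → trans (sum-swap (λ j k → sumFin (λ l → P i k * P j k * (P i l * P j l))))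
      (sum-cong (λ k → sum-swap (λ j l → P i k * P j k * (P i l * P j l))))))
    (trans (sum-swap (λ i k → sumFin (λ l → sumFin (λ j → P i k * P j k * (P i l * P j l)))))
      (sum-cong (λ k → sum-swap (λ i l → sumFin (λ j → P i k * P j k * (P i l * P j l))))))
  squares : sum₂ (λ i j → Gr i j * Gr i j) ≡ sum₂ (λ k l → Gc k l * Gc k l)
  squares = trans (square-expand P) (trans swap₄ (trans
    (sum-cong λ k → sum-cong λ l → sum-cong λ i → sum-cong λ j → rearrange (P i k) (P j k) (P i l) (P j l))
    (sym (square-expand (P ᵀ)))))
    where
    rearrange : ∀ a b c d → a * b * (c * d) ≡ a * c * (b * d)
    rearrange = solve 4 (λ a b c d → a :* b :* (c :* d) := a :* c :* (b :* d)) refl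
  T = sumFin {n} (λ _ → 1ℤ)
  diag-id : sumFin {n} (λ i → idMat i i) ≡ T
  diag-id = sum-cong id-diag
  Gc-trace : sumFin (λ k → Gc k k) ≡ c * T
  Gc-trace = trans (sum-cong (λ k → h k k)) (trans (sum-* c (λ k → idMat k k)) (cong (c *_) diag-id))
  Gc-squares : sum₂ (λ k l → Gc k l * Gc k l) ≡ c * c * T
  Gc-squares = trans (sum-cong (λ k → sum-cong (λ l → trans (cong₂ _*_ (h k l) (h k l)) (lem c (idMat k l)))))
    (trans (trace (λ k l → c * c * idMat k l)) (trans (sum-* (c * c) (λ k → idMat k k)) (cong (c * c *_) diag-id)))
    where
    lem : ∀ c d → c * d * (c * d) ≡ d * (c * c * d)
    lem = solve 2 (λ c d → c :* d :* (c :* d) := d :* (c :* c :* d)) refl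
  total : sum₂ (λ i j → E i j * E i j) ≡ 0ℤ
  total = trans (sum-cong (λ i → sum-cong (λ j → square c (idMat i j) (Gr i j))))
    (trans (sum₂-lc 1ℤ (λ i j → idMat i j * f i j) 1ℤ (λ i j → Gr i j * Gr i j))
    (trans (cong₂ (λ x y → 1ℤ * x + 1ℤ * y) (trans (trace f) (trans (sum-+ (λ i → c * c * idMat i i) _)
        (cong₂ _+_ (trans (sum-* (c * c) (λ i → idMat i i)) (cong (c * c *_) diag-id)) (trans (sum-* (- (2ℤ * c)) (λ i → Gr i i)) (cong (- (2ℤ * c) *_) (trans trace-eq Gc-trace))))))
      (trans squares Gc-squares))
    (cancel c T)))
    where
    f : Fin n → Fin n → ℤ
    f i j = c * c * idMat i j + - (2ℤ * c) * Gr i j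
    square : ∀ c d g → (c * d - g) * (c * d - g) ≡ 1ℤ * (d * (c * c * d + - (2ℤ * c) * g)) + 1ℤ * (g * g)
    square = solve 3 (λ c d g → (c :* d :- g) :* (c :* d :- g) := con 1ℤ :* (d :* (c :* c :* d :+ :- (con 2ℤ :* c) :* g)) :+ con 1ℤ :* (g :* g)) refl
    cancel : ∀ c t → 1ℤ * (c * c * t + - (2ℤ * c) * (c * t)) + 1ℤ * (c * c * t) ≡ 0ℤ
    cancel = solve 2 (λ c t → con 1ℤ :* (c :* c :* t :+ :- (con 2ℤ :* c) :* (c :* t)) :+ con 1ℤ :* (c :* c :* t) := con 0ℤ) refl

module _ {n} {A B : Mat (suc n)} (symA : Symmetric A) (symB : Symmetric B) (same : ∀ k → walks A k ≡ walks B k)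
  {δ} (δ≢0 : δ ≢ 0ℤ) (X : Mat (suc n))
  (WX : ∀ x → mulVec (walk A) (mulVec X x) ≗ λ i → δ * x i) (XW : ∀ x → mulVec X (mulVec (walk A) x) ≗ λ i → δ * x i) where

  private
    P : Mat (suc n)
    P i j = sumFin (λ k → walk B i k * X k j)

    applyP : ∀ x → mulVec P x ≗ mulVec (walk B) (mulVec X x)
    applyP = mulVec-∘ (walk B) X

    gram : ∀ x y → dot (mulVec (walk B) x) (mulVec (walk B) y) ≡ dot (mulVec (walk A) x) (mulVec (walk A) y)
    gram x y = trans (dot-gram (walk B) (walk B) x y) (trans (sum-cong (λ i → cong (x i *_) (sum-cong (λ j → cong (y j *_)
      (trans (dot-pow symB (toℕ i) (toℕ j)) (trans (sym (same (toℕ i ℕ.+ toℕ j))) (sym (dot-pow symA (toℕ i) (toℕ j))))))))) (sym (dot-gram (walk A) (walk A) x y)))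

    -- A matrix inserted between the two factors raises every walk index by one, so equal counts
    -- also give Pᵀ B P = δ² A.
    gram₁ : ∀ x y → dot (mulVec (walk B) x) (mulVec B (mulVec (walk B) y)) ≡ dot (mulVec (walk A) x) (mulVec A (mulVec (walk A) y))
    gram₁ x y = trans (shift B x y) (trans (dot-gram (walk B) (λ i j → pow B (suc (toℕ j)) i) x y) (trans (sum-cong (λ i → cong (x i *_) (sum-cong (λ j → cong (y j *_)
      (trans (dot-pow symB (toℕ i) (suc (toℕ j))) (trans (sym (same (toℕ i ℕ.+ suc (toℕ j)))) (sym (dot-pow symA (toℕ i) (suc (toℕ j)))))))))) (trans (sym (dot-gram (walk A) (λ i j → pow A (suc (toℕ j)) i) x y)) (sym (shift A x y)))))
      where
      shift : ∀ C x y → dot (mulVec (walk C) x) (mulVec C (mulVec (walk C) y)) ≡ dot (mulVec (walk C) x) (mulVec (λ i j → pow C (suc (toℕ j)) i) y)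
      shift C x y = dot-congʳ (mulVec (walk C) x) (λ i → sym (mulVec-∘ C (walk C) y i))

    dotP : ∀ x y → dot (mulVec P x) (mulVec P y) ≡ δ * δ * dot x y
    dotP x y = trans (dot-cong (applyP x) (applyP y)) (trans (gram (mulVec X x) (mulVec X y)) (trans (dot-cong (WX x) (WX y))
      (trans (dot-*ˡ δ x _) (trans (cong (δ *_) (dot-*ʳ x δ y)) (sym (*-assoc δ δ _))))))

    dotPB : ∀ x y → dot (mulVec P x) (mulVec B (mulVec P y)) ≡ δ * δ * dot x (mulVec A y)
    dotPB x y = trans (dot-cong (applyP x) (mulVec-cong B (applyP y))) (trans (gram₁ (mulVec X x) (mulVec X y)) (trans (dot-cong (WX x) (λ i → trans (mulVec-cong A (WX y) i) (mulVec-* A δ y i)))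
      (trans (dot-*ˡ δ x _) (trans (cong (δ *_) (dot-*ʳ x δ _)) (sym (*-assoc δ δ _))))))

    PᵀP : ∀ x → mulVec (P ᵀ) (mulVec P x) ≗ λ i → δ * δ * x i
    PᵀP x = dot-ext (λ z → trans (dot-mulVecᵀ z P _) (trans (dotP z x) (sym (dot-*ʳ z (δ * δ) x))))

    rows : ∀ i j → dot (P i) (P j) ≡ δ * δ * idMat i j
    rows = left-orthogonal⇒right P (δ * δ) (λ k l → trans (sym (dot-cong (mulVec-unit P k) (mulVec-unit P l))) (trans (dotP (idMat k) (idMat l)) (cong (δ * δ *_) (trans (unit-dot k (idMat l)) (id-sym l k)))))

    PPᵀ : ∀ x → mulVec P (mulVec (P ᵀ) x) ≗ λ i → δ * δ * x i
    PPᵀ x i = trans (dot-mulVecᵀ (P i) P x) (trans (sum-cong (λ j → trans (cong (_* x j) (trans (dot-comm (P j) (P i)) (rows i j))) (*-assoc (δ * δ) _ _))) (trans (sum-* (δ * δ) _) (cong (δ * δ *_) (sum-pick i x))))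

    ones≗ : ∀ (C : Mat (suc n)) → mulVec (walk C) (idMat zero) ≗ ones
    ones≗ C i = mulVec-unit (walk C) zero i

    Pe : ∀ i → mulVec P ones i ≡ δ
    Pe i = trans (applyP ones i) (trans (mulVec-cong (walk B) (λ j → trans (mulVec-cong X (λ k → sym (ones≗ A k)) j) (XW (idMat zero) j)) i)
      (trans (mulVec-* (walk B) δ (idMat zero) i) (trans (cong (δ *_) (ones≗ B i)) (*-identityʳ δ))))

    δδ≢0 : δ * δ ≢ 0ℤ
    δδ≢0 eq = δ≢0 (*≡0 δ δ≢0 eq)

    -- Multiply Pᵀ B P = δ² A by P on the left and cancel P Pᵀ = δ².
    PA : ∀ x → mulVec P (mulVec A x) ≗ mulVec B (mulVec P x)
    PA x i = sym (*-cancelˡ (δ * δ) δδ≢0 (trans (sym (PPᵀ (mulVec B (mulVec P x)) i)) (trans (mulVec-cong P PᵀBP i) (mulVec-* P (δ * δ) (mulVec A x) i))))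
      where
      PᵀBP : mulVec (P ᵀ) (mulVec B (mulVec P x)) ≗ λ i → δ * δ * mulVec A x i
      PᵀBP = dot-ext (λ z → trans (dot-mulVecᵀ z P _) (trans (dotPB z x) (sym (dot-*ʳ z (δ * δ) _))))

  mate : Mate A B δ
  mate = record { P = P ; PᵀP = PᵀP ; PPᵀ = PPᵀ ; Pe = Pe ; PA = PA }

-- Coordinates adapted to the Smith normal form of the walk matrix.

record Smith {n} (W : Mat n) (d : V n) : Set where
  field
    U U′ T T′ : Mat n
    UU′ : ∀ x → mulVec U (mulVec U′ x) ≗ x
    U′U : ∀ x → mulVec U′ (mulVec U x) ≗ x
    TT′ : ∀ x → mulVec T (mulVec T′ x) ≗ x
    WT  : ∀ x → mulVec W (mulVec T x) ≗ mulVec U′ (λ i → d i * x i)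

opaque
  unfolding sumFin _+_

  defs-sum : ∀ {n} (f : V n) → Defs.sumFin f ≡ sumFin f
  defs-sum {zero}  f = refl
  defs-sum {suc n} f = cong (f zero +_) (defs-sum (f ∘ suc))

  defs-mulVec : ∀ {n} (M : Mat n) x → Defs.mulVec M x ≗ mulVec M x
  defs-mulVec M x i = defs-sum (λ k → M i k * x k)

  defs-· : ∀ {n} (M N : Mat n) i j → (M Defs.· N) i j ≡ sumFin (λ k → M i k * N k j)
  defs-· M N i j = defs-sum (λ k → M i k * N k j)

defs-·-apply : ∀ {n} (M N : Mat n) x → mulVec (M Defs.· N) x ≗ mulVec M (mulVec N x)
defs-·-apply M N x i = trans (mulVec-congˡ (defs-· M N) x i) (mulVec-∘ M N x i)

powE≡pow : ∀ {n} (A : Mat n) k → powE A k ≗ pow A k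
powE≡pow A zero    i = refl
powE≡pow A (suc k) i = trans (defs-mulVec A (powE A k) i) (mulVec-cong A (powE≡pow A k) i)

inverse-apply : ∀ {n} (M N : Mat n) → (∀ i j → (M Defs.· N) i j ≡ idMat i j) → ∀ x → mulVec M (mulVec N x) ≗ x
inverse-apply M N h x i = trans (sym (defs-·-apply M N x i)) (trans (mulVec-congˡ h x i) (mulVec-id x i))

diag-apply : ∀ {n} (d : Fin n → ℕ) (x : V n) → mulVec (diagMat d) x ≗ λ i → ℤ.+ d i * x i
diag-apply d x i = trans (sum-cong (λ j → trans (cong (_* x j) (entry i j)) (*-assoc (idMat i j) _ _))) (sum-pick i (λ j → ℤ.+ d i * x j))
  where
  entry : ∀ i j → diagMat d i j ≡ idMat i j * ℤ.+ d i
  entry i j with i Fin.≟ j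
  ... | yes _ = sym (*-identityˡ _)
  ... | no  _ = sym (*-zeroˡ _)

smith : ∀ {n} (G : Graph n) d → IsInvariantFactors (walkMat G) d → Smith (walk (adjMat G)) (λ i → ℤ.+ d i)
smith G d (U , T , (U′ , uu′ , u′u) , (T′ , tt′ , _) , eq , _) = record
  { U = U ; U′ = U′ ; T = T ; T′ = T′
  ; UU′ = inverse-apply U U′ uu′ ; U′U = inverse-apply U′ U u′u ; TT′ = inverse-apply T T′ tt′
  ; WT = λ x i → trans (sym (inverse-apply U′ U u′u (mulVec (walk (adjMat G)) (mulVec T x)) i)) (mulVec-cong U′ (λ j →
      trans (mulVec-cong U (λ k → mulVec-congˡ (λ a b → sym (powE≡pow (adjMat G) (toℕ b) a)) (mulVec T x) k) j)
        (trans (sym (defs-·-apply U (walkMat G) (mulVec T x) j))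
        (trans (sym (defs-·-apply (U Defs.· walkMat G) T x j)) (trans (mulVec-congˡ eq x j) (diag-apply d x j))))) i) }

module SmithProperties {n} {W : Mat n} {d : V n} (S : Smith W d) where
  open Smith S public

  -- Coefficients of x with respect to the rows of `U`. In them, divisibility of Wᵀ x by m becomes m
  -- ∣ d_i coord_i for each i.
  coord : V n → V n
  coord = mulVec (U′ ᵀ)

  from-coord : ∀ x → mulVec (U ᵀ) (coord x) ≗ x
  from-coord = ᵀ-inverse U′ U U′U

  column : ∀ a k → mulVec W (λ m → T m a) k ≡ d a * U′ k a
  column a k = trans (mulVec-cong W (λ m → sym (mulVec-unit T a m)) k) (trans (WT (idMat a) k) (trans (mulVec-cong U′ (λ t → swap t) k)
    (trans (mulVec-* U′ (d a) (idMat a) k) (cong (d a *_) (mulVec-unit U′ a k)))))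
    where
    swap : ∀ t → d t * idMat a t ≡ d a * idMat a t
    swap t with a Fin.≟ t
    ... | yes refl = refl
    ... | no  _    = trans (*-zeroʳ (d t)) (sym (*-zeroʳ (d a)))

  coord-walk : ∀ x i → mulVec (T ᵀ) (mulVec (W ᵀ) x) i ≡ d i * coord x i
  coord-walk x i = trans (dot-mulVecᵀ (λ m → T m i) W x) (trans (dot-cong (column i) (λ _ → refl)) (dot-*ˡ (d i) (λ k → U′ k i) x))

  ∣-coord : ∀ {m} x → (∀ j → m ∣ mulVec (W ᵀ) x j) → ∀ i → m ∣ d i * coord x i
  ∣-coord {m} x h i = subst (m ∣_) (coord-walk x i) (mulVec-∣ (T ᵀ) h i)

  UW-T′ : ∀ x → mulVec U (mulVec W x) ≗ λ k → d k * mulVec T′ x k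
  UW-T′ x k = trans (mulVec-cong U (λ j → trans (mulVec-cong W (λ m → sym (TT′ x m)) j) (WT (mulVec T′ x) j)) k) (UU′ _ k)

  module _ (c : V n) {δ} (cd : ∀ i → c i * d i ≡ δ) where
    -- The integral matrix T diag(c) U = δ W⁻¹.
    X : Mat n
    X i j = sumFin (λ k → T i k * (c k * U k j))

    private
      X-apply : ∀ x → mulVec X x ≗ mulVec T (λ k → c k * mulVec U x k)
      X-apply x i = trans (mulVec-∘ T (λ k j → c k * U k j) x i) (mulVec-cong T (λ k → dot-*ˡ (c k) (U k) x) i)

    WX : ∀ x → mulVec W (mulVec X x) ≗ λ i → δ * x i
    WX x i = trans (mulVec-cong W (X-apply x) i) (trans (WT _ i) (trans (mulVec-cong U′ (λ k → trans (lem (d k) (c k) _) (cong (_* mulVec U x k) (cd k))) i)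
      (trans (mulVec-* U′ δ (mulVec U x) i) (cong (δ *_) (U′U x i)))))
      where
      lem : ∀ d c x → d * (c * x) ≡ c * d * x
      lem = solve 3 (λ d c x → d :* (c :* x) := c :* d :* x) refl

    XW : ∀ x → mulVec X (mulVec W x) ≗ λ i → δ * x i
    XW x i = trans (X-apply _ i) (trans (mulVec-cong T (λ k → trans (cong (c k *_) (UW-T′ x k)) (trans (sym (*-assoc (c k) (d k) _)) (cong (_* mulVec T′ x k) (cd k)))) i)
      (trans (mulVec-* T δ (mulVec T′ x) i) (cong (δ *_) (TT′ x i))))

  module _ (last : Fin n) (low : ∀ i → i ≢ last → d i ∣ 2ℤ) where

    -- By `column`, d_last ζ lies in W ℤⁿ. Up to elements killed by 2, the class of ζ generates ℤⁿ /
    -- W ℤⁿ.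
    ζ : V n
    ζ k = U′ k last

    -- The coordinate at `last` is ζ · y; the others are controlled by d_k ∣ 2.
    half-integral : ∀ {δ} y → (∀ j → δ ∣ mulVec (W ᵀ) y j) → δ ∣ 2ℤ * dot ζ y → ∀ i → δ ∣ 2ℤ * y i
    half-integral {δ} y h hζ i = subst (δ ∣_) (trans (mulVec-* (U ᵀ) 2ℤ (coord y) i) (cong (2ℤ *_) (from-coord y i))) (mulVec-∣ (U ᵀ) 2coord i)
      where
      2coord : ∀ k → δ ∣ 2ℤ * coord y k
      2coord k with k Fin.≟ last
      ... | yes refl = hζ
      ... | no k≢ = ∣-trans (∣-coord y h k) (*-mono-∣ (low k k≢) ∣-refl)

    split : ∀ x → Σ (V n) λ z → ∀ i → 2ℤ * x i ≡ mulVec W z i + 2ℤ * mulVec U x last * ζ i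
    split x = mulVec T w , λ i → trans (cong (2ℤ *_) (sym (U′U x i))) (trans (sym (mulVec-* U′ 2ℤ y i)) (trans (mulVec-cong U′ decomp i)
        (trans (mulVec-lc U′ 1ℤ (λ k → d k * w k) (2ℤ * y last) (idMat last) i)
          (cong₂ _+_ (trans (*-identityˡ _) (sym (WT w i))) (cong (2ℤ * y last *_) (mulVec-unit U′ last i))))))
      where
      y = mulVec U x
      w : V n
      w k with k Fin.≟ last
      ... | yes _ = 0ℤ
      ... | no k≢ = _∣_.quotient (low k k≢) * y k
      decomp : ∀ k → 2ℤ * y k ≡ lc 1ℤ (λ k → d k * w k) (2ℤ * y last) (idMat last) k
      decomp k with k Fin.≟ last
      ... | yes refl = trans (lem (d last) (2ℤ * y last)) (cong (λ t → 1ℤ * (d last * 0ℤ) + 2ℤ * y last * t) (sym (id-diag last)))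
        where
        lem : ∀ d y → y ≡ 1ℤ * (d * 0ℤ) + y * 1ℤ
        lem = solve 2 (λ d y → y := con 1ℤ :* (d :* con 0ℤ) :+ y :* con 1ℤ) refl
      ... | no k≢ = trans (cong (_* y k) (_∣_.equality (low k k≢))) (trans (lem _ (d k) (y k) (2ℤ * y last)) (cong (λ t → 1ℤ * (d k * (_∣_.quotient (low k k≢) * y k)) + 2ℤ * y last * t) (sym (id-off (k≢ ∘ sym)))))
        where
        lem : ∀ q d y z → q * d * y ≡ 1ℤ * (d * (q * y)) + z * 0ℤ
        lem = solve 4 (λ q d y z → q :* d :* y := con 1ℤ :* (d :* (q :* y)) :+ z :* con 0ℤ) refl

-- Linear algebra modulo 2 and the parity of walk counts.

odd? : ∀ x → Dec (Oddℤ x)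
odd? x with parity x
... | inj₁ p = no (λ q → odd-not-even q p)
... | inj₂ q = yes q

not-odd⇒even : ∀ {x} → ¬ Oddℤ x → 2ℤ ∣ x
not-odd⇒even {x} p with parity x
... | inj₁ q = q
... | inj₂ q with () ← p q

one-odd : Oddℤ 1ℤ
one-odd = subst (2ℤ ∣_) (sym (+-inverseʳ 1ℤ)) ∣0

-- Gaussian elimination modulo 2: an odd entry of the first row serves as pivot, and a row without
-- one holds automatically.
underdetermined : ∀ m (M : Fin m → Fin (suc m) → ℤ) →
  Σ (V (suc m)) λ c → (Σ (Fin (suc m)) λ i → Oddℤ (c i)) × (∀ r → 2ℤ ∣ mulVec M c r)
underdetermined zero    M = (λ _ → 1ℤ) , (zero , one-odd) , λ ()
underdetermined (suc m) M with any? (λ i → odd? (M zero i))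
... | no none = insertAt c zero 0ℤ , (suc i , odd) , sol
  where
  rec = underdetermined m (λ r i → M (suc r) (suc i))
  c = proj₁ rec
  i = proj₁ (proj₁ (proj₂ rec))
  odd = proj₂ (proj₁ (proj₂ rec))
  sol : ∀ r → 2ℤ ∣ mulVec M (insertAt c zero 0ℤ) r
  sol zero = sum-∣ (λ j → ∣m⇒∣m*n _ (not-odd⇒even (λ o → none (j , o))))
  sol (suc r) = subst (2ℤ ∣_) (sym (trans (sum-suc _) (trans (cong (_+ mulVec (λ r i → M (suc r) (suc i)) c r) (*-zeroʳ _)) (+-identityˡ _)))) (proj₂ (proj₂ rec) r)
... | yes (p , odd-p) = insertAt c p (- s) , (punchIn p i , subst Oddℤ (sym (insertAt-punchIn c p (- s) i)) odd) , sol
  where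
  rec = underdetermined m (λ r i → M (suc r) (punchIn p i) - M zero (punchIn p i) * M (suc r) p)
  c = proj₁ rec
  i = proj₁ (proj₁ (proj₂ rec))
  odd = proj₂ (proj₁ (proj₂ rec))
  s = sumFin (λ i → M zero (punchIn p i) * c i)
  value : ∀ r → mulVec M (insertAt c p (- s)) r ≡ M r p * - s + sumFin (λ i → M r (punchIn p i) * c i)
  value r = trans (sum-punchIn p _) (cong₂ _+_ (cong (M r p *_) (insertAt-lookup c p (- s)))
    (sum-cong (λ i → cong (M r (punchIn p i) *_) (insertAt-punchIn c p (- s) i))))
  sol : ∀ r → 2ℤ ∣ mulVec M (insertAt c p (- s)) r
  sol zero = subst (2ℤ ∣_) (sym (trans (value zero) (lem (M zero p) s))) (∣m⇒∣-m (∣m⇒∣m*n s odd-p))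
    where
    lem : ∀ a s → a * - s + s ≡ - ((a - 1ℤ) * s)
    lem = solve 2 (λ a s → a :* :- s :+ s := :- ((a :- con 1ℤ) :* s)) refl
  sol (suc r) = subst (2ℤ ∣_) (trans (sum-cong (λ i → lem (M (suc r) (punchIn p i)) (M zero (punchIn p i)) (M (suc r) p) (c i)))
      (trans (sum-+ (λ i → M (suc r) (punchIn p i) * c i) _) (trans (cong (sumFin (λ i → M (suc r) (punchIn p i) * c i) +_) (sum-* (- M (suc r) p) (λ i → M zero (punchIn p i) * c i))) (trans (lem₂ _ (M (suc r) p) s) (sym (value (suc r)))))))
    (proj₂ (proj₂ rec) r)
    where
    lem : ∀ a b m c → (a - b * m) * c ≡ a * c + - m * (b * c)
    lem = solve 4 (λ a b m c → (a :- b :* m) :* c := a :* c :+ :- m :* (b :* c)) refl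
    lem₂ : ∀ x m s → x + - m * s ≡ m * - s + x
    lem₂ = solve 3 (λ x m s → x :+ :- m :* s := m :* :- s :+ x) refl

quad-parity : ∀ {n} (a : Mat n) → Symmetric a → (f : V n) →
  Σ ℤ λ k → dot f (mulVec a f) ≡ sumFin (λ i → f i * f i * a i i) + 2ℤ * k
quad-parity {zero}  a s f = 0ℤ , trans (sum-nil _) (trans (sym (lem 0ℤ)) (cong (_+ 2ℤ * 0ℤ) (sym (sum-nil _))))
  where
  lem : ∀ x → x + 2ℤ * 0ℤ ≡ x
  lem = solve 1 (λ x → x :+ con 2ℤ :* con 0ℤ := x) refl
quad-parity {suc n} a s f = k + f zero * t ,
  trans (sum-suc {n} _) (trans (cong₂ _+_ (cong (f zero *_) (sum-suc {n} _)) rest)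
    (trans (lem (f zero) (a zero zero) t _ k) (cong (_+ 2ℤ * (k + f zero * t)) (sym (sum-suc {n} _)))))
  where
  a′ : Mat n
  a′ i j = a (suc i) (suc j)
  f′ : V n
  f′ = f ∘ suc
  t = sumFin (λ j → a zero (suc j) * f′ j)
  rec = quad-parity a′ (λ i j → s (suc i) (suc j)) f′
  k = proj₁ rec
  rest : sumFin (λ i → f′ i * mulVec a f (suc i)) ≡ f zero * t + (sumFin (λ i → f′ i * f′ i * a′ i i) + 2ℤ * k)
  rest = trans (sum-cong (λ i → trans (cong (f′ i *_) (sum-suc {n} _)) (trans (lem₁ (f′ i) (a (suc i) zero) (f zero) (mulVec a′ f′ i)) (cong (λ x → f zero * (x * f′ i) + f′ i * mulVec a′ f′ i) (s (suc i) zero)))))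
    (trans (sum-+ (λ i → f zero * (a zero (suc i) * f′ i)) _) (cong₂ _+_ (sum-* (f zero) (λ i → a zero (suc i) * f′ i)) (proj₂ rec)))
    where
    lem₁ : ∀ g a f m → g * (a * f + m) ≡ f * (a * g) + g * m
    lem₁ = solve 4 (λ g a f m → g :* (a :* f :+ m) := f :* (a :* g) :+ g :* m) refl
  lem : ∀ f a t x k → f * (a * f + t) + (f * t + (x + 2ℤ * k)) ≡ (f * f * a + x) + 2ℤ * (k + f * t)
  lem = solve 5 (λ f a t x k → f :* (a :* f :+ t) :+ (f :* t :+ (x :+ con 2ℤ :* k)) := (f :* f :* a :+ x) :+ con 2ℤ :* (k :+ f :* t)) refl

sum-square-parity : ∀ {n} (x : V n) → 2ℤ ∣ dot x x - sumFin x
sum-square-parity {n} x = subst (2ℤ ∣_) (trans (sum-+ (λ i → x i * x i) (λ i → - x i)) (cong (dot x x +_) (trans (sum-cong (λ i → sym (-1* (x i)))) (trans (sum-* (- 1ℤ) x) (-1* _)))))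
  (sum-∣ (λ i → square-parity (x i)))

halve : ∀ k → Σ ℕ λ j → (k ≡ j ℕ.+ j) ⊎ (k ≡ suc (j ℕ.+ j))
halve zero = 0 , inj₁ refl
halve (suc k) with halve k
... | j , inj₁ refl = j , inj₂ refl
... | j , inj₂ refl = suc j , inj₁ (cong suc (sym (ℕ.+-suc j j)))

even-quadratic : ∀ {n} {A : Mat n} → Symmetric A → (∀ i → A i i ≡ 0ℤ) → ∀ x → 2ℤ ∣ dot x (mulVec A x)
even-quadratic {A = A} s z x with quad-parity A s x
... | k , eq = subst (2ℤ ∣_) (sym (trans eq (trans (cong (_+ 2ℤ * k) (sum-zero (λ i → trans (cong (x i * x i *_) (z i)) (*-zeroʳ _)))) (+-identityˡ _)))) (∣n*m k)

-- A count of even index is the square norm of A^j e, congruent to its coordinate sum, a count of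
-- smaller positive index. A count of odd index is p · A p for p = A^j e, even since A is symmetric
-- with zero diagonal.
walks-even : ∀ {n} {A : Mat n} → Symmetric A → (∀ i → A i i ≡ 0ℤ) → ∀ k → 2ℤ ∣ walks A (suc k)
walks-even {A = A} s z = ℕ.<-rec _ step
  where
  step : ∀ k → (∀ {i} → i ℕ.< k → 2ℤ ∣ walks A (suc i)) → 2ℤ ∣ walks A (suc k)
  step k ih with halve (suc k)
  ... | suc j , inj₁ eq = subst (2ℤ ∣_) (trans (lem (dot p p) (walks A (suc j))) (trans (dot-pow s (suc j) (suc j)) (cong (walks A) (sym eq))))
      (∣m∣n⇒∣m+n (sum-square-parity p) (ih (subst (j ℕ.<_) (sym (ℕ.suc-injective eq)) (ℕ.m<m+n j (ℕ.s≤s ℕ.z≤n)))))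
    where
    p = pow A (suc j)
    lem : ∀ x y → x - y + y ≡ x
    lem = solve 2 (λ x y → x :- y :+ y := x) refl
  ... | j , inj₂ eq = subst (2ℤ ∣_) (trans (dot-pow s j (suc j)) (cong (walks A) (trans (ℕ.+-suc j j) (sym eq)))) (even-quadratic s z (pow A j))

opaque
  unfolding sumFin _+_
  sum-ones : ∀ n → sumFin {n} (λ _ → 1ℤ) ≡ ℤ.+ n
  sum-ones zero    = refl
  sum-ones (suc n) = cong (1ℤ +_) (sum-ones n)

sumℕ : ℕ → (ℕ → ℤ) → ℤ
sumℕ m f = sumFin {m} (f ∘ toℕ)

sumℕ-snoc : ∀ m f → sumℕ (suc m) f ≡ sumℕ m f + f m
sumℕ-snoc zero    f = trans (sum-suc {0} _) (trans (+-comm (f 0) _) (cong (_+ f 0) (trans (sum-nil _) (sym (sum-nil _)))))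
sumℕ-snoc (suc m) f = trans (sum-suc {suc m} _) (trans (cong (f 0 +_) (sumℕ-snoc m (f ∘ suc))) (trans (sym (+-assoc (f 0) _ _)) (cong (_+ f (suc m)) (sym (sum-suc {m} _)))))

extend : ∀ {m} → V m → ℕ → ℤ
extend {zero}  c k       = 0ℤ
extend {suc m} c zero    = c zero
extend {suc m} c (suc k) = extend (c ∘ suc) k

extend-toℕ : ∀ {m} (c : V m) i → extend c (toℕ i) ≡ c i
extend-toℕ c zero    = refl
extend-toℕ c (suc i) = extend-toℕ (c ∘ suc) i

spread : ∀ {h n} → (Fin h → Fin n) → V h → V n
spread idx f i = sumFin (λ k → f k * idMat (idx k) i)

spread-at : ∀ {h n} (idx : Fin h → Fin n) → (∀ {k l} → idx k ≡ idx l → k ≡ l) → ∀ f l → spread idx f (idx l) ≡ f l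
spread-at idx inj f l = trans (sum-cong (λ k → trans (*-comm (f k) _) (cong (_* f k) (entry k)))) (sum-pick l f)
  where
  entry : ∀ k → idMat (idx k) (idx l) ≡ idMat l k
  entry k with k Fin.≟ l
  ... | yes refl = trans (id-diag (idx k)) (sym (id-diag k))
  ... | no k≢l   = trans (id-off (k≢l ∘ inj)) (sym (id-off (k≢l ∘ sym)))

spread-off : ∀ {h n} (idx : Fin h → Fin n) i → (∀ k → idx k ≢ i) → ∀ f → spread idx f i ≡ 0ℤ
spread-off idx i off f = sum-zero (λ k → trans (cong (f k *_) (id-off (off k))) (*-zeroʳ (f k)))

mulVec-spread : ∀ {h m n} (M : Fin m → Fin n → ℤ) (idx : Fin h → Fin n) f → mulVec M (spread idx f) ≗ mulVec (λ i k → M i (idx k)) f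
mulVec-spread M idx f i = trans (dot-sumʳ (M i) f (λ k → idMat (idx k))) (sum-cong (λ k → trans (cong (f k *_) (mulVec-unit M (idx k) i)) (*-comm (f k) _)))

evens : ∀ {n} {x : V n} {m} → (∀ i → m ∣ x i) → Σ (V n) λ y → ∀ i → x i ≡ m * y i
evens h = (λ i → _∣_.quotient (h i)) , λ i → trans (_∣_.equality (h i)) (*-comm _ _)

module Dependence {n} (A : Mat n) where

  depends : ℕ → (ℕ → ℤ) → V n → Set
  depends j b x = ∀ i → 2ℤ ∣ x i - sumℕ j (λ k → b k * pow A k i)

  -- Repeated multiplication by x and reduction by the monic relation x^j ≡ Σ b_k x^k.
  spans : ∀ j b → depends j b (pow A j) → ∀ m → Σ (ℕ → ℤ) λ c → depends j c (pow A m)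
  spans zero b h zero = b , h
  spans (suc j) b h zero = first , λ i → subst (2ℤ ∣_) (sym (trans (cong (λ x → 1ℤ - x) (trans (sum-suc {j} _) (cong (1ℤ * 1ℤ +_) (sum-zero {j} (λ k → *-zeroˡ (pow A (suc (toℕ k)) i)))))) (lem))) ∣0
    where
    first : ℕ → ℤ
    first zero    = 1ℤ
    first (suc _) = 0ℤ
    lem : 1ℤ - (1ℤ * 1ℤ + 0ℤ) ≡ 0ℤ
    lem = trans (cong (λ x → 1ℤ - x) (trans (+-identityʳ _) (*-identityˡ 1ℤ))) (+-inverseʳ 1ℤ)
  spans j b h (suc m) with spans j b h m
  ... | c , hc = next j b h c hc
    where
    next : ∀ j b → depends j b (pow A j) → ∀ c → depends j c (pow A m) → Σ (ℕ → ℤ) λ c′ → depends j c′ (pow A (suc m))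
    next zero b h c hc = c , λ i → subst (λ x → 2ℤ ∣ pow A (suc m) i - x) (sym (sum-nil _)) (subst (2ℤ ∣_) (lem _) (mulVec-∣ A (λ k → subst (2ℤ ∣_) (trans (cong (λ x → pow A m k - x) (sum-nil _)) (sym (lem _))) (hc k)) i))
      where
      lem : ∀ x → x ≡ x - 0ℤ
      lem = solve 1 (λ x → x := x :- con 0ℤ) refl
    next (suc j) b h c hc = c′ , λ i → subst (2ℤ ∣_) (total i) (∣m∣n⇒∣m+n (mulVec-∣ A hc i) (∣n⇒∣m*n (c j) (h i)))
      where
      shift : ℕ → ℤ
      shift zero    = 0ℤ
      shift (suc k) = c k
      c′ : ℕ → ℤ
      c′ k = shift k + c j * b k
      x : V n
      x k = sumℕ (suc j) (λ l → c l * pow A l k)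
      next-sum : ∀ i → mulVec A x i ≡ sumℕ j (λ l → c l * pow A (suc l) i) + c j * pow A (suc j) i
      next-sum i = trans (dot-sumʳ (A i) (c ∘ toℕ) (λ l → pow A (toℕ l))) (sumℕ-snoc j (λ l → c l * pow A (suc l) i))
      split-c′ : ∀ i → sumℕ (suc j) (λ k → c′ k * pow A k i) ≡ sumℕ j (λ l → c l * pow A (suc l) i) + c j * sumℕ (suc j) (λ k → b k * pow A k i)
      split-c′ i = trans (sum-cong {suc j} (λ k → lem (shift (toℕ k)) (c j) (b (toℕ k)) (pow A (toℕ k) i))) (trans (sum-+ {suc j} (λ k → shift (toℕ k) * pow A (toℕ k) i) _)
          (cong₂ _+_ (trans (sum-suc {j} _) (trans (cong (_+ sumℕ j (λ l → c l * pow A (suc l) i)) (*-zeroˡ (pow A 0 i))) (+-identityˡ _))) (sum-* {suc j} (c j) _)))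
        where
        lem : ∀ s c b p → (s + c * b) * p ≡ s * p + c * (b * p)
        lem = solve 4 (λ s c b p → (s :+ c :* b) :* p := s :* p :+ c :* (b :* p)) refl
      total : ∀ i → mulVec A (λ k → pow A m k - x k) i + c j * (pow A (suc j) i - sumℕ (suc j) (λ k → b k * pow A k i)) ≡ pow A (suc m) i - sumℕ (suc j) (λ k → c′ k * pow A k i)
      total i = trans (cong (_+ c j * (pow A (suc j) i - sumℕ (suc j) (λ k → b k * pow A k i))) (trans (mulVec-cong A (λ k → sym (sub (pow A m k) (x k))) i) (trans (mulVec-lc A 1ℤ (pow A m) (- 1ℤ) x i) (cong (λ y → 1ℤ * pow A (suc m) i + - 1ℤ * y) (next-sum i)))))
          (trans (lem (pow A (suc m) i) (sumℕ j (λ l → c l * pow A (suc l) i)) (c j) (pow A (suc j) i) (sumℕ (suc j) (λ k → b k * pow A k i))) (cong (λ y → pow A (suc m) i - y) (sym (split-c′ i))))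
        where
        sub : ∀ a b → 1ℤ * a + - 1ℤ * b ≡ a - b
        sub = solve 2 (λ a b → con 1ℤ :* a :+ :- con 1ℤ :* b := a :- b) refl
        lem : ∀ p s c q t → 1ℤ * p + - 1ℤ * (s + c * q) + c * (q - t) ≡ p - (s + c * t)
        lem = solve 5 (λ p s c q t → con 1ℤ :* p :+ :- con 1ℤ :* (s :+ c :* q) :+ c :* (q :- t) := p :- (s :+ c :* t)) refl

  idMat-inject≤ : ∀ {m n} (k l : Fin m) (le : m ℕ.≤ n) → idMat (inject≤ k le) (inject≤ l le) ≡ idMat k l
  idMat-inject≤ k l le with k Fin.≟ l
  ... | yes refl = id-diag (inject≤ k le)
  ... | no k≢l   = id-off (k≢l ∘ inject≤-injective le le k l)

  -- r unit invariant factors keep the walk matrix from having rank below r modulo 2.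
  independent : ∀ {d} (S : Smith (walk A) d) r → r ℕ.≤ n → (∀ i → toℕ i ℕ.< r → d i ≡ 1ℤ) →
    ∀ j → j ℕ.≤ r → (c : ℕ → ℤ) → (∀ i → 2ℤ ∣ sumℕ j (λ k → c k * pow A k i)) → ∀ k → k ℕ.< j → 2ℤ ∣ c k
  independent {d} S r r≤n d≡1 (suc j) j<r c h k k<j with parity (c j)
  ... | inj₁ even = earlier (ℕ.m≤n⇒m<n∨m≡n (ℕ.≤-pred k<j))
    where
    h′ : ∀ i → 2ℤ ∣ sumℕ j (λ k → c k * pow A k i)
    h′ i = subst (2ℤ ∣_) (trans (cong (_- c j * pow A j i) (sumℕ-snoc j (λ k → c k * pow A k i))) (lem _ _)) (∣m∣n⇒∣m-n (h i) (∣m⇒∣m*n (pow A j i) even))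
      where
      lem : ∀ x y → x + y - y ≡ x
      lem = solve 2 (λ x y → x :+ y :- y := x) refl
    earlier : k ℕ.< j ⊎ k ≡ j → 2ℤ ∣ c k
    earlier (inj₁ lt)   = independent S r r≤n d≡1 j (ℕ.<⇒≤ j<r) c h′ k lt
    earlier (inj₂ refl) = even
  ... | inj₂ odd = ⊥-elim (odd-not-even (proj₂ (proj₁ (proj₂ sol))) contradiction)
    where
    open SmithProperties S
    dep : depends j (λ k → - c k) (pow A j)
    dep i = subst (2ℤ ∣_) (trans (cong (_- (c j - 1ℤ) * pow A j i) (sumℕ-snoc j (λ k → c k * pow A k i))) (trans (lem _ (c j) (pow A j i)) (cong (λ x → pow A j i - x) (sym (trans (sum-cong {j} (λ k → lem₂ (c (toℕ k)) _)) (sum-* {j} (- 1ℤ) (λ k → c (toℕ k) * pow A (toℕ k) i)))))))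
        (∣m∣n⇒∣m-n (h i) (∣m⇒∣m*n (pow A j i) odd))
      where
      lem : ∀ x c p → x + c * p - (c - 1ℤ) * p ≡ p - - 1ℤ * x
      lem = solve 3 (λ x c p → x :+ c :* p :- (c :- con 1ℤ) :* p := p :- :- con 1ℤ :* x) refl
      lem₂ : ∀ c p → - c * p ≡ - 1ℤ * (c * p)
      lem₂ = solve 2 (λ c p → :- c :* p := :- con 1ℤ :* (c :* p)) refl
    Z : ℕ → ℕ → ℤ
    Z m = proj₁ (spans j (λ k → - c k) dep m)
    le : suc j ℕ.≤ n
    le = ℕ.≤-trans j<r r≤n
    emb : Fin (suc j) → Fin n
    emb l = inject≤ l le
    -- If all walk vectors lie modulo 2 in the span of the first j, only j conditions make W y even
    -- for a combination y of the first j + 1 columns of T. As those invariant factors are 1, U W y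
    -- recovers the coefficients, one of which is odd.
    sol = underdetermined j (λ k l → sumFin (λ m → Z (toℕ m) (toℕ k) * T m (emb l)))
    x = proj₁ sol
    l₀ = proj₁ (proj₁ (proj₂ sol))
    y : V n
    y = mulVec (λ m l → T m (emb l)) x
    Zy : ∀ k → 2ℤ ∣ dot (λ m → Z (toℕ m) (toℕ {j} k)) y
    Zy k = subst (2ℤ ∣_) (mulVec-∘ (λ k m → Z (toℕ m) (toℕ {j} k)) (λ m l → T m (emb l)) x k) (proj₂ (proj₂ sol) k)
    Wy : ∀ i → 2ℤ ∣ mulVec (walk A) y i
    Wy i = subst (2ℤ ∣_) total (∣m∣n⇒∣m+n (sum-∣ (λ m → ∣m⇒∣m*n (y m) (proj₂ (spans j (λ k → - c k) dep (toℕ m)) i))) (dot-∣ (λ k → pow A (toℕ {j} k) i) Zy))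
      where
      s : Fin n → ℤ
      s m = sumℕ j (λ k → Z (toℕ m) k * pow A k i)
      swapped : dot (λ k → pow A (toℕ {j} k) i) (λ k → dot (λ m → Z (toℕ m) (toℕ k)) y) ≡ sumFin (λ m → s m * y m)
      swapped = dot-mulVec (λ k → pow A (toℕ {j} k) i) (λ k m → Z (toℕ m) (toℕ k)) y
      total : sumFin (λ m → (pow A (toℕ m) i - s m) * y m) + dot (λ k → pow A (toℕ {j} k) i) (λ k → dot (λ m → Z (toℕ m) (toℕ k)) y) ≡ mulVec (walk A) y i
      total = trans (cong (sumFin (λ m → (pow A (toℕ m) i - s m) * y m) +_) swapped) (trans (sym (sum-+ (λ m → (pow A (toℕ m) i - s m) * y m) (λ m → s m * y m))) (sum-cong (λ m → lem (pow A (toℕ m) i) (s m) (y m))))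
        where
        lem : ∀ p s y → (p - s) * y + s * y ≡ p * y
        lem = solve 3 (λ p s y → (p :- s) :* y :+ s :* y := p :* y) refl
    UWy : ∀ i → mulVec U (mulVec (walk A) y) i ≡ sumFin (λ l → x l * (d (emb l) * idMat i (emb l)))
    UWy i = trans (dot-congʳ (U i) (λ k → trans (sym (mulVec-∘ (walk A) (λ m l → T m (emb l)) x k)) (trans (dot-comm _ x) (sum-cong (λ l → cong (x l *_) (column (emb l) k))))))
      (trans (dot-sumʳ (U i) x (λ l k → d (emb l) * U′ k (emb l))) (sum-cong (λ l → cong (x l *_) (trans (dot-*ʳ (U i) (d (emb l)) (λ k → U′ k (emb l))) (cong (d (emb l) *_)
        (trans (dot-congʳ (U i) (λ k → sym (mulVec-unit U′ (emb l) k))) (trans (UU′ (idMat (emb l)) i) (id-sym (emb l) i))))))))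
    value : mulVec U (mulVec (walk A) y) (emb l₀) ≡ x l₀
    value = trans (UWy (emb l₀)) (trans (sum-cong (λ l → trans (cong₂ (λ a b → x l * (a * b)) (d≡1 (emb l) (ℕ.≤-trans (subst (ℕ._< suc j) (sym (toℕ-inject≤ l le)) (toℕ<n l)) j<r)) (idMat-inject≤ l₀ l le)) (lem (x l) _))) (sum-pick l₀ x))
      where
      lem : ∀ x i → x * (1ℤ * i) ≡ i * x
      lem = solve 2 (λ x i → x :* (con 1ℤ :* i) := i :* x) refl
    contradiction : 2ℤ ∣ x l₀
    contradiction = subst (2ℤ ∣_) value (mulVec-∣ U Wy (emb l₀))

-- The parity argument: null vectors of Wᵀ W modulo 4.

even-walks : ∀ {n} h ε → n ≡ (ε ℕ.+ h) ℕ.+ h → ε ≡ 0 ⊎ ε ≡ 1 → {A : Mat n} → Symmetric A → (∀ i → A i i ≡ 0ℤ) → ∀ x → 2ℤ ∣ walks A (ε ℕ.+ x)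
even-walks h _ n≡ (inj₁ refl) s z zero    = subst (2ℤ ∣_) (sym (sum-ones _)) (pos-∣ (ℕᵈ.divides h (trans n≡ (trans (cong (h ℕ.+_) (sym (ℕ.+-identityʳ h))) (ℕ.*-comm 2 h)))))
even-walks h _ n≡ (inj₁ refl) s z (suc x) = walks-even s z x
even-walks h _ n≡ (inj₂ refl) s z x       = walks-even s z x

place : ℕ → (ℕ → ℤ) → ℕ → ℤ
place zero    g k       = g k
place (suc ε) g zero    = 0ℤ
place (suc ε) g (suc k) = place ε g k

sum-place : ∀ ε h g (p : ℕ → ℤ) → sumℕ (ε ℕ.+ h) (λ k → place ε g k * p k) ≡ sumℕ h (λ k → g k * p (ε ℕ.+ k))
sum-place zero    h g p = refl
sum-place (suc ε) h g p = trans (sum-suc {ε ℕ.+ h} _) (trans (cong (_+ sumℕ (ε ℕ.+ h) (λ k → place ε g k * p (suc k))) (*-zeroˡ (p 0)))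
  (trans (+-identityˡ _) (sum-place ε h g (p ∘ suc))))

place-shift : ∀ ε g k → place ε g (ε ℕ.+ k) ≡ g k
place-shift zero    g k = refl
place-shift (suc ε) g k = place-shift ε g k

-- Here ε is the parity of n and h = ⌊n/2⌋, so r = ε + h = ⌈n/2⌉ and n - r = h. Starting at exponent
-- ε avoids the count of length zero, n itself, when n is odd.
module Kernel {n} (h ε : ℕ) (n≡ : n ≡ (ε ℕ.+ h) ℕ.+ h) (ε≤1 : ε ≡ 0 ⊎ ε ≡ 1) {A : Mat n} (symA : Symmetric A) (zeroA : ∀ i → A i i ≡ 0ℤ)
  {d : V n} (S : Smith (walk A) d) (d-low : ∀ i → toℕ i ℕ.< ε ℕ.+ h → d i ≡ 1ℤ) (last : Fin n) (low : ∀ i → i ≢ last → d i ∣ 2ℤ) where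

  open SmithProperties S

  r = ε ℕ.+ h

  r≤n : r ℕ.≤ n
  r≤n = subst (r ℕ.≤_) (sym n≡) (ℕ.m≤m+n r h)

  even-walk : ∀ x → 2ℤ ∣ walks A (ε ℕ.+ x)
  even-walk = even-walks h ε n≡ ε≤1 symA zeroA

  high< : ∀ (k : Fin h) → r ℕ.+ toℕ k ℕ.< n
  high< k = subst (r ℕ.+ toℕ k ℕ.<_) (sym n≡) (ℕ.+-monoʳ-< r (toℕ<n k))

  high : Fin h → Fin n
  high k = fromℕ< (high< k)

  low-or-high : ∀ i → toℕ i ℕ.< r ⊎ Σ (Fin h) λ k → high k ≡ i
  low-or-high i with toℕ i ℕ.<? r
  ... | yes lt = inj₁ lt
  ... | no ≮ = inj₂ (fromℕ< lt , toℕ-injective (trans (toℕ-fromℕ< (high< (fromℕ< lt))) (trans (cong (r ℕ.+_) (toℕ-fromℕ< lt)) (ℕ.m+[n∸m]≡n (ℕ.≮⇒≥ ≮)))))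
    where
    lt : toℕ i ℕ.∸ r ℕ.< h
    lt = ℕ.+-cancelˡ-< r _ _ (subst₂ ℕ._<_ (sym (ℕ.m+[n∸m]≡n (ℕ.≮⇒≥ ≮))) n≡ (toℕ<n i))

  W : Mat n
  W = walk A

  K : Fin n → Fin h → ℤ
  K i k = pow A (ε ℕ.+ toℕ k) i

  dot-K : ∀ j k → 2ℤ ∣ dot (pow A j) (λ i → K i k)
  dot-K j k = subst (2ℤ ∣_) (trans (cong (walks A) (lem ε j (toℕ k))) (sym (dot-pow symA j (ε ℕ.+ toℕ k)))) (even-walk (j ℕ.+ toℕ k))
    where
    lem : ∀ a b c → a ℕ.+ (b ℕ.+ c) ≡ b ℕ.+ (a ℕ.+ c)
    lem a b c = trans (sym (ℕ.+-assoc a b c)) (trans (cong (ℕ._+ c) (ℕ.+-comm a b)) (ℕ.+-assoc b a c))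

  -- z and the h columns of `K` have even products with all walks, so their first r coordinates are
  -- even and the other h leave room for a relation modulo 2 among the h + 1 vectors. The columns of
  -- `K` being independent, z has an odd coefficient in it.
  kernel : ∀ z → (∀ j → 2ℤ ∣ mulVec (W ᵀ) z j) → Σ (V h) λ f → Σ (V n) λ β → z ≗ lc 1ℤ (mulVec K f) 2ℤ β
  kernel z Wz = finish odd
    where
    vecs : Fin (suc h) → V n
    vecs zero    = z
    vecs (suc k) = λ i → K i k
    relation = underdetermined h (λ k l → coord (vecs l) (high k))
    c = proj₁ relation
    odd = proj₁ (proj₂ relation)
    sol = proj₂ (proj₂ relation)
    w : V n
    w = mulVec (λ i l → vecs l i) c
    Ww : ∀ j → 2ℤ ∣ mulVec (W ᵀ) w j
    Ww j = subst (2ℤ ∣_) (mulVec-∘ (W ᵀ) (λ i l → vecs l i) c j) (sum-∣ (λ l → ∣m⇒∣m*n (c l) (entry l)))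
      where
      entry : ∀ l → 2ℤ ∣ dot (pow A (toℕ j)) (vecs l)
      entry zero    = Wz j
      entry (suc k) = dot-K (toℕ j) k
    coord-w : ∀ i → 2ℤ ∣ coord w i
    coord-w i with low-or-high i
    ... | inj₁ lt = subst (2ℤ ∣_) (trans (cong (_* coord w i) (d-low i lt)) (*-identityˡ _)) (∣-coord w Ww i)
    ... | inj₂ (k , refl) = subst (2ℤ ∣_) (mulVec-∘ (U′ ᵀ) (λ i l → vecs l i) c (high k)) (sol k)
    w-even : ∀ i → 2ℤ ∣ w i
    w-even i = subst (2ℤ ∣_) (from-coord w i) (mulVec-∣ (U ᵀ) coord-w i)
    c′ : V h
    c′ = c ∘ suc
    w≡ : ∀ i → w i ≡ z i * c zero + mulVec K c′ i
    w≡ i = sum-suc {h} _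
    finish : (Σ (Fin (suc h)) λ i → Oddℤ (c i)) → Σ (V h) λ f → Σ (V n) λ β → z ≗ lc 1ℤ (mulVec K f) 2ℤ β
    finish odd with parity (c zero)
    ... | inj₂ o = (λ k → - 1ℤ * c′ k) , proj₁ β , λ i → trans (lem₂ (z i) (mulVec K c′ i)) (cong₂ (λ x y → 1ℤ * x + y) (sym (mulVec-* K (- 1ℤ) c′ i)) (proj₂ β i))
      where
      lem : ∀ z c k → (z * c + k) - z * (c - 1ℤ) ≡ z + k
      lem = solve 3 (λ z c k → (z :* c :+ k) :- z :* (c :- con 1ℤ) := z :+ k) refl
      lem₂ : ∀ z k → z ≡ 1ℤ * (- 1ℤ * k) + (z + k)
      lem₂ = solve 2 (λ z k → z := con 1ℤ :* (:- con 1ℤ :* k) :+ (z :+ k)) refl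
      β = evens (λ i → subst (2ℤ ∣_) (trans (cong (_- z i * (c zero - 1ℤ)) (w≡ i)) (lem (z i) (c zero) (mulVec K c′ i))) (∣m∣n⇒∣m-n (w-even i) (∣n⇒∣m*n (z i) o)))
    ... | inj₁ e = ⊥-elim (odd-not-even (proj₂ odd) (all-even (proj₁ odd)))
      where
      lem : ∀ z c k → (z * c + k) - z * c ≡ k
      lem = solve 3 (λ z c k → (z :* c :+ k) :- z :* c := k) refl
      Kc : ∀ i → 2ℤ ∣ sumℕ r (λ k → place ε (extend c′) k * pow A k i)
      Kc i = subst (2ℤ ∣_) (trans (trans (cong (_- z i * c zero) (w≡ i)) (lem (z i) (c zero) (mulVec K c′ i)))
          (trans (sum-cong (λ k → trans (*-comm (K i k) (c′ k)) (cong (_* K i k) (sym (extend-toℕ c′ k))))) (sym (sum-place ε h (extend c′) (λ k → pow A k i)))))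
        (∣m∣n⇒∣m-n (w-even i) (∣n⇒∣m*n (z i) e))
      all-even : ∀ i → 2ℤ ∣ c i
      all-even zero    = e
      all-even (suc k) = subst (2ℤ ∣_) (trans (place-shift ε (extend c′) (toℕ k)) (extend-toℕ c′ k))
        (Dependence.independent A S r r≤n d-low r ℕ.≤-refl (place ε (extend c′)) Kc (ε ℕ.+ toℕ k) (ℕ.+-monoʳ-< ε (toℕ<n k)))

  -- The diagonal terms of (K f) · A^k (K f), with f_i in place of f_i².
  qform : V h → ℕ → ℤ
  qform f k = sumFin (λ i → f i * walks A (ε ℕ.+ k ℕ.+ (ε ℕ.+ (toℕ i ℕ.+ toℕ i))))

  iter-K : ∀ k f → iter A k (mulVec K f) ≗ mulVec (λ i l → pow A (k ℕ.+ (ε ℕ.+ toℕ l)) i) f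
  iter-K zero    f i = refl
  iter-K (suc k) f i = trans (mulVec-cong A (iter-K k f) i) (sym (mulVec-∘ A (λ i l → pow A (k ℕ.+ (ε ℕ.+ toℕ l)) i) f i))

  -- Off-diagonal terms occur twice with an even walk count; on the diagonal the count is even, so
  -- f_i² may be replaced by f_i. The quadratic form thus becomes linear in f, which opens it to a
  -- rank argument.
  quadratic-mod4 : ∀ z f β → z ≗ lc 1ℤ (mulVec K f) 2ℤ β → ∀ k → 4ℤ ∣ dot z (iter A k z) - qform f k
  quadratic-mod4 z f β z≗ k = subst (4ℤ ∣_) (sym (trans (cong₂ _-_ zz qf) (lem₄ (sumFin (λ i → f i * f i * a i i)) Kq (dot g β′) (dot β β′) (sumFin (λ i → f i * a i i)))))
      (∣m∣n⇒∣m+n (subst (λ x → 4ℤ ∣ 2ℤ * x) square-diff (*-mono-∣′ (sum-∣ (λ i → ∣m⇒∣m*n (a i i) (square-parity (f i)))))) (∣m*n _))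
    where
    *-mono-∣′ : ∀ {x} → 2ℤ ∣ x → 4ℤ ∣ 2ℤ * x
    *-mono-∣′ {x} p = subst (_∣ 2ℤ * x) 2*2 (*-mono-∣ ∣-refl p)
      where
      opaque
        unfolding _+_
        2*2 : 2ℤ * 2ℤ ≡ 4ℤ
        2*2 = refl
    g = mulVec K f
    g′ = iter A k g
    β′ = iter A k β
    half : ℕ → ℤ
    half x = _∣_.quotient (even-walk x)
    a : Mat h
    a i j = half (toℕ i ℕ.+ (k ℕ.+ (ε ℕ.+ toℕ j)))
    a-sym : Symmetric a
    a-sym i j = cong half (swap (toℕ i) (toℕ j))
      where
      swap : ∀ i j → i ℕ.+ (k ℕ.+ (ε ℕ.+ j)) ≡ j ℕ.+ (k ℕ.+ (ε ℕ.+ i))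
      swap i j = ℕS.solve 4 (λ i j k ε → i ℕS.:+ (k ℕS.:+ (ε ℕS.:+ j)) ℕS.:= j ℕS.:+ (k ℕS.:+ (ε ℕS.:+ i))) refl i j k ε
    quad = quad-parity a a-sym f
    Kq = proj₁ quad
    gg : dot g g′ ≡ 2ℤ * (sumFin (λ i → f i * f i * a i i) + 2ℤ * Kq)
    gg = trans (dot-congʳ g (iter-K k f)) (trans (dot-gram K (λ i l → pow A (k ℕ.+ (ε ℕ.+ toℕ l)) i) f f)
      (trans (sum-cong (λ i → trans (cong (f i *_) (trans (sum-cong (λ j → trans (cong (f j *_) (entry i j)) (lem (f j) (a i j)))) (sum-* 2ℤ (λ j → a i j * f j)))) (*-swap (f i) 2ℤ (mulVec a f i))))
        (trans (sum-* 2ℤ (λ i → f i * mulVec a f i)) (cong (2ℤ *_) (proj₂ quad)))))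
      where
      entry : ∀ i j → dot (pow A (ε ℕ.+ toℕ i)) (pow A (k ℕ.+ (ε ℕ.+ toℕ j))) ≡ a i j * 2ℤ
      entry i j = trans (dot-pow symA (ε ℕ.+ toℕ i) _) (trans (cong (walks A) (ℕ.+-assoc ε (toℕ i) _)) (_∣_.equality (even-walk (toℕ i ℕ.+ (k ℕ.+ (ε ℕ.+ toℕ j))))))
      lem : ∀ f a → f * (a * 2ℤ) ≡ 2ℤ * (a * f)
      lem = solve 2 (λ f a → f :* (a :* con 2ℤ) := con 2ℤ :* (a :* f)) refl
    zz : dot z (iter A k z) ≡ 2ℤ * (sumFin (λ i → f i * f i * a i i) + 2ℤ * Kq) + 4ℤ * (dot g β′ + dot β β′)
    zz = trans (dot-cong z≗ (λ i → trans (iter-cong A k z≗ i) (iter-lc A k 1ℤ g 2ℤ β i))) (trans (dot-lcˡ 1ℤ g 2ℤ β (lc 1ℤ g′ 2ℤ β′))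
      (trans (cong₂ (λ x y → 1ℤ * x + 2ℤ * y) (dot-lcʳ g 1ℤ g′ 2ℤ β′) (trans (dot-lcʳ β 1ℤ g′ 2ℤ β′) (cong (λ x → 1ℤ * x + 2ℤ * dot β β′) (trans (dot-iter symA k β g) (dot-comm β′ g)))))
        (trans (lem (dot g g′) (dot g β′) (dot β β′)) (cong (_+ 4ℤ * (dot g β′ + dot β β′)) gg))))
      where
      lem : ∀ x y z → 1ℤ * (1ℤ * x + 2ℤ * y) + 2ℤ * (1ℤ * y + 2ℤ * z) ≡ x + 4ℤ * (y + z)
      lem = solve 3 (λ x y z → con 1ℤ :* (con 1ℤ :* x :+ con 2ℤ :* y) :+ con 2ℤ :* (con 1ℤ :* y :+ con 2ℤ :* z) := x :+ con 4ℤ :* (y :+ z)) refl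
    qf : qform f k ≡ 2ℤ * sumFin (λ i → f i * a i i)
    qf = trans (sum-cong (λ i → trans (cong (f i *_) (trans (cong (walks A) (shuffle (toℕ i))) (_∣_.equality (even-walk (toℕ i ℕ.+ (k ℕ.+ (ε ℕ.+ toℕ i))))))) (lem (f i) (a i i)))) (sum-* 2ℤ _)
      where
      lem : ∀ f a → f * (a * 2ℤ) ≡ 2ℤ * (f * a)
      lem = solve 2 (λ f a → f :* (a :* con 2ℤ) := con 2ℤ :* (f :* a)) refl
      shuffle : ∀ i → ε ℕ.+ k ℕ.+ (ε ℕ.+ (i ℕ.+ i)) ≡ ε ℕ.+ (i ℕ.+ (k ℕ.+ (ε ℕ.+ i)))
      shuffle i = ℕS.solve 3 (λ i k ε → ε ℕS.:+ k ℕS.:+ (ε ℕS.:+ (i ℕS.:+ i)) ℕS.:= ε ℕS.:+ (i ℕS.:+ (k ℕS.:+ (ε ℕS.:+ i)))) refl i k ε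
    square-diff : sumFin (λ i → (f i * f i - f i) * a i i) ≡ sumFin (λ i → f i * f i * a i i) - sumFin (λ i → f i * a i i)
    square-diff = trans (sum-cong (λ i → lem (f i) (a i i))) (trans (sum-+ (λ i → f i * f i * a i i) _) (cong (sumFin (λ i → f i * f i * a i i) +_) (trans (sum-* (- 1ℤ) (λ i → f i * a i i)) (-1* _))))
      where
      lem : ∀ f a → (f * f - f) * a ≡ f * f * a + - 1ℤ * (f * a)
      lem = solve 2 (λ f a → (f :* f :- f) :* a := f :* f :* a :+ :- con 1ℤ :* (f :* a)) refl
    lem₄ : ∀ s k x y t → 2ℤ * (s + 2ℤ * k) + 4ℤ * (x + y) - 2ℤ * t ≡ 2ℤ * (s - t) + (k + x + y) * 4ℤ
    lem₄ = solve 5 (λ s k x y t → con 2ℤ :* (s :+ con 2ℤ :* k) :+ con 4ℤ :* (x :+ y) :- con 2ℤ :* t := con 2ℤ :* (s :- t) :+ (k :+ x :+ y) :* con 4ℤ) refl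

  -- The top exponent ε + 2 (h - 1) + 1 is n - 1, so multiplying x^ε f(x²) by a linear factor still
  -- fits into n coefficients.
  position< : ∀ (i : Fin h) → ε ℕ.+ suc (toℕ i ℕ.+ toℕ i) ℕ.< n
  position< i = subst (ε ℕ.+ suc (toℕ i ℕ.+ toℕ i) ℕ.<_) (sym (trans n≡ (ℕ.+-assoc ε h h)))
    (ℕ.+-monoʳ-< ε (subst (ℕ._≤ h ℕ.+ h) (cong suc (ℕ.+-suc (toℕ i) (toℕ i))) (ℕ.+-mono-≤ (toℕ<n i) (toℕ<n i))))

  evenPos oddPos : Fin h → Fin n
  evenPos i = fromℕ< (ℕ.<-trans (ℕ.+-monoʳ-< ε (ℕ.n<1+n (toℕ i ℕ.+ toℕ i))) (position< i))
  oddPos  i = fromℕ< (position< i)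

  toℕ-even : ∀ i → toℕ (evenPos i) ≡ ε ℕ.+ (toℕ i ℕ.+ toℕ i)
  toℕ-even i = toℕ-fromℕ< _

  toℕ-odd : ∀ i → toℕ (oddPos i) ≡ ε ℕ.+ suc (toℕ i ℕ.+ toℕ i)
  toℕ-odd i = toℕ-fromℕ< _

  double-inj : ∀ {a b} → a ℕ.+ a ≡ b ℕ.+ b → a ≡ b
  double-inj {zero}  {zero}  eq = refl
  double-inj {suc a} {suc b} eq = cong suc (double-inj (ℕ.suc-injective (trans (sym (ℕ.+-suc a a)) (trans (ℕ.suc-injective eq) (ℕ.+-suc b b)))))

  double≢ : ∀ {a b} → a ℕ.+ a ≢ suc (b ℕ.+ b)
  double≢ {suc a} {zero}  eq with () ← trans (sym (ℕ.+-suc a a)) (ℕ.suc-injective eq)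
  double≢ {suc a} {suc b} eq = double≢ {a} {b} (ℕ.suc-injective (trans (sym (ℕ.+-suc a a)) (trans (ℕ.suc-injective eq) (cong suc (ℕ.+-suc b b)))))

  evenPos-inj : ∀ {k l} → evenPos k ≡ evenPos l → k ≡ l
  evenPos-inj {k} {l} eq = toℕ-injective (double-inj (ℕ.+-cancelˡ-≡ ε _ _ (trans (sym (toℕ-even k)) (trans (cong toℕ eq) (toℕ-even l)))))

  oddPos-inj : ∀ {k l} → oddPos k ≡ oddPos l → k ≡ l
  oddPos-inj {k} {l} eq = toℕ-injective (double-inj (ℕ.suc-injective (ℕ.+-cancelˡ-≡ ε _ _ (trans (sym (toℕ-odd k)) (trans (cong toℕ eq) (toℕ-odd l))))))

  even≢odd : ∀ k l → evenPos k ≢ oddPos l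
  even≢odd k l eq = double≢ {toℕ k} {toℕ l} (ℕ.+-cancelˡ-≡ ε _ _ (trans (sym (toℕ-even k)) (trans (cong toℕ eq) (toℕ-odd l))))

  -- The coefficient vector of x^ε (c₀ + c₁ x) f(x²).
  tau : V h → ℤ → ℤ → V n
  tau f c₀ c₁ = lc c₀ (spread evenPos f) c₁ (spread oddPos f)

  tau-even : ∀ f c₀ c₁ l → tau f c₀ c₁ (evenPos l) ≡ c₀ * f l
  tau-even f c₀ c₁ l = trans (cong₂ (λ x y → c₀ * x + c₁ * y) (spread-at evenPos evenPos-inj f l) (spread-off oddPos (evenPos l) (λ k eq → even≢odd l k (sym eq)) f)) (lem _ c₁)
    where
    lem : ∀ x c → x + c * 0ℤ ≡ x
    lem = solve 2 (λ x c → x :+ c :* con 0ℤ := x) refl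

  tau-odd : ∀ f c₀ c₁ l → tau f c₀ c₁ (oddPos l) ≡ c₁ * f l
  tau-odd f c₀ c₁ l = trans (cong₂ (λ x y → c₀ * x + c₁ * y) (spread-off evenPos (oddPos l) (λ k → even≢odd k l) f) (spread-at oddPos oddPos-inj f l)) (lem c₀ _)
    where
    lem : ∀ c x → c * 0ℤ + x ≡ x
    lem = solve 2 (λ c x → c :* con 0ℤ :+ x := x) refl

  dot-W-spread : ∀ m (idx : Fin h → Fin n) f → dot (pow A m) (mulVec W (spread idx f)) ≡ sumFin (λ i → f i * walks A (m ℕ.+ toℕ (idx i)))
  dot-W-spread m idx f = trans (dot-congʳ (pow A m) (mulVec-spread W idx f)) (trans (dot-mulVec (pow A m) (λ i k → pow A (toℕ (idx k)) i) f)
    (sum-cong (λ i → trans (*-comm _ (f i)) (cong (f i *_) (trans (dot-comm (pow A (toℕ (idx i))) (pow A m)) (dot-pow symA m (toℕ (idx i))))))))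

  -- This is the reason for the argument x²: the exponents 2 i of f(x²) reproduce the diagonal walk
  -- counts in `qform`.
  dot-W-tau : ∀ k f c₀ c₁ → dot (pow A (ε ℕ.+ k)) (mulVec W (tau f c₀ c₁)) ≡ c₀ * qform f k + c₁ * qform f (suc k)
  dot-W-tau k f c₀ c₁ = trans (dot-congʳ (pow A (ε ℕ.+ k)) (mulVec-lc W c₀ (spread evenPos f) c₁ (spread oddPos f)))
    (trans (dot-lcʳ (pow A (ε ℕ.+ k)) c₀ (mulVec W (spread evenPos f)) c₁ (mulVec W (spread oddPos f))) (cong₂ (λ x y → c₀ * x + c₁ * y)
      (trans (dot-W-spread (ε ℕ.+ k) evenPos f) (sum-cong (λ i → cong (λ m → f i * walks A (ε ℕ.+ k ℕ.+ m)) (toℕ-even i))))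
      (trans (dot-W-spread (ε ℕ.+ k) oddPos f) (sum-cong (λ i → cong (λ m → f i * walks A m) (trans (cong (ε ℕ.+ k ℕ.+_) (toℕ-odd i)) (shuffle (toℕ i ℕ.+ toℕ i))))))))
    where
    shuffle : ∀ i → ε ℕ.+ k ℕ.+ (ε ℕ.+ suc i) ≡ ε ℕ.+ suc k ℕ.+ (ε ℕ.+ i)
    shuffle i = ℕS.solve 3 (λ i k ε → ε ℕS.:+ k ℕS.:+ (ε ℕS.:+ (ℕS.con 1 ℕS.:+ i)) ℕS.:= ε ℕS.:+ (ℕS.con 1 ℕS.:+ k) ℕS.:+ (ε ℕS.:+ i)) refl i k ε

  dot-ones-W-tau : ∀ f c₀ c₁ → 2ℤ ∣ dot ones (mulVec W (tau f c₀ c₁))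
  dot-ones-W-tau f c₀ c₁ = subst (2ℤ ∣_) (sym (trans (dot-congʳ ones (mulVec-lc W c₀ (spread evenPos f) c₁ (spread oddPos f))) (dot-lcʳ ones c₀ (mulVec W (spread evenPos f)) c₁ (mulVec W (spread oddPos f)))))
    (∣m∣n⇒∣m+n (∣n⇒∣m*n c₀ (term evenPos toℕ-even)) (∣n⇒∣m*n c₁ (term oddPos toℕ-odd)))
    where
    term : (idx : Fin h → Fin n) {m : Fin h → ℕ} → (∀ i → toℕ (idx i) ≡ ε ℕ.+ m i) → 2ℤ ∣ dot ones (mulVec W (spread idx f))
    term idx {m} eq = subst (2ℤ ∣_) (sym (dot-W-spread 0 idx f)) (sum-∣ (λ i → ∣n⇒∣m*n (f i) (subst (λ k → 2ℤ ∣ walks A k) (sym (eq i)) (even-walk (m i)))))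

  -- Null vectors of Wᵀ W modulo 4, seen modulo 2. The lift is free because only the class modulo 2
  -- matters and, for odd n, the row of e needs a correction.
  record Isotropic (τ : V n) : Set where
    field
      lift : V n
      lift≡ : ∀ i → 2ℤ ∣ lift i - τ i
      rows : ∀ (j : Fin n) → 4ℤ ∣ dot (pow A (toℕ j)) (mulVec W lift)

  isotropic-lc : ∀ {x y} a b → Isotropic x → Isotropic y → Isotropic (lc a x b y)
  isotropic-lc {x} {y} a b p q = record
    { lift = lc a P.lift b Q.lift
    ; lift≡ = λ i → subst (2ℤ ∣_) (lem a (P.lift i) b (Q.lift i) (x i) (y i)) (∣m∣n⇒∣m+n (∣n⇒∣m*n a (P.lift≡ i)) (∣n⇒∣m*n b (Q.lift≡ i)))
    ; rows = λ j → subst (4ℤ ∣_) (sym (trans (dot-congʳ (pow A (toℕ j)) (mulVec-lc W a P.lift b Q.lift)) (dot-lcʳ (pow A (toℕ j)) a (mulVec W P.lift) b (mulVec W Q.lift))))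
        (∣m∣n⇒∣m+n (∣n⇒∣m*n a (P.rows j)) (∣n⇒∣m*n b (Q.rows j))) }
    where
    module P = Isotropic p
    module Q = Isotropic q
    lem : ∀ a p b q x y → a * (p - x) + b * (q - y) ≡ a * p + b * q - (a * x + b * y)
    lem = solve 6 (λ a p b q x y → a :* (p :- x) :+ b :* (q :- y) := a :* p :+ b :* q :- (a :* x :+ b :* y)) refl

  isotropic-tau : ∀ f c₀ c₁ → (∀ k → 4ℤ ∣ c₀ * qform f k + c₁ * qform f (suc k)) → Isotropic (tau f c₀ c₁)
  isotropic-tau f c₀ c₁ hyp = cases ε≤1
    where
    τ = tau f c₀ c₁
    row : ∀ k → 4ℤ ∣ dot (pow A (ε ℕ.+ k)) (mulVec W τ)
    row k = subst (4ℤ ∣_) (sym (dot-W-tau k f c₀ c₁)) (hyp k)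
    cases : ε ≡ 0 ⊎ ε ≡ 1 → Isotropic τ
    cases (inj₁ e) = record { lift = τ ; lift≡ = λ i → subst (2ℤ ∣_) (sym (+-inverseʳ (τ i))) ∣0
      ; rows = λ j → subst (λ m → 4ℤ ∣ dot (pow A m) (mulVec W τ)) (cong (ℕ._+ toℕ j) e) (row (toℕ j)) }
    -- For odd n the row of e is repaired by adding an even multiple of e.
    cases (inj₂ e) = record { lift = τ′ ; lift≡ = λ i → subst (2ℤ ∣_) (lem₁ (τ i) s N₀ (idMat o i)) (∣m⇒∣m*n (- N₀ * idMat o i) s-even)
      ; rows = λ j → row′ (toℕ j) }
      where
      lem₁ : ∀ t s n x → s * (- n * x) ≡ 1ℤ * t + - (s * n) * x - t
      lem₁ = solve 4 (λ t s n x → s :* (:- n :* x) := con 1ℤ :* t :+ :- (s :* n) :* x :- t) refl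
      o : Fin n
      o = fromℕ< (ℕ.≤-trans (ℕ.s≤s ℕ.z≤n) (toℕ<n last))
      toℕ-o : toℕ o ≡ 0
      toℕ-o = toℕ-fromℕ< _
      s = dot ones (mulVec W τ)
      s-even : 2ℤ ∣ s
      s-even = dot-ones-W-tau f c₀ c₁
      N₀ = walks A 0
      N₀-odd : Oddℤ N₀
      N₀-odd = subst Oddℤ (sym (trans (sum-ones n) (cong ℤ.+_ (trans n≡ (cong (λ ε → ε ℕ.+ h ℕ.+ h) e)))))
        (divides (ℤ.+ h) (trans (cong (_- 1ℤ) (trans (pos-+ 1 (h ℕ.+ h)) (cong (1ℤ +_) (pos-+ h h)))) (lem (ℤ.+ h))))
        where
        lem : ∀ h → 1ℤ + (h + h) - 1ℤ ≡ h * 2ℤ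
        lem = solve 1 (λ h → con 1ℤ :+ (h :+ h) :- con 1ℤ := h :* con 2ℤ) refl
      τ′ = lc 1ℤ τ (- (s * N₀)) (idMat o)
      Wτ′ : ∀ m → dot (pow A m) (mulVec W τ′) ≡ dot (pow A m) (mulVec W τ) - s * N₀ * walks A m
      Wτ′ m = trans (dot-congʳ (pow A m) (mulVec-lc W 1ℤ τ (- (s * N₀)) (idMat o))) (trans (dot-lcʳ (pow A m) 1ℤ (mulVec W τ) (- (s * N₀)) (mulVec W (idMat o)))
        (trans (cong (λ x → 1ℤ * dot (pow A m) (mulVec W τ) + - (s * N₀) * x) (trans (dot-congʳ (pow A m) (λ i → trans (mulVec-unit W o i) (cong (λ k → pow A k i) toℕ-o))) (trans (dot-pow symA m 0) (cong (walks A) (ℕ.+-identityʳ m)))))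
          (lem (dot (pow A m) (mulVec W τ)) (s * N₀) (walks A m))))
        where
        lem : ∀ x y z → 1ℤ * x + - y * z ≡ x - y * z
        lem = solve 3 (λ x y z → con 1ℤ :* x :+ :- y :* z := x :- y :* z) refl
      quarter : ∀ {x y} → 2ℤ ∣ x → 2ℤ ∣ y → 4ℤ ∣ x * y
      quarter {x} {y} p q = subst (_∣ x * y) (sym (pos-* 2 2)) (*-mono-∣ p q)
      row′ : ∀ m → 4ℤ ∣ dot (pow A m) (mulVec W τ′)
      row′ zero = subst (4ℤ ∣_) (sym (trans (Wτ′ 0) (lem s N₀))) (∣m⇒∣-m (quarter s-even (odd-* N₀-odd N₀-odd)))
        where
        lem : ∀ s n → s - s * n * n ≡ - (s * (n * n - 1ℤ))
        lem = solve 2 (λ s n → s :- s :* n :* n := :- (s :* (n :* n :- con 1ℤ))) refl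
      row′ (suc m) = subst (4ℤ ∣_) (sym (Wτ′ (suc m))) (∣m∣n⇒∣m-n (subst (λ k → 4ℤ ∣ dot (pow A k) (mulVec W τ)) (cong (ℕ._+ m) e) (row m))
        (subst (4ℤ ∣_) (lem s N₀ (walks A (suc m))) (quarter s-even (∣n⇒∣m*n N₀ (walks-even symA zeroA m)))))
        where
        lem : ∀ s n w → s * (n * w) ≡ s * n * w
        lem = solve 3 (λ s n w → s :* (n :* w) := s :* n :* w) refl

  4∣2*⇒2∣ : ∀ {x} → 4ℤ ∣ 2ℤ * x → 2ℤ ∣ x
  4∣2*⇒2∣ {x} p = ∣-cancelˡ 2ℤ 2≢0 (subst (_∣ 2ℤ * x) (pos-* 2 2) p)

  -- By kernel, vectors orthogonal modulo 2 to all walks are themselves walk combinations; applied to half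
  -- of W lift this pins an isotropic vector down modulo 2, up to the two coordinates at last.
  isotropic-even : ∀ {τ} (I : Isotropic τ) → let open Isotropic I in
    (4ℤ ∣ d last * dot (ζ last low) (mulVec W lift) → 2ℤ ∣ dot (ζ last low) (mulVec W lift)) →
    (∀ σ → (∀ i → 2ℤ ∣ lift i - σ i) → 4ℤ ∣ d last * mulVec T′ σ last → 2ℤ ∣ mulVec T′ σ last) →
    ∀ i → 2ℤ ∣ τ i
  isotropic-even {τ} I e₁ e₂ i = subst (2ℤ ∣_) (lem (lift i) (τ i)) (∣m∣n⇒∣m-n lift-even (lift≡ i))
    where
    open Isotropic I
    lem : ∀ x y → x - (x - y) ≡ y
    lem = solve 2 (λ x y → x :- (x :- y) := y) refl
    v = mulVec W lift
    near-last : ∀ {x : V n} → (∀ k → 4ℤ ∣ d k * x k) → (2ℤ ∣ x last) → ∀ k → 2ℤ ∣ x k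
    near-last {x} h hl k with k Fin.≟ last
    ... | yes refl = hl
    ... | no k≢ = 4∣2*⇒2∣ (∣-trans (h k) (*-mono-∣ (low k k≢) ∣-refl))
    v-even : ∀ k → 2ℤ ∣ v k
    v-even k = subst (2ℤ ∣_) (from-coord v k) (mulVec-∣ (U ᵀ) (near-last (∣-coord v rows) (e₁ (∣-coord v rows last))) k)
    v′ = proj₁ (evens v-even)
    v≡ : ∀ k → v k ≡ 2ℤ * v′ k
    v≡ = proj₂ (evens v-even)
    ker = kernel v′ (λ j → 4∣2*⇒2∣ (subst (4ℤ ∣_) (trans (dot-congʳ (pow A (toℕ j)) v≡) (dot-*ʳ (pow A (toℕ j)) 2ℤ v′)) (rows j)))
    f = proj₁ ker
    β = proj₁ (proj₂ ker)
    place< : ∀ (k : Fin h) → ε ℕ.+ toℕ k ℕ.< n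
    place< k = ℕ.<-≤-trans (ℕ.+-monoʳ-< ε (toℕ<n k)) r≤n
    σ = spread (λ k → fromℕ< (place< k)) f
    Wσ : mulVec W σ ≗ mulVec K f
    Wσ i = trans (mulVec-spread W (λ k → fromℕ< (place< k)) f i) (mulVec-congˡ (λ i k → cong (λ m → pow A m i) (toℕ-fromℕ< (place< k))) f i)
    -- Half of W lift equals W σ modulo 2, so this vector agrees with `lift` modulo 2 while W ρ
    -- vanishes modulo 4.
    ρ = lc 1ℤ lift (- 2ℤ) σ
    Wρ : ∀ i → mulVec W ρ i ≡ 4ℤ * β i
    Wρ i = trans (mulVec-lc W 1ℤ lift (- 2ℤ) σ i) (trans (cong₂ (λ x y → 1ℤ * x + - 2ℤ * y) (trans (v≡ i) (cong (2ℤ *_) (proj₂ (proj₂ ker) i))) (Wσ i)) (lem₂ (mulVec K f i) (β i)))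
      where
      lem₂ : ∀ k b → 1ℤ * (2ℤ * (1ℤ * k + 2ℤ * b)) + - 2ℤ * k ≡ 4ℤ * b
      lem₂ = solve 2 (λ k b → con 1ℤ :* (con 2ℤ :* (con 1ℤ :* k :+ con 2ℤ :* b)) :+ :- con 2ℤ :* k := con 4ℤ :* b) refl
    dT : ∀ k → 4ℤ ∣ d k * mulVec T′ ρ k
    dT k = subst (4ℤ ∣_) (UW-T′ ρ k) (mulVec-∣ U (λ i → subst (4ℤ ∣_) (sym (Wρ i)) (∣n*m (β i))) k)
    ρ-near : ∀ i → 2ℤ ∣ lift i - ρ i
    ρ-near i = divides (σ i) (lem₃ (lift i) (σ i))
      where
      lem₃ : ∀ x s → x - (1ℤ * x + - 2ℤ * s) ≡ s * 2ℤ
      lem₃ = solve 2 (λ x s → x :- (con 1ℤ :* x :+ :- con 2ℤ :* s) := s :* con 2ℤ) refl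
    ρ-even : ∀ i → 2ℤ ∣ ρ i
    ρ-even i = subst (2ℤ ∣_) (TT′ ρ i) (mulVec-∣ T (near-last dT (e₂ ρ ρ-near (dT last))) i)
    lift-even : 2ℤ ∣ lift i
    lift-even = subst (2ℤ ∣_) (lem₄ (lift i) (ρ i)) (∣m∣n⇒∣m+n (ρ-near i) (ρ-even i))
      where
      lem₄ : ∀ x y → x - y + y ≡ x
      lem₄ = solve 2 (λ x y → x :- y :+ y := x) refl

  -- The two coordinates at `last` that d_k ∣ 2 does not control. They detect isotropic vectors
  -- modulo 2, which therefore have rank at most two.
  y-val s-val : V n → ℤ
  y-val τ = dot (ζ last low) (mulVec W τ)
  s-val τ = mulVec T′ τ last

  isotropic-even′ : ∀ {τ} → Isotropic τ → 2ℤ ∣ y-val τ → 2ℤ ∣ s-val τ → ∀ i → 2ℤ ∣ τ i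
  isotropic-even′ {τ} I hy hs = isotropic-even I
      (λ _ → subst (2ℤ ∣_) (lem (y-val lift) (y-val τ)) (∣m∣n⇒∣m+n (near-y lift τ lift≡) hy))
      (λ σ near _ → subst (2ℤ ∣_) (lem₂ (s-val σ) (s-val lift) (s-val τ)) (∣m∣n⇒∣m+n (∣m∣n⇒∣m-n (near-s lift τ lift≡) (near-s lift σ near)) hs))
    where
    open Isotropic I
    lem : ∀ x y → x - y + y ≡ x
    lem = solve 2 (λ x y → x :- y :+ y := x) refl
    lem₂ : ∀ s l t → (l - t) - (l - s) + t ≡ s
    lem₂ = solve 3 (λ s l t → (l :- t) :- (l :- s) :+ t := s) refl
    difference : ∀ (x y : V n) → (λ i → x i - y i) ≗ lc 1ℤ x (- 1ℤ) y
    difference x y i = lem₃ (x i) (y i)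
      where
      lem₃ : ∀ x y → x - y ≡ 1ℤ * x + - 1ℤ * y
      lem₃ = solve 2 (λ x y → x :- y := con 1ℤ :* x :+ :- con 1ℤ :* y) refl
    sub : ∀ a b → 1ℤ * a + - 1ℤ * b ≡ a - b
    sub = solve 2 (λ a b → con 1ℤ :* a :+ :- con 1ℤ :* b := a :- b) refl
    near-s : ∀ x y → (∀ i → 2ℤ ∣ x i - y i) → 2ℤ ∣ s-val x - s-val y
    near-s x y h = subst (2ℤ ∣_) (trans (mulVec-cong T′ (difference x y) last) (trans (mulVec-lc T′ 1ℤ x (- 1ℤ) y last) (sub (s-val x) (s-val y)))) (mulVec-∣ T′ h last)
    near-y : ∀ x y → (∀ i → 2ℤ ∣ x i - y i) → 2ℤ ∣ y-val x - y-val y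
    near-y x y h = subst (2ℤ ∣_) (trans (dot-congʳ (ζ last low) (λ i → trans (mulVec-cong W (difference x y) i) (mulVec-lc W 1ℤ x (- 1ℤ) y i))) (trans (dot-lcʳ (ζ last low) 1ℤ (mulVec W x) (- 1ℤ) (mulVec W y)) (sub (y-val x) (y-val y))))
      (dot-∣ (ζ last low) (mulVec-∣ W h))

  y-lc : ∀ a x b y → y-val (lc a x b y) ≡ a * y-val x + b * y-val y
  y-lc a x b y = trans (dot-congʳ (ζ last low) (mulVec-lc W a x b y)) (dot-lcʳ (ζ last low) a (mulVec W x) b (mulVec W y))

  s-lc : ∀ a x b y → s-val (lc a x b y) ≡ a * s-val x + b * s-val y
  s-lc a x b y = mulVec-lc T′ a x b y last

  -- The isotropic vectors have rank at most 2 modulo 2, and x^ε f₀(x²), x^{ε+1} f₀(x²) already have rank 2.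
  proportional : ∀ (f₀ f : V h) c₀ c₁ l₀ → Oddℤ (f₀ l₀) → Oddℤ c₀ ⊎ Oddℤ c₁ →
    Isotropic (tau f₀ 1ℤ 0ℤ) → Isotropic (tau f₀ 0ℤ 1ℤ) → Isotropic (tau f c₀ c₁) →
    Σ ℤ λ α → ∀ l → 2ℤ ∣ f l - α * f₀ l
  proportional f₀ f c₀ c₁ l₀ f₀-odd c-odd I₁ I₂ I₃ = result c-odd
    where
    τ₁ = tau f₀ 1ℤ 0ℤ
    τ₂ = tau f₀ 0ℤ 1ℤ
    τ₃ = tau f c₀ c₁
    a₁ = y-val τ₁
    a₂ = y-val τ₂
    a₃ = y-val τ₃
    b₁ = s-val τ₁
    b₂ = s-val τ₂
    b₃ = s-val τ₃
    Δ = a₁ * b₂ - a₂ * b₁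
    odd-cancel : ∀ {x} → 2ℤ ∣ x * f₀ l₀ → 2ℤ ∣ x
    odd-cancel {x} p = odd*even f₀-odd (subst (2ℤ ∣_) (*-comm x (f₀ l₀)) p)
    -- τ₁ and τ₂ have disjoint supports, so p and q can be read off at the even and the odd position
    -- of l₀, where f₀ is odd.
    coefficients-even : ∀ p q → 2ℤ ∣ p * a₁ + q * a₂ → 2ℤ ∣ p * b₁ + q * b₂ → 2ℤ ∣ p × 2ℤ ∣ q
    coefficients-even p q hy hs = odd-cancel (subst (2ℤ ∣_) (trans (cong₂ (λ x y → p * x + q * y) (tau-even f₀ 1ℤ 0ℤ l₀) (tau-even f₀ 0ℤ 1ℤ l₀)) (lem p q (f₀ l₀))) (even (evenPos l₀)))
        , odd-cancel (subst (2ℤ ∣_) (trans (cong₂ (λ x y → p * x + q * y) (tau-odd f₀ 1ℤ 0ℤ l₀) (tau-odd f₀ 0ℤ 1ℤ l₀)) (lem₂ p q (f₀ l₀))) (even (oddPos l₀)))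
      where
      even = isotropic-even′ (isotropic-lc p q I₁ I₂) (subst (2ℤ ∣_) (sym (y-lc p τ₁ q τ₂)) hy) (subst (2ℤ ∣_) (sym (s-lc p τ₁ q τ₂)) hs)
      lem : ∀ p q f → p * (1ℤ * f) + q * (0ℤ * f) ≡ p * f
      lem = solve 3 (λ p q f → p :* (con 1ℤ :* f) :+ q :* (con 0ℤ :* f) := p :* f) refl
      lem₂ : ∀ p q f → p * (0ℤ * f) + q * (1ℤ * f) ≡ q * f
      lem₂ = solve 3 (λ p q f → p :* (con 0ℤ :* f) :+ q :* (con 1ℤ :* f) := q :* f) refl
    -- For even Δ the pairs (b₂, - b₁) and (- a₂, a₁) would be relations, so b₁ and a₁ would be
    -- even; then (1, 0) would be a relation as well.
    Δ-odd : Oddℤ Δ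
    Δ-odd = not-even⇒odd λ even → odd-not-even one-odd (proj₁ (coefficients-even 1ℤ 0ℤ
        (subst (2ℤ ∣_) (lem₁ a₁ a₂) (a₁-even even)) (subst (2ℤ ∣_) (lem₁ b₁ b₂) (b₁-even even))))
      where
      lem₁ : ∀ a b → a ≡ 1ℤ * a + 0ℤ * b
      lem₁ = solve 2 (λ a b → a := con 1ℤ :* a :+ con 0ℤ :* b) refl
      neg-even : ∀ {x} → 2ℤ ∣ - x → 2ℤ ∣ x
      neg-even {x} p = subst (2ℤ ∣_) (lem x) (∣m⇒∣-m p)
        where
        lem : ∀ x → - - x ≡ x
        lem = solve 1 (λ x → :- :- x := x) refl
      first : ∀ a₁ b₁ a₂ b₂ → a₁ * b₂ - a₂ * b₁ ≡ b₂ * a₁ + - b₁ * a₂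
      first = solve 4 (λ a₁ b₁ a₂ b₂ → a₁ :* b₂ :- a₂ :* b₁ := b₂ :* a₁ :+ :- b₁ :* a₂) refl
      zero₁ : ∀ b₁ b₂ → b₂ * b₁ + - b₁ * b₂ ≡ 0ℤ
      zero₁ = solve 2 (λ b₁ b₂ → b₂ :* b₁ :+ :- b₁ :* b₂ := con 0ℤ) refl
      zero₂ : ∀ a₁ a₂ → - a₂ * a₁ + a₁ * a₂ ≡ 0ℤ
      zero₂ = solve 2 (λ a₁ a₂ → :- a₂ :* a₁ :+ a₁ :* a₂ := con 0ℤ) refl
      second : ∀ a₁ b₁ a₂ b₂ → a₁ * b₂ - a₂ * b₁ ≡ - a₂ * b₁ + a₁ * b₂
      second = solve 4 (λ a₁ b₁ a₂ b₂ → a₁ :* b₂ :- a₂ :* b₁ := :- a₂ :* b₁ :+ a₁ :* b₂) refl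
      b₁-even : 2ℤ ∣ Δ → 2ℤ ∣ b₁
      b₁-even even = neg-even (proj₂ (coefficients-even b₂ (- b₁) (subst (2ℤ ∣_) (first a₁ b₁ a₂ b₂) even) (subst (2ℤ ∣_) (sym (zero₁ b₁ b₂)) ∣0)))
      a₁-even : 2ℤ ∣ Δ → 2ℤ ∣ a₁
      a₁-even even = proj₂ (coefficients-even (- a₂) a₁ (subst (2ℤ ∣_) (sym (zero₂ a₁ a₂)) ∣0) (subst (2ℤ ∣_) (second a₁ b₁ a₂ b₂) even))
    p = a₃ * b₂ - a₂ * b₃
    q = a₁ * b₃ - a₃ * b₁
    τ = lc Δ τ₃ (- 1ℤ) (lc p τ₁ q τ₂)
    τ-even : ∀ i → 2ℤ ∣ τ i
    τ-even = isotropic-even′ (isotropic-lc Δ (- 1ℤ) I₃ (isotropic-lc p q I₁ I₂))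
      (subst (2ℤ ∣_) (sym (trans (y-lc Δ τ₃ (- 1ℤ) _) (trans (cong (λ x → Δ * a₃ + - 1ℤ * x) (y-lc p τ₁ q τ₂)) (cramer a₁ a₂ a₃ b₁ b₂ b₃)))) ∣0)
      (subst (2ℤ ∣_) (sym (trans (s-lc Δ τ₃ (- 1ℤ) _) (trans (cong (λ x → Δ * b₃ + - 1ℤ * x) (s-lc p τ₁ q τ₂)) (cramer′ a₁ a₂ a₃ b₁ b₂ b₃)))) ∣0)
      where
      cramer : ∀ a₁ a₂ a₃ b₁ b₂ b₃ → (a₁ * b₂ - a₂ * b₁) * a₃ + - 1ℤ * ((a₃ * b₂ - a₂ * b₃) * a₁ + (a₁ * b₃ - a₃ * b₁) * a₂) ≡ 0ℤ
      cramer = solve 6 (λ a₁ a₂ a₃ b₁ b₂ b₃ → (a₁ :* b₂ :- a₂ :* b₁) :* a₃ :+ :- con 1ℤ :* ((a₃ :* b₂ :- a₂ :* b₃) :* a₁ :+ (a₁ :* b₃ :- a₃ :* b₁) :* a₂) := con 0ℤ) refl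
      cramer′ : ∀ a₁ a₂ a₃ b₁ b₂ b₃ → (a₁ * b₂ - a₂ * b₁) * b₃ + - 1ℤ * ((a₃ * b₂ - a₂ * b₃) * b₁ + (a₁ * b₃ - a₃ * b₁) * b₂) ≡ 0ℤ
      cramer′ = solve 6 (λ a₁ a₂ a₃ b₁ b₂ b₃ → (a₁ :* b₂ :- a₂ :* b₁) :* b₃ :+ :- con 1ℤ :* ((a₃ :* b₂ :- a₂ :* b₃) :* b₁ :+ (a₁ :* b₃ :- a₃ :* b₁) :* b₂) := con 0ℤ) refl
    -- Since Δ c is odd, f agrees with Δ c f modulo 2.
    reduce : ∀ c α → Oddℤ c → (∀ l → 2ℤ ∣ Δ * (c * f l) - α * f₀ l) → ∀ l → 2ℤ ∣ f l - α * f₀ l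
    reduce c α co h l = subst (2ℤ ∣_) (lem Δ c (f l) (α * f₀ l)) (∣m∣n⇒∣m-n (h l) (∣m⇒∣m*n (f l) (odd-* Δ-odd co)))
      where
      lem : ∀ d c f x → d * (c * f) - x - (d * c - 1ℤ) * f ≡ f - x
      lem = solve 4 (λ d c f x → d :* (c :* f) :- x :- (d :* c :- con 1ℤ) :* f := f :- x) refl
    result : Oddℤ c₀ ⊎ Oddℤ c₁ → Σ ℤ λ α → ∀ l → 2ℤ ∣ f l - α * f₀ l
    result (inj₁ o) = p , reduce c₀ p o λ l → subst (2ℤ ∣_) (trans (cong₂ (λ x y → Δ * x + - 1ℤ * y) (tau-even f c₀ c₁ l) (cong₂ (λ x y → p * x + q * y) (tau-even f₀ 1ℤ 0ℤ l) (tau-even f₀ 0ℤ 1ℤ l)))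
        (lem (Δ * (c₀ * f l)) p q (f₀ l))) (τ-even (evenPos l))
      where
      lem : ∀ x p q g → x + - 1ℤ * (p * (1ℤ * g) + q * (0ℤ * g)) ≡ x - p * g
      lem = solve 4 (λ x p q g → x :+ :- con 1ℤ :* (p :* (con 1ℤ :* g) :+ q :* (con 0ℤ :* g)) := x :- p :* g) refl
    result (inj₂ o) = q , reduce c₁ q o λ l → subst (2ℤ ∣_) (trans (cong₂ (λ x y → Δ * x + - 1ℤ * y) (tau-odd f c₀ c₁ l) (cong₂ (λ x y → p * x + q * y) (tau-odd f₀ 1ℤ 0ℤ l) (tau-odd f₀ 0ℤ 1ℤ l)))
        (lem (Δ * (c₁ * f l)) p q (f₀ l))) (τ-even (oddPos l))
      where
      lem : ∀ x p q g → x + - 1ℤ * (p * (0ℤ * g) + q * (1ℤ * g)) ≡ x - q * g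
      lem = solve 4 (λ x p q g → x :+ :- con 1ℤ :* (p :* (con 0ℤ :* g) :+ q :* (con 1ℤ :* g)) := x :- q :* g) refl

-- Cyclic classes modulo δ, the lattice of a mate, and descent on walk coefficients.

infix 4 _∣ᵛ_
_∣ᵛ_ : ∀ {n} → ℤ → V n → Set
m ∣ᵛ x = ∀ i → m ∣ x i

infixr 7 _⋆_
_⋆_ : ∀ {n} → ℤ → V n → V n
(c ⋆ x) i = c * x i

-- Membership of x in the cyclic subgroup generated by y in ℤⁿ / δ ℤⁿ.
Mult : ∀ {n} → ℤ → V n → V n → Set
Mult δ x y = Σ ℤ λ c → δ ∣ᵛ lc 1ℤ x (- c) y

mult-refl : ∀ {n δ} (x : V n) → Mult δ x x
mult-refl x = 1ℤ , λ i → subst (_ ∣_) (sym (lem (x i))) ∣0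
  where
  lem : ∀ x → 1ℤ * x + - 1ℤ * x ≡ 0ℤ
  lem = solve 1 (λ x → con 1ℤ :* x :+ :- con 1ℤ :* x := con 0ℤ) refl

mult-trans : ∀ {n δ} {x y z : V n} → Mult δ x y → Mult δ y z → Mult δ x z
mult-trans {x = x} {y} {z} (c , p) (c′ , q) = c * c′ , λ i → subst (_ ∣_) (lem (x i) (y i) (z i) c c′) (∣m∣n⇒∣m+n (p i) (∣n⇒∣m*n c (q i)))
  where
  lem : ∀ x y z c d → 1ℤ * x + - c * y + c * (1ℤ * y + - d * z) ≡ 1ℤ * x + - (c * d) * z
  lem = solve 5 (λ x y z c d → con 1ℤ :* x :+ :- c :* y :+ c :* (con 1ℤ :* y :+ :- d :* z) := con 1ℤ :* x :+ :- (c :* d) :* z) refl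

mult-lc : ∀ {n δ} a (x : V n) b y {z} → Mult δ x z → Mult δ y z → Mult δ (lc a x b y) z
mult-lc a x b y {z} (c , p) (c′ , q) = a * c + b * c′ , λ i → subst (_ ∣_) (lem a (x i) b (y i) c c′ (z i)) (∣m∣n⇒∣m+n (∣n⇒∣m*n a (p i)) (∣n⇒∣m*n b (q i)))
  where
  lem : ∀ a x b y c d z → a * (1ℤ * x + - c * z) + b * (1ℤ * y + - d * z) ≡ 1ℤ * (a * x + b * y) + - (a * c + b * d) * z
  lem = solve 7 (λ a x b y c d z → a :* (con 1ℤ :* x :+ :- c :* z) :+ b :* (con 1ℤ :* y :+ :- d :* z) := con 1ℤ :* (a :* x :+ b :* y) :+ :- (a :* c :+ b :* d) :* z) refl

mult-≗ : ∀ {n δ} {x x′ z : V n} → x ≗ x′ → Mult δ x z → Mult δ x′ z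
mult-≗ {z = z} e (c , p) = c , λ i → subst (λ t → _ ∣ 1ℤ * t + - c * z i) (e i) (p i)

mult-∣ : ∀ {n δ} {x} (z : V n) → δ ∣ᵛ x → Mult δ x z
mult-∣ {x = x} z p = 0ℤ , λ i → subst (_ ∣_) (lem (x i) (z i)) (p i)
  where
  lem : ∀ x z → x ≡ 1ℤ * x + - 0ℤ * z
  lem = solve 2 (λ x z → x := con 1ℤ :* x :+ :- con 0ℤ :* z) refl

mult-sum : ∀ {m n δ} (c : V m) (x : Fin m → V n) z → (∀ k → Mult δ (x k) z) → Mult δ (λ i → sumFin (λ k → c k * x k i)) z
mult-sum {zero}  c x z h = mult-∣ z (λ i → subst (_ ∣_) (sym (sum-nil _)) ∣0)
mult-sum {suc m} c x z h = mult-≗ (λ i → trans (cong (c zero * x zero i +_) (*-identityˡ _)) (sym (sum-suc {m} _)))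
  (mult-lc (c zero) (x zero) 1ℤ _ (h zero) (mult-sum (c ∘ suc) (x ∘ suc) z (h ∘ suc)))

-- A gcd of δ and the entries of x. Its universal property carries a factor k so that it yields the
-- order δ / g of x modulo δ.
content : ∀ {m} δ (x : V m) → Σ ℤ λ g → g ∣ δ × g ∣ᵛ x × (∀ {M k} → M ∣ k * δ → (∀ i → M ∣ k * x i) → M ∣ k * g)
content {zero}  δ x = δ , ∣-refl , (λ ()) , λ p _ → p
content {suc m} δ x with content δ (x ∘ suc)
... | g , g∣δ , g∣x , univ = B.g , ∣-trans new∣g g∣δ , (λ { zero → divides B.b′ B.b≡ ; (suc i) → ∣-trans new∣g (g∣x i) })
    , λ {M} {k} p q → subst (M ∣_) (trans (lem k B.x g B.y (x zero)) (cong (k *_) (sym B.g≡))) (∣m∣n⇒∣m+n (∣n⇒∣m*n B.x (univ p (q ∘ suc))) (∣n⇒∣m*n B.y (q zero)))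
  where
  module B = Bezout (bezout g (x zero))
  new∣g : B.g ∣ g
  new∣g = divides B.a′ B.a≡
  lem : ∀ k x g y a → x * (k * g) + y * (k * a) ≡ k * (x * g + y * a)
  lem = solve 5 (λ k x g y a → x :* (k :* g) :+ y :* (k :* a) := k :* (x :* g :+ y :* a)) refl

module MateLattice {n} {A B : Mat n} {δ : ℤ} (m : Mate A B δ) (symA : Symmetric A) (symB : Symmetric B) where
  open Mate m public

  -- vec a is δ times the vector with coordinates a in the orthonormal basis formed by the rows of P / δ;
  -- in this scale the lattice ℤⁿ becomes δ ℤⁿ and integrality of an inner product means divisibility by δ * δ.
  vec : V n → V n
  vec = mulVec (P ᵀ)

  vec-lc : ∀ a x b y → vec (lc a x b y) ≗ lc a (vec x) b (vec y)
  vec-lc = mulVec-lc (P ᵀ)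

  vec-⋆ : ∀ a x → vec (a ⋆ x) ≗ a ⋆ vec x
  vec-⋆ = mulVec-* (P ᵀ)

  dot-vec : ∀ a b → dot (vec a) (vec b) ≡ δ * δ * dot a b
  dot-vec a b = trans (dot-mulVecᵀ (vec a) P b) (trans (dot-cong (PPᵀ a) (λ _ → refl)) (dot-*ˡ (δ * δ) a b))

  A-vec : ∀ a → mulVec A (vec a) ≗ vec (mulVec B a)
  A-vec a = dot-ext λ z → trans (dot-sym symA z (vec a)) (trans (dot-mulVecᵀ (mulVec A z) P a) (trans (dot-cong (PA z) (λ _ → refl))
    (trans (sym (dot-sym symB (mulVec P z) a)) (sym (dot-mulVecᵀ z P (mulVec B a))))))

  iter-vec : ∀ k a → iter A k (vec a) ≗ vec (iter B k a)
  iter-vec zero    a i = refl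
  iter-vec (suc k) a i = trans (mulVec-cong A (iter-vec k a) i) (A-vec (iter B k a) i)

  dot-iter-vec : ∀ k a b → dot (vec a) (iter A k (vec b)) ≡ δ * δ * dot a (iter B k b)
  dot-iter-vec k a b = trans (dot-congʳ (vec a) (iter-vec k b)) (dot-vec a (iter B k b))

  dot-ones-vec : ∀ a → dot ones (vec a) ≡ δ * dot ones a
  dot-ones-vec a = trans (dot-mulVecᵀ ones P a) (trans (dot-cong (λ i → trans (Pe i) (sym (*-identityʳ δ))) (λ _ → refl)) (dot-*ˡ δ ones a))

  -- Moving A^k across gives e · vec (B^k a) = δ (e · B^k a).
  walk-vec : ∀ a k → δ ∣ dot (pow A k) (vec a)
  walk-vec a k = subst (δ ∣_) (sym (trans (dot-cong {y = vec a} (λ i → trans (cong (λ j → pow A j i) (sym (ℕ.+-identityʳ k))) (sym (iter-pow A k 0 i))) (λ _ → refl))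
    (trans (sym (dot-iter symA k ones (vec a))) (trans (dot-congʳ ones (iter-vec k a)) (dot-ones-vec (iter B k a)))))) (∣n*m _)

shift : ∀ {m} → V (suc m) → V (suc m)
shift j zero    = 0ℤ
shift j (suc i) = j (inject₁ i)

sum-init-last : ∀ {m} (f : V (suc m)) → sumFin f ≡ sumFin (f ∘ inject₁) + f (fromℕ m)
sum-init-last {zero}  f = trans (sum-suc {0} f) (trans (+-comm (f zero) _) (cong (_+ f zero) (trans (sum-nil _) (sym (sum-nil _)))))
sum-init-last {suc m} f = trans (sum-suc {suc m} f) (trans (cong (f zero +_) (sum-init-last (f ∘ suc))) (trans (sym (+-assoc (f zero) _ _)) (cong (_+ f (suc (fromℕ m))) (sym (sum-suc {m} _)))))

walk-shift : ∀ {m} (A : Mat (suc m)) j → j (fromℕ m) ≡ 0ℤ → mulVec A (mulVec (walk A) j) ≗ mulVec (walk A) (shift j)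
walk-shift {m} A j j≡0 k = trans (sym (mulVec-∘ A (walk A) j k)) (trans (sum-init-last (λ i → pow A (suc (toℕ i)) k * j i))
  (trans (cong₂ _+_ (sum-cong (λ i → cong (λ l → pow A (suc l) k * j (inject₁ i)) (toℕ-inject₁ i))) (trans (cong (pow A (suc (toℕ (fromℕ m))) k *_) j≡0) (*-zeroʳ (pow A (suc (toℕ (fromℕ m))) k))))
    (trans (+-comm _ 0ℤ) (trans (cong (_+ sumFin (λ i → pow A (suc (toℕ i)) k * j (inject₁ i))) (sym (*-zeroʳ (pow A 0 k)))) (sym (sum-suc {m} _))))))

-- As a polynomial j satisfies (x - c) j ≡ 0 modulo ℓ; since x - c is monic, the coefficients vanish
-- from the top downwards.
shift-divisible : ∀ {m ℓ c} (j : V (suc m)) → j (fromℕ m) ≡ 0ℤ → (∀ i → ℓ ∣ shift j i - c * j i) → ℓ ∣ᵛ j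
shift-divisible {m} {ℓ} {c} j j≡0 h = >-weakInduction (λ i → ℓ ∣ j i) (subst (ℓ ∣_) (sym j≡0) ∣0)
  (λ i p → subst (ℓ ∣_) (lem (j (inject₁ i)) (c * j (suc i))) (∣m∣n⇒∣m+n (h (suc i)) (∣n⇒∣m*n c p)))
  where
  lem : ∀ x y → x - y + y ≡ x
  lem = solve 2 (λ x y → x :- y :+ y := x) refl

-- With last coefficient zero, A acts on walk coefficients as a plain shift, without reduction by
-- the characteristic polynomial; injectivity of W then gives an identity of coefficients.
walk-descent : ∀ {n} (A : Mat n) (last : Fin n) → suc (toℕ last) ≡ n → (∀ z → (∀ i → mulVec (walk A) z i ≡ 0ℤ) → ∀ i → z i ≡ 0ℤ) →
  ∀ j k ℓ c → j last ≡ 0ℤ → (∀ i → ℓ * mulVec (walk A) k i ≡ mulVec A (mulVec (walk A) j) i - c * mulVec (walk A) j i) → ℓ ∣ᵛ j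
walk-descent {suc m} A last last≡ inj j k ℓ c j≡0 eq = shift-divisible {m} {ℓ} {c} j j≡0′ (λ i → divides (k i) (trans (sym (solved i)) (*-comm ℓ (k i))))
  where
  last≡fromℕ : last ≡ fromℕ m
  last≡fromℕ = toℕ-injective (trans (ℕ.suc-injective last≡) (sym (toℕ-fromℕ m)))
  j≡0′ : j (fromℕ m) ≡ 0ℤ
  j≡0′ = subst (λ i → j i ≡ 0ℤ) last≡fromℕ j≡0
  w : V (suc m)
  w = lc ℓ k (- 1ℤ) (lc 1ℤ (shift j) (- c) j)
  Ww : ∀ i → mulVec (walk A) w i ≡ 0ℤ
  Ww i = trans (mulVec-lc (walk A) ℓ k (- 1ℤ) _ i) (trans (cong₂ (λ x y → x + - 1ℤ * y) (eq i) (trans (mulVec-lc (walk A) 1ℤ (shift j) (- c) j i) (cong (λ x → 1ℤ * x + - c * mulVec (walk A) j i) (sym (walk-shift A j j≡0′ i)))))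
      (lem (mulVec A (mulVec (walk A) j) i) c (mulVec (walk A) j i)))
    where
    lem : ∀ a c x → a - c * x + - 1ℤ * (1ℤ * a + - c * x) ≡ 0ℤ
    lem = solve 3 (λ a c x → a :- c :* x :+ :- con 1ℤ :* (con 1ℤ :* a :+ :- c :* x) := con 0ℤ) refl
  solved : ∀ i → ℓ * k i ≡ shift j i - c * j i
  solved i = x-y≡0⇒x≡y (trans (lem (ℓ * k i) (shift j i) c (j i)) (inj w Ww i))
    where
    lem : ∀ a s c x → a - (s - c * x) ≡ a + - 1ℤ * (1ℤ * s + - c * x)
    lem = solve 4 (λ a s c x → a :- (s :- c :* x) := a :+ :- con 1ℤ :* (con 1ℤ :* s :+ :- c :* x)) refl

mult-eq : ∀ {n δ} {x y : V n} → Mult δ x y → Σ ℤ λ c → Σ (V n) λ w → ∀ i → x i ≡ c * y i + δ * w i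
mult-eq {δ = δ} {x} {y} (c , p) = c , proj₁ quotients , λ i → trans (lem (x i) c (y i)) (cong (c * y i +_) (proj₂ quotients i))
  where
  quotients = evens p
  lem : ∀ x c y → x ≡ c * y + (1ℤ * x + - c * y)
  lem = solve 3 (λ x c y → x := c :* y :+ (con 1ℤ :* x :+ :- c :* y)) refl

-- Cyclicity of the quotient, its order, and comparison of two mates.

module Main {n} (h ε : ℕ) (n≡ : n ≡ (ε ℕ.+ h) ℕ.+ h) (ε≤1 : ε ≡ 0 ⊎ ε ≡ 1) {A : Mat n} (symA : Symmetric A) (zeroA : ∀ i → A i i ≡ 0ℤ)
  {d : V n} (S : Smith (walk A) d) (d-low : ∀ i → toℕ i ℕ.< ε ℕ.+ h → d i ≡ 1ℤ) (last : Fin n) (low : ∀ i → i ≢ last → d i ∣ 2ℤ)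
  (δ≢0 : d last ≢ 0ℤ) (d∣δ : ∀ i → d i ∣ d last) (last≡ : suc (toℕ last) ≡ n) where

  open Kernel h ε n≡ ε≤1 symA zeroA S d-low last low
  open SmithProperties S

  δ : ℤ
  δ = d last

  -- Not the all-ones vector, which is `ones`, but the vector ζ of the Smith form.
  e : V n
  e = ζ last low

  Integral : V n → Set
  Integral t = ∀ (j : Fin n) → δ ∣ dot (pow A (toℕ j)) t

  integral-lc : ∀ a x b y → Integral x → Integral y → Integral (lc a x b y)
  integral-lc a x b y p q j = subst (δ ∣_) (sym (dot-lcʳ (pow A (toℕ j)) a x b y)) (∣m∣n⇒∣m+n (∣n⇒∣m*n a (p j)) (∣n⇒∣m*n b (q j)))

  halfInt : ∀ y → Integral y → δ ∣ 2ℤ * dot e y → δ ∣ᵛ 2ℤ ⋆ y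
  halfInt = half-integral last low

  -- The class of t / δ modulo ℤⁿ is killed by 2; as z is K f modulo 2, it is determined by f modulo
  -- 2.
  record Torsion (t : V n) : Set where
    field
      z  : V n
      2t≡ : ∀ i → 2ℤ * t i ≡ δ * z i
      f  : V h
      β  : V n
      z≗ : z ≗ lc 1ℤ (mulVec K f) 2ℤ β

    isotropic : ∀ c₀ c₁ → (∀ k → 4ℤ ∣ c₀ * dot z (iter A k z) + c₁ * dot z (iter A (suc k) z)) → Isotropic (tau f c₀ c₁)
    isotropic c₀ c₁ hyp = isotropic-tau f c₀ c₁ λ k → subst (4ℤ ∣_) (lem c₀ (dot z (iter A k z)) (qform f k) c₁ (dot z (iter A (suc k) z)) (qform f (suc k)))
        (∣m∣n⇒∣m-n (hyp k) (∣m∣n⇒∣m+n (∣n⇒∣m*n c₀ (quadratic-mod4 z f β z≗ k)) (∣n⇒∣m*n c₁ (quadratic-mod4 z f β z≗ (suc k)))))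
      where
      lem : ∀ c x q c′ x′ q′ → (c * x + c′ * x′) - (c * (x - q) + c′ * (x′ - q′)) ≡ c * q + c′ * q′
      lem = solve 6 (λ c x q c′ x′ q′ → (c :* x :+ c′ :* x′) :- (c :* (x :- q) :+ c′ :* (x′ :- q′)) := c :* q :+ c′ :* q′) refl

  open Torsion

  opaque
    torsion : ∀ {t} → Integral t → δ ∣ᵛ 2ℤ ⋆ t → Torsion t
    torsion {t} integral double = record { z = half ; 2t≡ = eq ; f = proj₁ ker ; β = proj₁ (proj₂ ker) ; z≗ = proj₂ (proj₂ ker) }
      where
      half : V n
      half i = _∣_.quotient (double i)
      eq : ∀ i → 2ℤ * t i ≡ δ * half i
      eq i = trans (_∣_.equality (double i)) (*-comm (half i) δ)
      ker : Σ (V h) λ f → Σ (V n) λ β → half ≗ lc 1ℤ (mulVec K f) 2ℤ β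
      ker = kernel half (λ j → ∣-cancelˡ δ δ≢0 (subst (δ * 2ℤ ∣_) (trans (sym (dot-*ʳ (pow A (toℕ j)) 2ℤ t)) (trans (dot-congʳ (pow A (toℕ j)) eq) (dot-*ʳ (pow A (toℕ j)) δ half)))
        (subst (_∣ 2ℤ * dot (pow A (toℕ j)) t) (*-comm 2ℤ δ) (*-mono-∣ (∣-refl {2ℤ}) (integral j)))))

  halve-∣ : ∀ {x y} → 2ℤ * x ≡ δ * y → 2ℤ ∣ y → δ ∣ x
  halve-∣ {x} {y} eq p = ∣-cancelˡ 2ℤ 2≢0 (subst₂ _∣_ (*-comm δ 2ℤ) (sym eq) (*-mono-∣ (∣-refl {δ}) p))

  torsion-agree : ∀ {t t₀} (T : Torsion t) (T₀ : Torsion t₀) α → (∀ l → 2ℤ ∣ f T l - α * f T₀ l) → δ ∣ᵛ lc 1ℤ t (- α) t₀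
  torsion-agree {t} {t₀} T T₀ α hyp i = halve-∣ {y = z T i - α * z T₀ i} (trans (lem (t i) α (t₀ i)) (trans (cong₂ (λ x y → x - α * y) (2t≡ T i) (2t≡ T₀ i)) (lem₂ δ (z T i) α (z T₀ i))))
      (subst (2ℤ ∣_) (sym (trans (cong₂ (λ x y → x - α * y) (z≗ T i) (z≗ T₀ i)) (lem₃ (mulVec K (f T) i) (β T i) α (mulVec K (f T₀) i) (β T₀ i))))
        (∣m∣n⇒∣m+n (subst (2ℤ ∣_) (mulVec-lc K 1ℤ (f T) (- α) (f T₀) i) (mulVec-∣ K (λ l → subst (2ℤ ∣_) (lem₄ (f T l) α (f T₀ l)) (hyp l)) i)) (∣m*n (β T i - α * β T₀ i))))
    where
    lem : ∀ t a s → 2ℤ * (1ℤ * t + - a * s) ≡ 2ℤ * t - a * (2ℤ * s)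
    lem = solve 3 (λ t a s → con 2ℤ :* (con 1ℤ :* t :+ :- a :* s) := con 2ℤ :* t :- a :* (con 2ℤ :* s)) refl
    lem₂ : ∀ d x a y → d * x - a * (d * y) ≡ d * (x - a * y)
    lem₂ = solve 4 (λ d x a y → d :* x :- a :* (d :* y) := d :* (x :- a :* y)) refl
    lem₃ : ∀ k b a l c → (1ℤ * k + 2ℤ * b) - a * (1ℤ * l + 2ℤ * c) ≡ (1ℤ * k + - a * l) + (b - a * c) * 2ℤ
    lem₃ = solve 5 (λ k b a l c → (con 1ℤ :* k :+ con 2ℤ :* b) :- a :* (con 1ℤ :* l :+ con 2ℤ :* c) := (con 1ℤ :* k :+ :- a :* l) :+ (b :- a :* c) :* con 2ℤ) refl
    lem₄ : ∀ x a y → x - a * y ≡ 1ℤ * x + - a * y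
    lem₄ = solve 3 (λ x a y → x :- a :* y := con 1ℤ :* x :+ :- a :* y) refl

  torsion-odd : ∀ {t} (T : Torsion t) → ¬ δ ∣ᵛ t → Σ (Fin h) λ l → Oddℤ (f T l)
  torsion-odd {t} T ∤ = decide (any? (λ l → odd? (f T l)))
    where
    decide : Dec (Σ (Fin h) λ l → Oddℤ (f T l)) → Σ (Fin h) λ l → Oddℤ (f T l)
    decide (yes p) = p
    decide (no none) = ⊥-elim (∤ λ i → halve-∣ (2t≡ T i) (subst (2ℤ ∣_) (sym (z≗ T i))
      (∣m∣n⇒∣m+n (∣n⇒∣m*n 1ℤ (mulVec-∣ K (λ l → not-odd⇒even (λ o → none (l , o))) i)) (∣n*m (β T i)))))

  quadruple : ∀ {t} (T : Torsion t) k → 4ℤ * dot t (iter A k t) ≡ δ * (δ * dot (z T) (iter A k (z T)))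
  quadruple {t} T k = trans (cong (_* dot t (iter A k t)) (pos-* 2 2)) (trans (lem 2ℤ (dot t (iter A k t))) (trans (sym (double₂ 2ℤ t))
      (trans (dot-cong {x = 2ℤ ⋆ t} {δ ⋆ z T} {iter A k (2ℤ ⋆ t)} {iter A k (δ ⋆ z T)} (2t≡ T) (iter-cong A k (2t≡ T))) (double₂ δ (z T)))))
    where
    lem : ∀ c x → c * c * x ≡ c * (c * x)
    lem = solve 2 (λ c x → c :* c :* x := c :* (c :* x)) refl
    iter-⋆ : ∀ c k x → iter A k (c ⋆ x) ≗ c ⋆ iter A k x
    iter-⋆ c zero    x i = refl
    iter-⋆ c (suc k) x i = trans (mulVec-cong A (iter-⋆ c k x) i) (mulVec-* A c (iter A k x) i)
    double₂ : ∀ c x → dot (c ⋆ x) (iter A k (c ⋆ x)) ≡ c * (c * dot x (iter A k x))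
    double₂ c x = trans (dot-*ˡ c x _) (cong (c *_) (trans (dot-congʳ x (iter-⋆ c k x)) (dot-*ʳ x c (iter A k x))))

  module _ {B} (m : Mate A B δ) (symB : Symmetric B) where
    open MateLattice m symA symB

    vec-integral : ∀ a → Integral (vec a)
    vec-integral a j = walk-vec a (toℕ j)

    module _ {a} (T : Torsion (vec a)) where

      -- The product vec a · A^k vec a is δ² (a · B^k a); substituting 2 vec a = δ z gives 4 (a ·
      -- B^k a).
      vec-quadratic : ∀ k → 4ℤ ∣ dot (z T) (iter A k (z T))
      vec-quadratic k = divides (dot a (iter B k a)) (*-cancelˡ δ δ≢0 (*-cancelˡ δ δ≢0 (trans (sym (quadruple T k)) (trans (cong (4ℤ *_) (dot-iter-vec k a a)) (lem 4ℤ δ _)))))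
        where
        lem : ∀ q d x → q * (d * d * x) ≡ d * (d * (x * q))
        lem = solve 3 (λ q d x → q :* (d :* d :* x) := d :* (d :* (x :* q))) refl

      vec-isotropic : ∀ c₀ c₁ → Isotropic (tau (f T) c₀ c₁)
      vec-isotropic c₀ c₁ = isotropic T c₀ c₁ λ k → ∣m∣n⇒∣m+n (∣n⇒∣m*n c₀ (vec-quadratic k)) (∣n⇒∣m*n c₁ (vec-quadratic (suc k)))

      -- The nonzero class of vec a supplies f₀ in `proportional`. The vector t may lie outside the
      -- lattice of the mate: one relation c₀ + c₁ x modulo 4 is enough for it.
      torsion-multiple : ¬ δ ∣ᵛ vec a → ∀ {t} (T′ : Torsion t) c₀ c₁ → Oddℤ c₀ ⊎ Oddℤ c₁ →
        (∀ k → 4ℤ ∣ c₀ * dot (z T′) (iter A k (z T′)) + c₁ * dot (z T′) (iter A (suc k) (z T′))) → Mult δ t (vec a)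
      torsion-multiple ∤ T′ c₀ c₁ odd hyp = proj₁ multiple , torsion-agree T′ T (proj₁ multiple) (proj₂ multiple)
        where
        entry = torsion-odd T ∤
        multiple = proportional (f T) (f T′) c₀ c₁ (proj₁ entry) (proj₂ entry) odd (vec-isotropic 1ℤ 0ℤ) (vec-isotropic 0ℤ 1ℤ) (isotropic T′ c₀ c₁ hyp)

      -- The hypothesis says that 4 does not divide δ. Then the coordinates at `last` behave like
      -- the others, isotropic vectors are even, and f cannot have an odd entry.
      no-torsion : (∀ y → 4ℤ ∣ δ * y → 2ℤ ∣ y) → δ ∣ᵛ vec a
      no-torsion half = decide (all? (λ i → δ ∣? vec a i))
        where
        absurd : (Σ (Fin h) λ l → Oddℤ (f T l)) → δ ∣ᵛ vec a
        absurd (l , l-odd) = ⊥-elim (odd-not-even l-odd (subst (2ℤ ∣_) (trans (tau-even (f T) 1ℤ 0ℤ l) (*-identityˡ _))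
          (isotropic-even (vec-isotropic 1ℤ 0ℤ) (half _) (λ _ _ → half _) (evenPos l))))
        decide : Dec (δ ∣ᵛ vec a) → δ ∣ᵛ vec a
        decide (yes p) = p
        decide (no ∤) = absurd (torsion-odd T ∤)

    vec-torsion : ∀ a → δ ∣ᵛ 2ℤ ⋆ vec a → Torsion (vec a)
    vec-torsion a p = torsion (vec-integral a) p

    -- Starting from δ, which annihilates the class, factors 2 are removed until the annihilator is
    -- odd or the next removal leaves a class of order exactly 2.
    dichotomy : ∀ a → (Σ ℤ λ o → Oddℤ o × δ ∣ᵛ o ⋆ vec a) ⊎ (Σ ℤ λ k → ¬ δ ∣ᵛ k ⋆ vec a × δ ∣ᵛ (2ℤ * k) ⋆ vec a)
    dichotomy a = descend j (λ i → subst (λ c → δ ∣ c * vec a i) eq (∣n*m (vec a i)))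
      where
      factors = two-adic δ δ≢0
      j = proj₁ factors
      o = proj₁ (proj₂ factors)
      odd = proj₁ (proj₂ (proj₂ factors))
      eq = proj₂ (proj₂ (proj₂ factors))
      descend : ∀ j → δ ∣ᵛ (2ℤ ^ j * o) ⋆ vec a → (Σ ℤ λ o → Oddℤ o × δ ∣ᵛ o ⋆ vec a) ⊎ (Σ ℤ λ k → ¬ δ ∣ᵛ k ⋆ vec a × δ ∣ᵛ (2ℤ * k) ⋆ vec a)
      descend zero    p = inj₁ (o , odd , λ i → subst (λ c → δ ∣ c * vec a i) (*-identityˡ o) (p i))
      descend (suc j) p = decide (all? (λ i → δ ∣? (2ℤ ^ j * o) * vec a i))
        where
        decide : Dec (δ ∣ᵛ (2ℤ ^ j * o) ⋆ vec a) → (Σ ℤ λ o → Oddℤ o × δ ∣ᵛ o ⋆ vec a) ⊎ (Σ ℤ λ k → ¬ δ ∣ᵛ k ⋆ vec a × δ ∣ᵛ (2ℤ * k) ⋆ vec a)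
        decide (yes q) = descend j q
        decide (no ∤)  = inj₂ (2ℤ ^ j * o , ∤ , λ i → subst (λ c → δ ∣ c * vec a i) (*-assoc 2ℤ (2ℤ ^ j) o) (p i))

    -- A Bezout change of basis for the products with ζ yields u₁ and t, where ζ · vec t = 0 makes t
    -- a 2-torsion class. It remains to absorb t.
    pair-generator : ∀ a b → Σ (V n) λ u → Mult δ (vec a) (vec u) × Mult δ (vec b) (vec u)
    pair-generator a b = decide (all? (λ i → δ ∣? vec t i)) (dichotomy u₁)
      where
      open Bezout (bezout (dot e (vec a)) (dot e (vec b)))
      u₁ t : V n
      u₁ = lc x a y b
      t = lc b′ a (- a′) b
      vec-a : vec a ≗ lc a′ (vec u₁) y (vec t)
      vec-a i = sym (trans (cong₂ (λ p q → a′ * p + y * q) (vec-lc x a y b i) (vec-lc b′ a (- a′) b i))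
          (trans (lem a′ x y b′ (vec a i) (vec b i)) (trans (cong (_* vec a i) coprime) (*-identityˡ _))))
        where
        lem : ∀ a x y b p q → a * (x * p + y * q) + y * (b * p + - a * q) ≡ (x * a + y * b) * p
        lem = solve 6 (λ a x y b p q → a :* (x :* p :+ y :* q) :+ y :* (b :* p :+ :- a :* q) := (x :* a :+ y :* b) :* p) refl
      vec-b : vec b ≗ lc b′ (vec u₁) (- x) (vec t)
      vec-b i = sym (trans (cong₂ (λ p q → b′ * p + - x * q) (vec-lc x a y b i) (vec-lc b′ a (- a′) b i))
          (trans (lem a′ x y b′ (vec a i) (vec b i)) (trans (cong (_* vec b i) coprime) (*-identityˡ _))))
        where
        lem : ∀ a x y b p q → b * (x * p + y * q) + - x * (b * p + - a * q) ≡ (x * a + y * b) * q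
        lem = solve 6 (λ a x y b p q → b :* (x :* p :+ y :* q) :+ :- x :* (b :* p :+ :- a :* q) := (x :* a :+ y :* b) :* q) refl
      2t : δ ∣ᵛ 2ℤ ⋆ vec t
      2t = halfInt (vec t) (vec-integral t) (subst (δ ∣_) (sym (trans (cong (2ℤ *_) (trans (dot-congʳ e (vec-lc b′ a (- a′) b)) (trans (dot-lcʳ e b′ (vec a) (- a′) (vec b)) (cong₂ (λ p q → b′ * p + - a′ * q) a≡ b≡)))) (lem a′ b′ g))) ∣0)
        where
        lem : ∀ a b g → 2ℤ * (b * (a * g) + - a * (b * g)) ≡ 0ℤ
        lem = solve 3 (λ a b g → con 2ℤ :* (b :* (a :* g) :+ :- a :* (b :* g)) := con 0ℤ) refl
      from : ∀ u → Mult δ (vec u₁) (vec u) → Mult δ (vec t) (vec u) → Mult δ (vec a) (vec u) × Mult δ (vec b) (vec u)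
      from u p q = mult-≗ (λ i → sym (vec-a i)) (mult-lc a′ (vec u₁) y (vec t) p q) , mult-≗ (λ i → sym (vec-b i)) (mult-lc b′ (vec u₁) (- x) (vec t) p q)
      decide : Dec (δ ∣ᵛ vec t) → (Σ ℤ λ o → Oddℤ o × δ ∣ᵛ o ⋆ vec u₁) ⊎ (Σ ℤ λ k → ¬ δ ∣ᵛ k ⋆ vec u₁ × δ ∣ᵛ (2ℤ * k) ⋆ vec u₁) →
        Σ (V n) λ u → Mult δ (vec a) (vec u) × Mult δ (vec b) (vec u)
      decide (yes p) _ = u₁ , from u₁ (mult-refl (vec u₁)) (mult-∣ (vec u₁) p)
      -- Some k u₁ is a nonzero 2-torsion class, and t is a multiple of it.
      decide (no ∤) (inj₂ (k , ∤k , 2k)) = u₁ , from u₁ (mult-refl (vec u₁))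
          (mult-trans (torsion-multiple T₀ (λ p → ∤k (λ i → subst (δ ∣_) (vec-⋆ k u₁ i) (p i))) (vec-torsion t 2t) 1ℤ 0ℤ (inj₁ one-odd)
              (λ k → ∣m∣n⇒∣m+n (∣n⇒∣m*n 1ℤ (vec-quadratic (vec-torsion t 2t) k)) (∣n⇒∣m*n 0ℤ (vec-quadratic (vec-torsion t 2t) (suc k)))))
            (k , λ i → subst (δ ∣_) (sym (trans (cong (λ p → 1ℤ * p + - k * vec u₁ i) (vec-⋆ k u₁ i)) (lem k (vec u₁ i)))) ∣0))
        where
        lem : ∀ k x → 1ℤ * (k * x) + - k * x ≡ 0ℤ
        lem = solve 2 (λ k x → con 1ℤ :* (k :* x) :+ :- k :* x := con 0ℤ) refl
        T₀ : Torsion (vec (k ⋆ u₁))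
        T₀ = vec-torsion (k ⋆ u₁) (λ i → subst (δ ∣_) (trans (*-assoc 2ℤ k (vec u₁ i)) (cong (2ℤ *_) (sym (vec-⋆ k u₁ i)))) (2k i))
      -- With u₁ killed by the odd number o and t killed by 2, the sum u₁ + t generates both, as o
      -- (u₁ + t) ≡ t.
      decide (no ∤) (inj₁ (o , odd , ou₁)) = u , from u u₁-mult t-mult
        where
        u : V n
        u = lc 1ℤ u₁ 1ℤ t
        t-mult : Mult δ (vec t) (vec u)
        t-mult = o , λ i → subst (δ ∣_) (trans (lem o (vec t i) (vec u₁ i) (_∣_.quotient odd) ) (trans (cong (λ w → 1ℤ * vec t i + - (1ℤ + w) * (1ℤ * vec u₁ i + 1ℤ * vec t i)) (sym (_∣_.equality odd)))
            (trans (lem₂ o (vec t i) (1ℤ * vec u₁ i + 1ℤ * vec t i)) (cong (λ w → 1ℤ * vec t i + - o * w) (sym (vec-lc 1ℤ u₁ 1ℤ t i))))))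
          (∣m⇒∣-m (∣m∣n⇒∣m+n (∣m⇒∣-m′ i) (∣n⇒∣m*n (_∣_.quotient odd) (2t i))))
          where
          ∣m⇒∣-m′ : ∀ i → δ ∣ (1ℤ + _∣_.quotient odd * 2ℤ) * vec u₁ i
          ∣m⇒∣-m′ i = subst (λ w → δ ∣ w * vec u₁ i) (trans (lem₃ o) (cong (1ℤ +_) (_∣_.equality odd))) (ou₁ i)
            where
            lem₃ : ∀ o → o ≡ 1ℤ + (o - 1ℤ)
            lem₃ = solve 1 (λ o → o := con 1ℤ :+ (o :- con 1ℤ)) refl
          lem : ∀ o t u q → - ((1ℤ + q * 2ℤ) * u + q * (2ℤ * t)) ≡ 1ℤ * t + - (1ℤ + q * 2ℤ) * (1ℤ * u + 1ℤ * t)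
          lem = solve 4 (λ o t u q → :- ((con 1ℤ :+ q :* con 2ℤ) :* u :+ q :* (con 2ℤ :* t)) := con 1ℤ :* t :+ :- (con 1ℤ :+ q :* con 2ℤ) :* (con 1ℤ :* u :+ con 1ℤ :* t)) refl
          lem₂ : ∀ o t w → 1ℤ * t + - (1ℤ + (o - 1ℤ)) * w ≡ 1ℤ * t + - o * w
          lem₂ = solve 3 (λ o t w → con 1ℤ :* t :+ :- (con 1ℤ :+ (o :- con 1ℤ)) :* w := con 1ℤ :* t :+ :- o :* w) refl
        u₁-mult : Mult δ (vec u₁) (vec u)
        u₁-mult = mult-≗ (λ i → trans (cong (λ w → 1ℤ * w + - 1ℤ * vec t i) (vec-lc 1ℤ u₁ 1ℤ t i)) (lem (vec u₁ i) (vec t i))) (mult-lc 1ℤ (vec u) (- 1ℤ) (vec t) (mult-refl (vec u)) t-mult)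
          where
          lem : ∀ u t → 1ℤ * (1ℤ * u + 1ℤ * t) + - 1ℤ * t ≡ u
          lem = solve 2 (λ u t → con 1ℤ :* (con 1ℤ :* u :+ con 1ℤ :* t) :+ :- con 1ℤ :* t := u) refl

    generator : Σ (V n) λ u → ∀ b → Mult δ (vec b) (vec u)
    generator = proj₁ (family idMat) , λ b → mult-≗ (λ i → sum-cong (λ k → trans (cong (b k *_) (mulVec-unit (P ᵀ) k i)) (*-comm (b k) _))) (mult-sum b (λ k → vec (idMat k)) _ (proj₂ (family idMat)))
      where
      family : ∀ {k} (v : Fin k → V n) → Σ (V n) λ u → ∀ i → Mult δ (vec (v i)) (vec u)
      family {zero}  v = ones , λ ()
      family {suc k} v = proj₁ pair , λ { zero → proj₁ (proj₂ pair) ; (suc i) → mult-trans (proj₂ tail i) (proj₂ (proj₂ pair)) }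
        where
        tail = family (v ∘ suc)
        pair = pair-generator (v zero) (proj₁ tail)

  record MateLevel {B} (m : Mate A B δ) (symB : Symmetric B) : Set where
    open MateLattice m symA symB
    field
      u   : V n
      gen : ∀ b → Mult δ (vec b) (vec u)
      ℓ   : ℕ
      order⇒ : ∀ k → δ ∣ᵛ k ⋆ vec u → ℤ.+ ℓ ∣ k
      order⇐ : ∀ k → ℤ.+ ℓ ∣ k → δ ∣ᵛ k ⋆ vec u

  abs-≡ : ∀ x → (x ≡ ℤ.+ ℤ.∣ x ∣) ⊎ (x ≡ - ℤ.+ ℤ.∣ x ∣)
  abs-≡ (ℤ.+ n) = inj₁ refl
  abs-≡ ℤ.-[1+ n ] = inj₂ neg
    where
    opaque
      unfolding _+_
      neg : ℤ.-[1+ n ] ≡ - ℤ.+ suc n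
      neg = refl

  abs-∣ : ∀ {x y} → x ∣ y → ℤ.+ ℤ.∣ x ∣ ∣ y
  abs-∣ {x} (divides q refl) with abs-≡ x
  ... | inj₁ eq = divides q (cong (q *_) eq)
  ... | inj₂ eq = divides (- q) (trans (cong (q *_) eq) (lem q _))
    where
    lem : ∀ q x → q * - x ≡ - q * x
    lem = solve 2 (λ q x → q :* :- x := :- q :* x) refl

  ∣-abs : ∀ {x y} → ℤ.+ ℤ.∣ x ∣ ∣ y → x ∣ y
  ∣-abs {x} (divides q refl) with abs-≡ x
  ... | inj₁ eq = divides q (cong (q *_) (sym eq))
  ... | inj₂ eq = divides (- q) (trans (lem q _) (cong (- q *_) (sym eq)))
    where
    lem : ∀ q x → q * x ≡ - q * - x
    lem = solve 2 (λ q x → q :* x := :- q :* :- x) refl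

  -- The order is δ / g for the gcd g of δ and the entries of vec u.
  level : ∀ {B} (m : Mate A B δ) (symB : Symmetric B) → MateLevel m symB
  level m symB = record { u = u ; gen = gen ; ℓ = ℤ.∣ l ∣
    ; order⇒ = λ k p → abs-∣ (∣-cancelˡ g g≢0 (subst₂ _∣_ (trans δ≡ (*-comm l g)) (*-comm k g) (univ (∣m*n k) p)))
    ; order⇐ = λ k p i → subst₂ _∣_ (sym δ≡) refl (*-mono-∣ (∣-abs p) (g∣u i)) }
    where
    u = proj₁ (generator m symB)
    gen = proj₂ (generator m symB)
    contents = content δ (MateLattice.vec m symA symB u)
    g = proj₁ contents
    l = _∣_.quotient (proj₁ (proj₂ contents))
    δ≡ = _∣_.equality (proj₁ (proj₂ contents))
    g∣u = proj₁ (proj₂ (proj₂ contents))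
    univ : ∀ {M k} → M ∣ k * δ → (∀ i → M ∣ k * MateLattice.vec m symA symB u i) → M ∣ k * g
    univ = proj₂ (proj₂ (proj₂ contents))
    g≢0 : g ≢ 0ℤ
    g≢0 eq = δ≢0 (trans δ≡ (trans (cong (l *_) eq) (*-zeroʳ l)))

  walk-injective : ∀ z → (∀ i → mulVec W z i ≡ 0ℤ) → ∀ i → z i ≡ 0ℤ
  walk-injective z Wz i = *≡0 δ δ≢0 (trans (sym (XW c cd z i)) (sum-zero (λ k → trans (cong (X c cd i k *_) (Wz k)) (*-zeroʳ (X c cd i k)))))
    where
    c : V n
    c i = _∣_.quotient (d∣δ i)
    cd : ∀ i → c i * d i ≡ δ
    cd i = sym (_∣_.equality (d∣δ i))

  module Order {B} (m : Mate A B δ) (symB : Symmetric B) (L : MateLevel m symB) where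
    open MateLattice m symA symB public
    open MateLevel L public

    û : V n
    û = vec u

    λL : ℤ
    λL = ℤ.+ ℓ

    λL∣δ : λL ∣ δ
    λL∣δ = order⇒ δ (λ i → ∣n*m (û i))

    λL≢0 : λL ≢ 0ℤ
    λL≢0 eq = δ≢0 (0∣⇒≡0 (subst (_∣ δ) eq λL∣δ))

    -- The single product ζ · û detects the order up to a factor 2.
    half-order : ∀ k → δ ∣ 2ℤ * k * dot e û → λL ∣ 2ℤ * k
    half-order k p = order⇒ (2ℤ * k) (λ i → subst (δ ∣_) (sym (*-assoc 2ℤ k (û i)))
      (halfInt (k ⋆ û) (λ j → subst (δ ∣_) (sym (dot-*ʳ (pow A (toℕ j)) k û)) (∣n⇒∣m*n k (vec-integral m symB u j)))
        (subst (δ ∣_) (trans (*-assoc 2ℤ k (dot e û)) (cong (2ℤ *_) (sym (dot-*ʳ e k û)))) p) i))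

    -- A preserves the cyclic quotient, hence acts on its generator as a scalar.
    eigen : Σ ℤ λ c → Σ (V n) λ x → ∀ i → mulVec A û i ≡ c * û i + δ * x i
    eigen = proj₁ eq , proj₁ (proj₂ eq) , λ i → trans (A-vec u i) (proj₂ (proj₂ eq) i)
      where eq = mult-eq (gen (mulVec B u))

    half-not-multiple : ∀ q → λL ≡ q * 2ℤ → ¬ λL ∣ q
    half-not-multiple q eq (divides r q≡) = odd-not-even one-odd (divides r (sym (*-cancelˡ λL λL≢0 (trans (lem λL r) (trans (cong (_* 2ℤ) (sym q≡)) (trans (sym eq) (sym (*-identityʳ λL))))))))
      where
      lem : ∀ l r → l * (r * 2ℤ) ≡ r * l * 2ℤ
      lem = solve 2 (λ l r → l :* (r :* con 2ℤ) := r :* l :* con 2ℤ) refl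

    half-torsion : ∀ q → λL ≡ q * 2ℤ → Torsion (vec (q ⋆ u)) × ¬ δ ∣ᵛ vec (q ⋆ u)
    half-torsion q eq = vec-torsion m symB (q ⋆ u) (λ i → subst (δ ∣_) (trans (*-assoc 2ℤ q (û i)) (cong (2ℤ *_) (sym (vec-⋆ q u i)))) (order⇐ (2ℤ * q) (divides 1ℤ (trans (*-comm 2ℤ q) (trans (sym eq) (sym (*-identityˡ λL))))) i))
      , λ p → half-not-multiple q eq (order⇒ q (λ i → subst (δ ∣_) (vec-⋆ q u i) (p i)))

    odd-order : (∀ y → 4ℤ ∣ δ * y → 2ℤ ∣ y) → Oddℤ λL
    odd-order half = not-even⇒odd λ { (divides q eq) → proj₂ (half-torsion q eq) (no-torsion m symB (proj₁ (half-torsion q eq)) half) }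

    κ : ℤ
    κ = _∣_.quotient λL∣δ

    δ≡ : δ ≡ κ * λL
    δ≡ = _∣_.equality λL∣δ

    dot-û-walks : ∀ z → δ ∣ dot û (mulVec W z)
    dot-û-walks z = subst (δ ∣_) (sym (trans (dot-mulVec û W z) (dot-comm _ z))) (dot-∣ z (λ j → vec-integral m symB u j))

    -- 2 κ maps the intersection of the two lattices into the walk lattice.
    deep : ∀ x → δ ∣ dot û x → Σ (V n) λ z → ∀ i → mulVec W z i ≡ 2ℤ * κ * x i
    deep x p = lc κ z₀ q (λ k → T k last) , λ i → trans (mulVec-lc W κ z₀ q (λ k → T k last) i) (trans (cong (λ y → κ * mulVec W z₀ i + q * y) (column last i))
        (trans (cong (λ y → κ * mulVec W z₀ i + q * (y * e i)) δ≡) (trans (lem κ (mulVec W z₀ i) q λL (e i)) (trans (cong (λ y → κ * (mulVec W z₀ i + y * e i)) (sym 2c≡)) (trans (cong (κ *_) (sym (split≡ i))) (lem₂ κ (x i)))))))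
      where
      parts = split last low x
      z₀ = proj₁ parts
      split≡ = proj₂ parts
      c = mulVec U x last
      -- Pair 2 x = W z₀ + 2 c ζ with û. The factor λL gained here completes κ to δ, and δ ζ lies in
      -- W ℤⁿ.
      2c : λL ∣ 2ℤ * c
      2c = half-order c (subst (δ ∣_) (trans (cong (_- dot û (mulVec W z₀)) expand) (trans (lem₃ (dot û (mulVec W z₀)) (2ℤ * c) (dot û e)) (cong (2ℤ * c *_) (dot-comm û e)))) (∣m∣n⇒∣m-n (∣n⇒∣m*n 2ℤ p) (dot-û-walks z₀)))
        where
        expand : 2ℤ * dot û x ≡ 1ℤ * dot û (mulVec W z₀) + 2ℤ * c * dot û e
        expand = trans (sym (dot-*ʳ û 2ℤ x)) (trans (dot-congʳ û (λ i → trans (split≡ i) (cong (_+ 2ℤ * c * e i) (sym (*-identityˡ _))))) (dot-lcʳ û 1ℤ (mulVec W z₀) (2ℤ * c) e))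
        lem₃ : ∀ a c b → 1ℤ * a + c * b - a ≡ c * b
        lem₃ = solve 3 (λ a c b → con 1ℤ :* a :+ c :* b :- a := c :* b) refl
      q = _∣_.quotient 2c
      2c≡ : 2ℤ * c ≡ q * λL
      2c≡ = _∣_.equality 2c
      lem : ∀ k w q l e → k * w + q * (k * l * e) ≡ k * (w + q * l * e)
      lem = solve 5 (λ k w q l e → k :* w :+ q :* (k :* l :* e) := k :* (w :+ q :* l :* e)) refl
      lem₂ : ∀ k x → k * (2ℤ * x) ≡ 2ℤ * k * x
      lem₂ = solve 2 (λ k x → k :* (con 2ℤ :* x) := con 2ℤ :* k :* x) refl

    -- As δ = κ λL, it suffices that λL ∣ 2 κ, hence by `half-order` that δ ∣ 2 κ (ζ · û). A
    -- combination of the walk vectors 2 κ xu and 2 κ λL ζ has coefficients divisible by λL by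
    -- `walk-descent`; pairing its quotient with û and with ζ gives the claim multiplied by the
    -- coprime a′ and b′.
    order-bound : λL * λL ∣ 2ℤ * δ
    order-bound = subst (λL * λL ∣_) (trans (*-assoc 2ℤ κ λL) (cong (2ℤ *_) (sym δ≡))) (*-mono-∣ (half-order κ total) ∣-refl)
      where
      xu-pair = evens (order⇐ λL ∣-refl)
      xu = proj₁ xu-pair
      xu≡ : ∀ i → λL * û i ≡ δ * xu i
      xu≡ = proj₂ xu-pair
      c = proj₁ eigen
      x = proj₁ (proj₂ eigen)
      Aû : ∀ i → mulVec A û i ≡ c * û i + δ * x i
      Aû = proj₂ (proj₂ eigen)
      s = dot u u
      Aû-lc : mulVec A û ≗ lc c û δ x
      Aû-lc = Aû
      dot-xu : ∀ y → δ * dot y xu ≡ λL * dot y û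
      dot-xu y = trans (sym (dot-*ʳ y δ xu)) (trans (dot-congʳ y (λ i → sym (xu≡ i))) (dot-*ʳ y λL û))
      dot-û-xu : dot û xu ≡ λL * (δ * s)
      dot-û-xu = *-cancelˡ δ δ≢0 (trans (dot-xu û) (trans (cong (λL *_) (dot-vec u u)) (lem λL δ s)))
        where
        lem : ∀ l d s → l * (d * d * s) ≡ d * (l * (d * s))
        lem = solve 3 (λ l d s → l :* (d :* d :* s) := d :* (l :* (d :* s))) refl
      δ∣ûx : δ ∣ dot û x
      δ∣ûx = divides (dot u (mulVec B u) - c * s) (*-cancelˡ δ δ≢0 (trans (lem (c * dot û û) δ (dot û x)) (trans (cong₂ _-_ (trans (sym (dot-lcʳ û c û δ x)) (trans (dot-congʳ û (λ i → trans (sym (Aû i)) (A-vec u i))) (dot-vec u (mulVec B u)))) (cong (c *_) (dot-vec u u)))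
          (lem₂ δ (dot u (mulVec B u)) c s))))
        where
        lem : ∀ a d x → d * x ≡ (a + d * x) - a
        lem = solve 3 (λ a d x → d :* x := (a :+ d :* x) :- a) refl
        lem₂ : ∀ d b c s → d * d * b - c * (d * d * s) ≡ d * ((b - c * s) * d)
        lem₂ = solve 4 (λ d b c s → d :* d :* b :- c :* (d :* d :* s) := d :* ((b :- c :* s) :* d)) refl
      A-xu : ∀ i → mulVec A xu i ≡ c * xu i + λL * x i
      A-xu i = *-cancelˡ δ δ≢0 (trans (sym (mulVec-* A δ xu i)) (trans (mulVec-cong A (λ k → sym (xu≡ k)) i) (trans (mulVec-* A λL û i) (trans (cong (λL *_) (Aû i)) (trans (lem λL c (û i) δ (x i)) (trans (cong (λ y → c * y + λL * (δ * x i)) (xu≡ i)) (lem₂ c δ (xu i) λL (x i))))))))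
        where
        lem : ∀ l c u d x → l * (c * u + d * x) ≡ c * (l * u) + l * (d * x)
        lem = solve 5 (λ l c u d x → l :* (c :* u :+ d :* x) := c :* (l :* u) :+ l :* (d :* x)) refl
        lem₂ : ∀ c d y l x → c * (d * y) + l * (d * x) ≡ d * (c * y + l * x)
        lem₂ = solve 5 (λ c d y l x → c :* (d :* y) :+ l :* (d :* x) := d :* (c :* y :+ l :* x)) refl
      ju-pair = deep xu (subst (δ ∣_) (sym dot-û-xu) (∣n⇒∣m*n λL (∣n*m s)))
      jζ-pair = deep (λL ⋆ e) (subst (δ ∣_) (sym (trans (dot-*ʳ û λL e) (trans (cong (λL *_) (dot-comm û e)) (sym (dot-xu e))))) (∣n*m (dot e xu)))
      ju = proj₁ ju-pair
      jζ = proj₁ jζ-pair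
      open Bezout (bezout (ju last) (jζ last)) renaming (x to p; y to q)
      -- The second Bezout row makes the last coefficient of j vanish, as the descent requires.
      j w y : V n
      j = lc b′ ju (- a′) jζ
      w = lc b′ xu (- a′) (λL ⋆ e)
      y = lc b′ x (- a′) (lc 1ℤ (mulVec A e) (- c) e)
      j-last : j last ≡ 0ℤ
      j-last = trans (cong₂ (λ s t → b′ * s + - a′ * t) a≡ b≡) (lem b′ a′ g)
        where
        lem : ∀ b a g → b * (a * g) + - a * (b * g) ≡ 0ℤ
        lem = solve 3 (λ b a g → b :* (a :* g) :+ :- a :* (b :* g) := con 0ℤ) refl
      Wj : ∀ i → mulVec W j i ≡ 2ℤ * κ * w i
      Wj i = trans (mulVec-lc W b′ ju (- a′) jζ i) (trans (cong₂ (λ s t → b′ * s + - a′ * t) (proj₂ ju-pair i) (proj₂ jζ-pair i)) (lem b′ (2ℤ * κ) (xu i) a′ (λL * e i)))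
        where
        lem : ∀ b k x a z → b * (k * x) + - a * (k * z) ≡ k * (b * x + - a * z)
        lem = solve 5 (λ b k x a z → b :* (k :* x) :+ :- a :* (k :* z) := k :* (b :* x :+ :- a :* z)) refl
      -- xu = (λL / δ) û inherits the eigenvalue c modulo λL, and the other summand of w is a
      -- multiple of λL.
      A-w : ∀ i → mulVec A w i - c * w i ≡ λL * y i
      A-w i = trans (cong (_- c * w i) (trans (mulVec-lc A b′ xu (- a′) (λL ⋆ e) i) (cong₂ (λ s t → b′ * s + - a′ * t) (A-xu i) (mulVec-* A λL e i)))) (lem b′ c (xu i) λL (x i) a′ (mulVec A e i) (e i))
        where
        lem : ∀ b c u l x a f e → b * (c * u + l * x) + - a * (l * f) - c * (b * u + - a * (l * e)) ≡ l * (b * x + - a * (1ℤ * f + - c * e))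
        lem = solve 8 (λ b c u l x a f e → b :* (c :* u :+ l :* x) :+ :- a :* (l :* f) :- c :* (b :* u :+ :- a :* (l :* e)) := l :* (b :* x :+ :- a :* (con 1ℤ :* f :+ :- c :* e))) refl
      δ∣ûy : δ ∣ dot û y
      δ∣ûy = subst (δ ∣_) (sym (dot-lcʳ û b′ x (- a′) _)) (∣m∣n⇒∣m+n (∣n⇒∣m*n b′ δ∣ûx) (∣n⇒∣m*n (- a′)
        (subst (δ ∣_) (sym (trans (dot-lcʳ û 1ℤ (mulVec A e) (- c) e) (trans (cong (λ t → 1ℤ * t + - c * dot û e) (trans (dot-sym symA û e) (trans (dot-cong Aû-lc (λ _ → refl)) (dot-lcˡ c û δ x e)))) (lem c (dot û e) δ (dot x e))))) (∣n*m (dot x e)))))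
        where
        lem : ∀ c u d x → 1ℤ * (c * u + d * x) + - c * u ≡ d * x
        lem = solve 4 (λ c u d x → con 1ℤ :* (c :* u :+ d :* x) :+ :- c :* u := d :* x) refl
      k-pair = deep y δ∣ûy
      j-div : λL ∣ᵛ j
      j-div = walk-descent A last last≡ walk-injective j (proj₁ k-pair) λL c j-last λ i → trans (cong (λL *_) (proj₂ k-pair i)) (trans (lem λL (2ℤ * κ) (y i)) (trans (cong (2ℤ * κ *_) (sym (A-w i)))
          (trans (lem₂ (2ℤ * κ) (mulVec A w i) c (w i)) (cong₂ (λ s t → s - c * t) (trans (sym (mulVec-* A (2ℤ * κ) w i)) (mulVec-cong A (λ k → sym (Wj k)) i)) (sym (Wj i))))))
        where
        lem : ∀ l k y → l * (k * y) ≡ k * (l * y)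
        lem = solve 3 (λ l k y → l :* (k :* y) := k :* (l :* y)) refl
        lem₂ : ∀ k a c w → k * (a - c * w) ≡ k * a - c * (k * w)
        lem₂ = solve 4 (λ k a c w → k :* (a :- c :* w) := k :* a :- c :* (k :* w)) refl
      j′ : V n
      j′ = proj₁ (evens j-div)
      Wj′ : ∀ v → λL * dot v (mulVec W j′) ≡ 2ℤ * κ * (b′ * dot v xu + - a′ * (λL * dot v e))
      Wj′ v = trans (sym (dot-*ʳ v λL (mulVec W j′))) (trans (dot-congʳ v (λ i → trans (sym (mulVec-* W λL j′ i)) (trans (mulVec-cong W (λ k → sym (proj₂ (evens j-div) k)) i) (Wj i))))
        (trans (dot-*ʳ v (2ℤ * κ) w) (cong (2ℤ * κ *_) (trans (dot-lcʳ v b′ xu (- a′) (λL ⋆ e)) (cong (λ t → b′ * dot v xu + - a′ * t) (dot-*ʳ v λL e))))))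
      part-a : δ ∣ a′ * (2ℤ * κ * dot e û)
      part-a = subst (δ ∣_) (trans (cong (λ t → 2ℤ * κ * b′ * (δ * s) - t) reduced) (trans (lem₂ (2ℤ * κ) b′ (δ * s) a′ (dot û e)) (cong (λ t → a′ * (2ℤ * κ * t)) (dot-comm û e))))
          (∣m∣n⇒∣m-n (∣n⇒∣m*n (2ℤ * κ * b′) (∣n*m s)) (dot-û-walks j′))
        where
        reduced : dot û (mulVec W j′) ≡ 2ℤ * κ * (b′ * (δ * s) + - a′ * dot û e)
        reduced = *-cancelˡ λL λL≢0 (trans (Wj′ û) (trans (cong (λ t → 2ℤ * κ * (b′ * t + - a′ * (λL * dot û e))) dot-û-xu) (lem (2ℤ * κ) b′ λL (δ * s) a′ (dot û e))))
          where
          lem : ∀ k b l s a e → k * (b * (l * s) + - a * (l * e)) ≡ l * (k * (b * s + - a * e))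
          lem = solve 6 (λ k b l s a e → k :* (b :* (l :* s) :+ :- a :* (l :* e)) := l :* (k :* (b :* s :+ :- a :* e))) refl
        lem₂ : ∀ k b s a e → k * b * s - k * (b * s + - a * e) ≡ a * (k * e)
        lem₂ = solve 5 (λ k b s a e → k :* b :* s :- k :* (b :* s :+ :- a :* e) := a :* (k :* e)) refl
      part-b : δ ∣ b′ * (2ℤ * κ * dot e û)
      part-b = subst (δ ∣_) (trans (cong (_+ a′ * (2ℤ * κ) * dot e e * δ) reduced) (lem₂ (2ℤ * κ) b′ (dot e û) a′ δ (dot e e))) (∣m∣n⇒∣m+n (∣n*m (dot e (mulVec W j′))) (∣m*n (a′ * (2ℤ * κ) * dot e e)))
        where
        reduced : δ * dot e (mulVec W j′) ≡ 2ℤ * κ * (b′ * dot e û + - a′ * (δ * dot e e))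
        reduced = *-cancelˡ λL λL≢0 (trans (*-swap λL δ (dot e (mulVec W j′))) (trans (cong (δ *_) (Wj′ e)) (trans (lem δ (2ℤ * κ) b′ (dot e xu) a′ (λL * dot e e)) (trans (cong (λ t → 2ℤ * κ * (b′ * t + - a′ * (δ * (λL * dot e e)))) (dot-xu e)) (lem₃ (2ℤ * κ) b′ λL (dot e û) a′ δ (dot e e))))))
          where
          lem : ∀ d k b x a z → d * (k * (b * x + - a * z)) ≡ k * (b * (d * x) + - a * (d * z))
          lem = solve 6 (λ d k b x a z → d :* (k :* (b :* x :+ :- a :* z)) := k :* (b :* (d :* x) :+ :- a :* (d :* z))) refl
          lem₃ : ∀ k b l u a d z → k * (b * (l * u) + - a * (d * (l * z))) ≡ l * (k * (b * u + - a * (d * z)))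
          lem₃ = solve 7 (λ k b l u a d z → k :* (b :* (l :* u) :+ :- a :* (d :* (l :* z))) := l :* (k :* (b :* u :+ :- a :* (d :* z)))) refl
        lem₂ : ∀ k b u a d z → k * (b * u + - a * (d * z)) + a * k * z * d ≡ b * (k * u)
        lem₂ = solve 6 (λ k b u a d z → k :* (b :* u :+ :- a :* (d :* z)) :+ a :* k :* z :* d := b :* (k :* u)) refl
      total : δ ∣ 2ℤ * κ * dot e û
      total = subst (δ ∣_) (trans (lem p a′ q b′ (2ℤ * κ * dot e û)) (trans (cong (_* (2ℤ * κ * dot e û)) coprime) (*-identityˡ _))) (∣m∣n⇒∣m+n (∣n⇒∣m*n p part-a) (∣n⇒∣m*n q part-b))
        where
        lem : ∀ p a q b t → p * (a * t) + q * (b * t) ≡ (p * a + q * b) * t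
        lem = solve 5 (λ p a q b t → p :* (a :* t) :+ q :* (b :* t) := (p :* a :+ q :* b) :* t) refl

  -- Two mates of the same level have lattices with the same sum with Z^n.
  align : ∀ {B₁ B₂} (m₁ : Mate A B₁ δ) (m₂ : Mate A B₂ δ) (sym₁ : Symmetric B₁) (sym₂ : Symmetric B₂) (L₁ : MateLevel m₁ sym₁) (L₂ : MateLevel m₂ sym₂) →
    MateLevel.ℓ L₁ ≡ MateLevel.ℓ L₂ → Mult δ (MateLattice.vec m₂ symA sym₂ (MateLevel.u L₂)) (MateLattice.vec m₁ symA sym₁ (MateLevel.u L₁))
  align {B₁} {B₂} m₁ m₂ sym₁ sym₂ L₁ L₂ same = mult-≗ (λ i → lem₀ (O₂.û i) c (O₁.û i)) (mult-lc 1ℤ t c O₁.û t-mult (mult-refl O₁.û))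
    where
    module O₁ = Order m₁ sym₁ L₁
    module O₂ = Order m₂ sym₂ L₂
    lem₀ : ∀ x c y → 1ℤ * (1ℤ * x + - c * y) + c * y ≡ x
    lem₀ = solve 3 (λ x c y → con 1ℤ :* (con 1ℤ :* x :+ :- c :* y) :+ c :* y := x) refl
    x₁ x₂ : ℤ
    x₁ = 2ℤ * dot e O₁.û
    x₂ = 2ℤ * dot e O₂.û
    open Bezout (bezout x₁ δ) renaming (x to p; y to q)
    b′≢0 : b′ ≢ 0ℤ
    b′≢0 eq = δ≢0 (trans b≡ (trans (cong (_* g) eq) (*-zeroˡ g)))
    -- Equality of levels enters here: for b′ = δ / g the product 2 b′ (ζ · û₁) vanishes modulo δ,
    -- so the common order divides 2 b′, which therefore kills û₂ too.
    g∣x₂ : g ∣ x₂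
    g∣x₂ = ∣-cancelˡ b′ b′≢0 (subst₂ _∣_ b≡ (trans (dot-*ʳ e (2ℤ * b′) O₂.û) (lem b′ (dot e O₂.û))) (dot-∣ e (O₂.order⇐ (2ℤ * b′) (subst (λ l → ℤ.+ l ∣ 2ℤ * b′) same
        (O₁.half-order b′ (divides a′ (trans (lem b′ (dot e O₁.û)) (trans (cong (b′ *_) a≡) (trans (*-swap b′ a′ g) (cong (a′ *_) (sym b≡)))))))))))
      where
      lem : ∀ b d → 2ℤ * b * d ≡ b * (2ℤ * d)
      lem = solve 2 (λ b d → con 2ℤ :* b :* d := b :* (con 2ℤ :* d)) refl
    ratio c : ℤ
    ratio = _∣_.quotient g∣x₂
    -- Chosen to make 2 ζ · (û₂ - c û₁) divisible by δ.
    c = ratio * p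
    t : V n
    t = lc 1ℤ O₂.û (- c) O₁.û
    t-integral : Integral t
    t-integral = integral-lc 1ℤ O₂.û (- c) O₁.û (vec-integral m₂ sym₂ O₂.u) (vec-integral m₁ sym₁ O₁.u)
    2t : δ ∣ᵛ 2ℤ ⋆ t
    2t = halfInt t t-integral (divides (ratio * q) (trans (cong (2ℤ *_) (dot-lcʳ e 1ℤ O₂.û (- c) O₁.û)) (trans (lem (dot e O₂.û) ratio p (dot e O₁.û))
        (trans (cong (λ z → z - ratio * p * x₁) (trans (_∣_.equality g∣x₂) (cong (ratio *_) g≡))) (lem₂ ratio p x₁ q δ)))))
      where
      lem : ∀ y r p x → 2ℤ * (1ℤ * y + - (r * p) * x) ≡ 2ℤ * y - r * p * (2ℤ * x)
      lem = solve 4 (λ y r p x → con 2ℤ :* (con 1ℤ :* y :+ :- (r :* p) :* x) := con 2ℤ :* y :- r :* p :* (con 2ℤ :* x)) refl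
      lem₂ : ∀ r p x q d → r * (p * x + q * d) - r * p * x ≡ r * q * d
      lem₂ = solve 5 (λ r p x q d → r :* (p :* x :+ q :* d) :- r :* p :* x := r :* q :* d) refl
    Tt = torsion t-integral 2t
    F H S′ : ℕ → ℤ
    F k = dot (z Tt) (iter A k (z Tt))
    H k = dot O₁.û (iter A k (z Tt))
    S′ k = dot O₂.u (iter B₂ k O₂.u) - c * c * dot O₁.u (iter B₁ k O₁.u)
    -- The difference t may lie in neither lattice, so `F k` need not vanish modulo 4. Comparing û₂
    -- = t + c û₁ with the two integral norms leaves the mixed term `H k`.
    relation : ∀ k → δ * F k + 4ℤ * c * H k ≡ 4ℤ * δ * S′ k
    relation k = *-cancelˡ δ δ≢0 (trans (lem₁ δ (F k) c (H k)) (trans (cong (λ y → δ * (δ * F k) + 4ℤ * c * y) (sym 2G)) (trans (cong (_+ 4ℤ * c * (2ℤ * G)) (sym (quadruple Tt k)))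
        (trans (lem₂ (dot t (iter A k t)) c G (dot O₁.û (iter A k O₁.û))) (trans (cong₂ (λ y z → 4ℤ * (y - c * c * z)) (trans (sym expand) (O₂.dot-iter-vec k O₂.u O₂.u)) (O₁.dot-iter-vec k O₁.u O₁.u))
          (lem₃ δ (dot O₂.u (iter B₂ k O₂.u)) c (dot O₁.u (iter B₁ k O₁.u))))))))
      where
      G = dot O₁.û (iter A k t)
      2G : 2ℤ * G ≡ δ * H k
      2G = trans (cong (2ℤ *_) (dot-iter symA k O₁.û t)) (trans (sym (dot-*ʳ (iter A k O₁.û) 2ℤ t)) (trans (dot-congʳ (iter A k O₁.û) (2t≡ Tt)) (trans (dot-*ʳ (iter A k O₁.û) δ (z Tt)) (cong (δ *_) (sym (dot-iter symA k O₁.û (z Tt)))))))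
      û₂≗ : O₂.û ≗ lc 1ℤ t c O₁.û
      û₂≗ i = sym (lem (O₂.û i) c (O₁.û i))
        where
        lem : ∀ x c y → 1ℤ * (1ℤ * x + - c * y) + c * y ≡ x
        lem = solve 3 (λ x c y → con 1ℤ :* (con 1ℤ :* x :+ :- c :* y) :+ c :* y := x) refl
      expand : dot O₂.û (iter A k O₂.û) ≡ dot t (iter A k t) + 2ℤ * c * G + c * c * dot O₁.û (iter A k O₁.û)
      expand = trans (dot-cong û₂≗ (λ i → trans (iter-cong A k û₂≗ i) (iter-lc A k 1ℤ t c O₁.û i))) (trans (dot-lcˡ 1ℤ t c O₁.û (lc 1ℤ (iter A k t) c (iter A k O₁.û)))
        (trans (cong₂ (λ x y → 1ℤ * x + c * y) (trans (dot-lcʳ t 1ℤ (iter A k t) c (iter A k O₁.û)) (cong (λ x → 1ℤ * dot t (iter A k t) + c * x) (trans (dot-iter symA k t O₁.û) (dot-comm (iter A k t) O₁.û)))) (dot-lcʳ O₁.û 1ℤ (iter A k t) c (iter A k O₁.û)))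
          (lem (dot t (iter A k t)) c G (dot O₁.û (iter A k O₁.û)))))
        where
        lem : ∀ t c g u → 1ℤ * (1ℤ * t + c * g) + c * (1ℤ * g + c * u) ≡ t + 2ℤ * c * g + c * c * u
        lem = solve 4 (λ t c g u → con 1ℤ :* (con 1ℤ :* t :+ c :* g) :+ c :* (con 1ℤ :* g :+ c :* u) := t :+ con 2ℤ :* c :* g :+ c :* c :* u) refl
      lem₁ : ∀ d f c h → d * (d * f + 4ℤ * c * h) ≡ d * (d * f) + 4ℤ * c * (d * h)
      lem₁ = solve 4 (λ d f c h → d :* (d :* f :+ con 4ℤ :* c :* h) := d :* (d :* f) :+ con 4ℤ :* c :* (d :* h)) refl
      lem₂ : ∀ t c g u → 4ℤ * t + 4ℤ * c * (2ℤ * g) ≡ 4ℤ * (t + 2ℤ * c * g + c * c * u - c * c * u)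
      lem₂ = solve 4 (λ t c g u → con 4ℤ :* t :+ con 4ℤ :* c :* (con 2ℤ :* g) := con 4ℤ :* (t :+ con 2ℤ :* c :* g :+ c :* c :* u :- c :* c :* u)) refl
      lem₃ : ∀ d s c u → 4ℤ * (d * d * s - c * c * (d * d * u)) ≡ d * (4ℤ * d * (s - c * c * u))
      lem₃ = solve 4 (λ d s c u → con 4ℤ :* (d :* d :* s :- c :* c :* (d :* d :* u)) := d :* (con 4ℤ :* d :* (s :- c :* c :* u))) refl
    μ = proj₁ O₁.eigen
    x = proj₁ (proj₂ O₁.eigen)
    H-suc : ∀ k → H (suc k) ≡ μ * H k + δ * dot x (iter A k (z Tt))
    H-suc k = trans (dot-sym symA O₁.û (iter A k (z Tt))) (trans (dot-cong (proj₂ (proj₂ O₁.eigen)) (λ _ → refl)) (dot-lcˡ μ O₁.û δ x (iter A k (z Tt))))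
    -- û₁ has eigenvalue μ modulo δ, so the mixed terms cancel from F (k + 1) - μ F k. This is the
    -- relation with c₀ = - μ and c₁ = 1.
    recurrence : ∀ k → 4ℤ ∣ - μ * F k + 1ℤ * F (suc k)
    recurrence k = divides (S′ (suc k) - μ * S′ k - c * y) (*-cancelˡ δ δ≢0 (trans (lem₁ δ μ (F k) (F (suc k)) c (H k) (H (suc k))) (trans (cong₂ (λ a b → a - μ * b - 4ℤ * c * (H (suc k) - μ * H k)) (relation (suc k)) (relation k))
        (trans (cong (λ a → 4ℤ * δ * S′ (suc k) - μ * (4ℤ * δ * S′ k) - 4ℤ * c * (a - μ * H k)) (H-suc k)) (lem₂ δ (S′ (suc k)) μ (S′ k) c (H k) y)))))
      where
      y = dot x (iter A k (z Tt))
      lem₁ : ∀ d m f f′ c h h′ → d * (- m * f + 1ℤ * f′) ≡ (d * f′ + 4ℤ * c * h′) - m * (d * f + 4ℤ * c * h) - 4ℤ * c * (h′ - m * h)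
      lem₁ = solve 7 (λ d m f f′ c h h′ → d :* (:- m :* f :+ con 1ℤ :* f′) := (d :* f′ :+ con 4ℤ :* c :* h′) :- m :* (d :* f :+ con 4ℤ :* c :* h) :- con 4ℤ :* c :* (h′ :- m :* h)) refl
      lem₂ : ∀ d s′ m s c h y → 4ℤ * d * s′ - m * (4ℤ * d * s) - 4ℤ * c * (m * h + d * y - m * h) ≡ d * ((s′ - m * s - c * y) * 4ℤ)
      lem₂ = solve 7 (λ d s′ m s c h y → con 4ℤ :* d :* s′ :- m :* (con 4ℤ :* d :* s) :- con 4ℤ :* c :* (m :* h :+ d :* y :- m :* h) := d :* ((s′ :- m :* s :- c :* y) :* con 4ℤ)) refl
    t-mult : Mult δ t O₁.û
    t-mult = cases (parity O₁.λL)
      where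
      cases : 2ℤ ∣ O₁.λL ⊎ Oddℤ O₁.λL → Mult δ t O₁.û
      cases (inj₁ (divides q eq)) = mult-trans (torsion-multiple m₁ sym₁ (proj₁ (O₁.half-torsion q eq)) (proj₂ (O₁.half-torsion q eq)) Tt (- μ) 1ℤ (inj₂ one-odd) recurrence)
        (mult-≗ (λ i → sym (O₁.vec-⋆ q O₁.u i)) (q , λ i → subst (δ ∣_) (sym (lem q (O₁.û i))) ∣0))
        where
        lem : ∀ q x → 1ℤ * (q * x) + - q * x ≡ 0ℤ
        lem = solve 2 (λ q x → con 1ℤ :* (q :* x) :+ :- q :* x := con 0ℤ) refl
      -- The class of t is killed by 2 and by the odd common order, hence zero.
      cases (inj₂ (divides q eq)) = mult-∣ O₁.û λ i → subst (δ ∣_) (trans (cong (λ y → lc 1ℤ (O₁.λL ⋆ O₂.û) (- c) (O₁.λL ⋆ O₁.û) i - y * t i) (sym eq)) (lem O₁.λL (O₂.û i) c (O₁.û i)))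
          (∣m∣n⇒∣m-n (∣m∣n⇒∣m+n (∣n⇒∣m*n 1ℤ (O₂.order⇐ O₁.λL (subst (λ l → ℤ.+ l ∣ O₁.λL) same ∣-refl) i)) (∣n⇒∣m*n (- c) (O₁.order⇐ O₁.λL ∣-refl i))) (subst (δ ∣_) (sym (*-assoc q 2ℤ (t i))) (∣n⇒∣m*n q (2t i))))
        where
        lem : ∀ l x c y → 1ℤ * (l * x) + - c * (l * y) - (l - 1ℤ) * (1ℤ * x + - c * y) ≡ 1ℤ * x + - c * y
        lem = solve 4 (λ l x c y → con 1ℤ :* (l :* x) :+ :- c :* (l :* y) :- (l :- con 1ℤ) :* (con 1ℤ :* x :+ :- c :* y) := con 1ℤ :* x :+ :- c :* y) refl

-- Lattices with the same sum with ℤⁿ coincide.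

module Glue {n} {A B₁ B₂ : Mat n} {δ} (δ≢0 : δ ≢ 0ℤ) (m₁ : Mate A B₁ δ) (m₂ : Mate A B₂ δ)
  (symA : Symmetric A) (sym₁ : Symmetric B₁) (sym₂ : Symmetric B₂) where

  module L₁ = MateLattice m₁ symA sym₁
  module L₂ = MateLattice m₂ symA sym₂

  -- Unscaled, the products between the two lattices are integers, which forces unimodular lattices
  -- to coincide. Modulo δ all vectors are multiples of v₁ or v₂, so v₁ · v₂ is the essential case.
  glue : ∀ u₁ u₂ → (∀ b → Mult δ (L₁.vec b) (L₁.vec u₁)) → (∀ b → Mult δ (L₂.vec b) (L₂.vec u₂)) →
    Mult δ (L₂.vec u₂) (L₁.vec u₁) → Mult δ (L₁.vec u₁) (L₂.vec u₂) → ∀ a b → δ * δ ∣ dot (L₁.vec a) (L₂.vec b)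
  glue u₁ u₂ gen₁ gen₂ to₁ to₂ a b = divides (k₁ * k₂ * w + k₁ * s₂ + k₂ * s₁ + dot y₁ y₂)
      (trans (dot-cong (proj₂ (proj₂ E₁)) (proj₂ (proj₂ E₂))) (trans (dot-lcˡ k₁ v₁ δ y₁ (lc k₂ v₂ δ y₂)) (trans (cong₂ (λ p q → k₁ * p + δ * q) (dot-lcʳ v₁ k₂ v₂ δ y₂) (dot-lcʳ y₁ k₂ v₂ δ y₂))
        (trans (cong₂ (λ p q → k₁ * (k₂ * p + δ * dot v₁ y₂) + δ * (k₂ * q + δ * dot y₁ y₂)) v₁v₂ y₁v₂) (trans (cong (λ p → k₁ * (k₂ * (w * (δ * δ)) + δ * p) + δ * (k₂ * (s₁ * δ) + δ * dot y₁ y₂)) v₁y₂)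
          (lem k₁ k₂ w δ s₂ s₁ (dot y₁ y₂)))))))
    where
    lem : ∀ k l w d s t y → k * (l * (w * (d * d)) + d * (s * d)) + d * (l * (t * d) + d * y) ≡ (k * l * w + k * s + l * t + y) * (d * d)
    lem = solve 7 (λ k l w d s t y → k :* (l :* (w :* (d :* d)) :+ d :* (s :* d)) :+ d :* (l :* (t :* d) :+ d :* y) := (k :* l :* w :+ k :* s :+ l :* t :+ y) :* (d :* d)) refl
    v₁ = L₁.vec u₁
    v₂ = L₂.vec u₂
    E₁ = mult-eq (gen₁ a)
    E₂ = mult-eq (gen₂ b)
    k₁ = proj₁ E₁
    y₁ = proj₁ (proj₂ E₁)
    k₂ = proj₁ E₂
    y₂ = proj₁ (proj₂ E₂)
    F₁ = mult-eq to₁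
    F₂ = mult-eq to₂
    c₁ = proj₁ F₁
    x₁ = proj₁ (proj₂ F₁)
    c₂ = proj₁ F₂
    x₂ = proj₁ (proj₂ F₂)
    v₂≡ : v₂ ≗ lc c₁ v₁ δ x₁
    v₂≡ = proj₂ (proj₂ F₁)
    v₁≡ : v₁ ≗ lc c₂ v₂ δ x₂
    v₁≡ = proj₂ (proj₂ F₂)
    -- The all-ones vector is characteristic for both lattices, so v₂ · v₂ and v₁ · v₁ are congruent to the
    -- corresponding coordinate sums modulo 2; this makes c₁ (v₁ · x₁) divisible by δ, not only its double.
    characteristic : δ ∣ c₁ * dot v₁ x₁
    characteristic = ∣-cancelˡ 2ℤ 2≢0 (subst₂ _∣_ (*-comm δ 2ℤ) (sym doubled) (*-mono-∣ (∣-refl {δ}) even))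
      where
      p₂ = dot u₂ u₂
      p₁ = dot u₁ u₁
      q = dot x₁ x₁
      doubled : 2ℤ * (c₁ * dot v₁ x₁) ≡ δ * (p₂ - c₁ * c₁ * p₁ - q)
      doubled = *-cancelˡ δ δ≢0 (trans (lem₁ δ c₁ (dot v₁ x₁) (dot v₁ v₁) q) (trans (cong (λ z → z - c₁ * c₁ * dot v₁ v₁ - δ * δ * q) (sym square)) (trans (cong₂ (λ y z → y - c₁ * c₁ * z - δ * δ * q) (L₂.dot-vec u₂ u₂) (L₁.dot-vec u₁ u₁)) (lem₂ δ p₂ c₁ p₁ q))))
        where
        square : dot v₂ v₂ ≡ c₁ * c₁ * dot v₁ v₁ + 2ℤ * c₁ * δ * dot v₁ x₁ + δ * δ * q
        square = trans (dot-cong v₂≡ v₂≡) (trans (dot-lcˡ c₁ v₁ δ x₁ (lc c₁ v₁ δ x₁)) (trans (cong₂ (λ y z → c₁ * y + δ * z) (dot-lcʳ v₁ c₁ v₁ δ x₁) (trans (dot-lcʳ x₁ c₁ v₁ δ x₁) (cong (λ z → c₁ * z + δ * q) (dot-comm x₁ v₁)))) (lem₃ c₁ (dot v₁ v₁) δ (dot v₁ x₁) q)))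
          where
          lem₃ : ∀ c v d x q → c * (c * v + d * x) + d * (c * x + d * q) ≡ c * c * v + 2ℤ * c * d * x + d * d * q
          lem₃ = solve 5 (λ c v d x q → c :* (c :* v :+ d :* x) :+ d :* (c :* x :+ d :* q) := c :* c :* v :+ con 2ℤ :* c :* d :* x :+ d :* d :* q) refl
        lem₁ : ∀ d c x v q → d * (2ℤ * (c * x)) ≡ c * c * v + 2ℤ * c * d * x + d * d * q - c * c * v - d * d * q
        lem₁ = solve 5 (λ d c x v q → d :* (con 2ℤ :* (c :* x)) := c :* c :* v :+ con 2ℤ :* c :* d :* x :+ d :* d :* q :- c :* c :* v :- d :* d :* q) refl
        lem₂ : ∀ d p c r q → d * d * p - c * c * (d * d * r) - d * d * q ≡ d * (d * (p - c * c * r - q))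
        lem₂ = solve 5 (λ d p c r q → d :* d :* p :- c :* c :* (d :* d :* r) :- d :* d :* q := d :* (d :* (p :- c :* c :* r :- q))) refl
      sums : dot ones u₂ ≡ c₁ * dot ones u₁ + dot ones x₁
      sums = *-cancelˡ δ δ≢0 (trans (sym (L₂.dot-ones-vec u₂)) (trans (dot-congʳ ones v₂≡) (trans (dot-lcʳ ones c₁ v₁ δ x₁) (trans (cong (λ z → c₁ * z + δ * dot ones x₁) (L₁.dot-ones-vec u₁)) (lem₁ c₁ δ (dot ones u₁) (dot ones x₁))))))
        where
        lem₁ : ∀ c d o x → c * (d * o) + d * x ≡ d * (c * o + x)
        lem₁ = solve 4 (λ c d o x → c :* (d :* o) :+ d :* x := d :* (c :* o :+ x)) refl
      parity-of : ∀ x → 2ℤ ∣ dot x x - dot ones x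
      parity-of x = subst (λ z → 2ℤ ∣ dot x x - z) (sum≡dot x) (sum-square-parity x)
      even : 2ℤ ∣ p₂ - c₁ * c₁ * p₁ - q
      even = subst (2ℤ ∣_) (trans (cong (λ z → (p₂ - z) - (c₁ * c₁ * (p₁ - dot ones u₁) + (q - dot ones x₁)) - (c₁ * c₁ - c₁) * dot ones u₁) sums) (lem₁ p₂ c₁ (dot ones u₁) (dot ones x₁) p₁ q))
        (∣m∣n⇒∣m-n (∣m∣n⇒∣m-n (parity-of u₂) (∣m∣n⇒∣m+n (∣n⇒∣m*n (c₁ * c₁) (parity-of u₁)) (parity-of x₁))) (∣m⇒∣m*n (dot ones u₁) (square-parity c₁)))
        where
        lem₁ : ∀ p c o x r q → (p - (c * o + x)) - (c * c * (r - o) + (q - x)) - (c * c - c) * o ≡ p - c * c * r - q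
        lem₁ = solve 6 (λ p c o x r q → (p :- (c :* o :+ x)) :- (c :* c :* (r :- o) :+ (q :- x)) :- (c :* c :- c) :* o := p :- c :* c :* r :- q) refl
    -- c₂ c₁ fixes v₁ modulo δ, which removes the factor c₁ left by `characteristic`.
    v₁x₁ : δ ∣ dot v₁ x₁
    v₁x₁ = subst (δ ∣_) (sym (trans (dot-congˡ x₁ v₁≡′) (trans (dot-lcˡ (c₂ * c₁) v₁ δ (lc c₂ x₁ 1ℤ x₂) x₁) (cong (_+ δ * dot (lc c₂ x₁ 1ℤ x₂) x₁) (*-assoc c₂ c₁ _)))))
      (∣m∣n⇒∣m+n (∣n⇒∣m*n c₂ characteristic) (∣n*m _))
      where
      v₁≡′ : v₁ ≗ lc (c₂ * c₁) v₁ δ (lc c₂ x₁ 1ℤ x₂)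
      v₁≡′ i = trans (v₁≡ i) (trans (cong (λ z → c₂ * z + δ * x₂ i) (v₂≡ i)) (lem₁ c₂ c₁ (v₁ i) δ (x₁ i) (x₂ i)))
        where
        lem₁ : ∀ c b v d x y → c * (b * v + d * x) + d * y ≡ c * b * v + d * (c * x + 1ℤ * y)
        lem₁ = solve 6 (λ c b v d x y → c :* (b :* v :+ d :* x) :+ d :* y := c :* b :* v :+ d :* (c :* x :+ con 1ℤ :* y)) refl
    product₁₂ : δ * δ ∣ dot v₁ v₂
    product₁₂ = subst (δ * δ ∣_) (sym (trans (dot-congʳ v₁ v₂≡) (dot-lcʳ v₁ c₁ v₁ δ x₁)))
      (∣m∣n⇒∣m+n (∣n⇒∣m*n c₁ (subst (δ * δ ∣_) (sym (L₁.dot-vec u₁ u₁)) (∣n*m _))) (*-mono-∣ ∣-refl v₁x₁))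
    w = _∣_.quotient product₁₂
    v₁v₂ : dot v₁ v₂ ≡ w * (δ * δ)
    v₁v₂ = _∣_.equality product₁₂
    remainder : ∀ {x v k y} → x ≗ lc k v δ y → δ * δ ∣ dot x v → δ * δ ∣ dot v v → δ ∣ dot y v
    remainder {x} {v} {k} {y} eq p q = ∣-cancelˡ δ δ≢0 (subst (δ * δ ∣_) (trans (cong (_- k * dot v v) (trans (dot-congˡ v eq) (dot-lcˡ k v δ y v))) (lem₁ (k * dot v v) (δ * dot y v))) (∣m∣n⇒∣m-n p (∣n⇒∣m*n k q)))
      where
      lem₁ : ∀ a b → a + b - a ≡ b
      lem₁ = solve 2 (λ a b → a :+ b :- a := b) refl
    y₁v₁ : δ ∣ dot y₁ v₁
    y₁v₁ = remainder (proj₂ (proj₂ E₁)) (subst (δ * δ ∣_) (sym (L₁.dot-vec a u₁)) (∣n*m _)) (subst (δ * δ ∣_) (sym (L₁.dot-vec u₁ u₁)) (∣n*m _))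
    y₂v₂ : δ ∣ dot y₂ v₂
    y₂v₂ = remainder (proj₂ (proj₂ E₂)) (subst (δ * δ ∣_) (sym (L₂.dot-vec b u₂)) (∣n*m _)) (subst (δ * δ ∣_) (sym (L₂.dot-vec u₂ u₂)) (∣n*m _))
    y₁∣ : δ ∣ dot y₁ v₂
    y₁∣ = subst (δ ∣_) (sym (trans (dot-congʳ y₁ v₂≡) (dot-lcʳ y₁ c₁ v₁ δ x₁))) (∣m∣n⇒∣m+n (∣n⇒∣m*n c₁ y₁v₁) (∣n*m _))
    y₂∣ : δ ∣ dot v₁ y₂
    y₂∣ = subst (δ ∣_) (sym (trans (dot-congˡ y₂ v₁≡) (dot-lcˡ c₂ v₂ δ x₂ y₂))) (∣m∣n⇒∣m+n (∣n⇒∣m*n c₂ (subst (δ ∣_) (dot-comm y₂ v₂) y₂v₂)) (∣n*m _))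
    s₁ = _∣_.quotient y₁∣
    y₁v₂ : dot y₁ v₂ ≡ s₁ * δ
    y₁v₂ = _∣_.equality y₁∣
    s₂ = _∣_.quotient y₂∣
    v₁y₂ : dot v₁ y₂ ≡ s₂ * δ
    v₁y₂ = _∣_.equality y₂∣

-- From equal lattices to isomorphic graphs.

zero-or-one : ∀ {x} → x * x ≡ x → (x ≡ 0ℤ) ⊎ (x ≡ 1ℤ)
zero-or-one {x} eq with x ℤ.≟ 0ℤ
... | yes p = inj₁ p
... | no x≢0 = inj₂ (*-cancelˡ x x≢0 (trans eq (sym (*-identityʳ x))))

idempotent-unit : ∀ {n} (x : V n) → (∀ k → x k * x k ≡ x k) → sumFin x ≡ 1ℤ → Σ (Fin n) λ j → ∀ k → x k ≡ idMat j k
idempotent-unit {zero} x h eq with () ← trans (sym eq) (sum-nil x)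
idempotent-unit {suc n} x h eq with zero-or-one (h zero)
... | inj₂ x≡1 = zero , λ { zero → x≡1 ; (suc k) → rest k }
  where
  nonneg : ∀ k → NonNegative (x (suc k))
  nonneg k = subst NonNegative (h (suc k)) (square-nonneg (x (suc k)))
  rest : ∀ k → x (suc k) ≡ 0ℤ
  rest = sum-nonneg≡0 nonneg (trans (sym (lem (x zero) _)) (trans (cong₂ _-_ (trans (sym (sum-suc x)) eq) x≡1) (+-inverseʳ 1ℤ)))
    where
    lem : ∀ a b → a + b - a ≡ b
    lem = solve 2 (λ a b → a :+ b :- a := b) refl
... | inj₁ x≡0 with idempotent-unit (x ∘ suc) (h ∘ suc) (trans (sym (+-identityˡ _)) (trans (cong (_+ sumFin (x ∘ suc)) (sym x≡0)) (trans (sym (sum-suc x)) eq)))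
... | j , unit = suc j , λ { zero → x≡0 ; (suc k) → unit k }

-- An integer vector with x · x = 1 and coordinate sum 1 is a unit vector, as x_k² - x_k ≥ 0.
unit-vector : ∀ {n} (x : V n) → dot x x ≡ 1ℤ → sumFin x ≡ 1ℤ → Σ (Fin n) λ j → ∀ k → x k ≡ idMat j k
unit-vector x sq eq = idempotent-unit x (λ k → x-y≡0⇒x≡y (sum-nonneg≡0 (λ k → square-self (x k)) total k)) eq
  where
  total : sumFin (λ k → x k * x k - x k) ≡ 0ℤ
  total = trans (sum-+ (λ k → x k * x k) (λ k → - x k)) (trans (cong₂ _+_ sq (trans (sum-cong (λ k → sym (-1* (x k)))) (trans (sum-* (- 1ℤ) x) (trans (-1* _) (cong -_ eq))))) (+-inverseʳ 1ℤ))
  opaque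
    unfolding _+_
    square-self : ∀ y → NonNegative (y * y - y)
    square-self (ℤ.+ zero)  = 0 , refl
    square-self (ℤ.+ suc m) = m ℕ.+ m ℕ.* m , trans (lem′ (ℤ.+ m) (ℤ.+ suc m) refl) (trans (cong (ℤ.+ m +_) (sym (pos-* m m))) (sym (pos-+ m (m ℕ.* m))))
      where
      lem : ∀ m → (1ℤ + m) * (1ℤ + m) - (1ℤ + m) ≡ m + m * m
      lem = solve 1 (λ m → (con 1ℤ :+ m) :* (con 1ℤ :+ m) :- (con 1ℤ :+ m) := m :+ m :* m) refl
      lem′ : ∀ m k → k ≡ 1ℤ + m → k * k - k ≡ m + m * m
      lem′ m k refl = lem m
    square-self ℤ.-[1+ m ] = nonneg-+ (square-nonneg ℤ.-[1+ m ]) (suc m , refl)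

idMat-one : ∀ {n} {i j : Fin n} → idMat i j ≡ 1ℤ → i ≡ j
idMat-one {i = zero}  {zero}  eq = refl
idMat-one {i = suc i} {suc j} eq = cong suc (idMat-one eq)

-- R = P₁ P₂ᵀ / δ² is orthogonal, has row sums 1 and intertwines B₁ and B₂; being integral, it is a
-- permutation matrix.
module Permute {n} {A B₁ B₂ : Mat n} {δ} (δ≢0 : δ ≢ 0ℤ) (m₁ : Mate A B₁ δ) (m₂ : Mate A B₂ δ)
  (R : Mat n) (R≡ : ∀ i j → dot (Mate.P m₁ i) (Mate.P m₂ j) ≡ δ * δ * R i j) where

  module M₁ = Mate m₁
  module M₂ = Mate m₂

  δδ≢0 : δ * δ ≢ 0ℤ
  δδ≢0 eq = δ≢0 (*≡0 δ δ≢0 eq)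

  PᵀP₂-ones : ∀ i → mulVec (M₂.P ᵀ) ones i ≡ δ
  PᵀP₂-ones i = *-cancelˡ δ δ≢0 (trans (sym (mulVec-* (M₂.P ᵀ) δ ones i)) (trans (mulVec-cong (M₂.P ᵀ) (λ j → trans (*-identityʳ δ) (sym (M₂.Pe j))) i) (trans (M₂.PᵀP ones i) (*-identityʳ _))))

  R-apply : ∀ x i → δ * δ * mulVec R x i ≡ mulVec M₁.P (mulVec (M₂.P ᵀ) x) i
  R-apply x i = trans (sym (dot-*ˡ (δ * δ) (R i) x)) (trans (sum-cong (λ j → cong (_* x j) (trans (sym (R≡ i j)) (dot-comm (M₁.P i) (M₂.P j))))) (sym (dot-mulVecᵀ (M₁.P i) M₂.P x)))

  row-sum : ∀ i → sumFin (R i) ≡ 1ℤ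
  row-sum i = *-cancelˡ (δ * δ) δδ≢0 (trans (cong (δ * δ *_) (trans (sum≡dot (R i)) (dot-comm ones (R i)))) (trans (R-apply ones i) (trans (mulVec-cong M₁.P (λ j → trans (PᵀP₂-ones j) (sym (*-identityʳ δ))) i)
    (trans (mulVec-* M₁.P δ ones i) (trans (cong (δ *_) (M₁.Pe i)) (sym (*-identityʳ _)))))))

  row-square : ∀ i → dot (R i) (R i) ≡ 1ℤ
  row-square i = *-cancelˡ (δ * δ) δδ≢0 (*-cancelˡ (δ * δ) δδ≢0 (trans (cong (δ * δ *_) (sym (dot-*ʳ (R i) (δ * δ) (R i)))) (trans (sym (dot-*ˡ (δ * δ) (R i) (λ j → δ * δ * R i j)))
    (trans (dot-cong (λ j → trans (sym (R≡ i j)) (dot-comm (M₁.P i) (M₂.P j))) (λ j → trans (sym (R≡ i j)) (dot-comm (M₁.P i) (M₂.P j))))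
      (trans (dot-mulVec (mulVec M₂.P (M₁.P i)) M₂.P (M₁.P i))
        (trans (dot-congˡ (M₁.P i) (M₂.PᵀP (M₁.P i))) (trans (dot-*ˡ (δ * δ) (M₁.P i) (M₁.P i)) (cong (δ * δ *_) norm))))))))
    where
    norm : dot (M₁.P i) (M₁.P i) ≡ δ * δ * 1ℤ
    norm = trans (dot-congʳ (M₁.P i) (λ k → sym (mulVec-unit (M₁.P ᵀ) i k))) (trans (M₁.PPᵀ (idMat i) i) (cong (δ * δ *_) (id-diag i)))

  row : ∀ i → Σ (Fin n) λ j → ∀ k → R i k ≡ idMat j k
  row i = unit-vector (R i) (row-square i) (row-sum i)

  intertwine : ∀ x i → mulVec B₁ (mulVec R x) i ≡ mulVec R (mulVec B₂ x) i
  intertwine x i = *-cancelˡ (δ * δ) δδ≢0 (trans (sym (mulVec-* B₁ (δ * δ) (mulVec R x) i)) (trans (mulVec-cong B₁ (R-apply x) i) (trans (sym (M₁.PA (mulVec (M₂.P ᵀ) x) i))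
    (trans (mulVec-cong M₁.P PᵀB i) (sym (R-apply (mulVec B₂ x) i))))))
    where
    PᵀB : ∀ k → mulVec A (mulVec (M₂.P ᵀ) x) k ≡ mulVec (M₂.P ᵀ) (mulVec B₂ x) k
    PᵀB k = *-cancelˡ (δ * δ) δδ≢0 (trans (sym (M₂.PᵀP (mulVec A y) k)) (trans (mulVec-cong (M₂.P ᵀ) (λ j → trans (M₂.PA y j) (trans (mulVec-cong B₂ (M₂.PPᵀ x) j) (mulVec-* B₂ (δ * δ) x j))) k) (mulVec-* (M₂.P ᵀ) (δ * δ) (mulVec B₂ x) k)))
      where y = mulVec (M₂.P ᵀ) x

isomorphic : ∀ {n} (H₁ H₂ : Graph n) {A : Mat n} {δ} → δ ≢ 0ℤ → (m₁ : Mate A (adjMat H₁) δ) (m₂ : Mate A (adjMat H₂) δ) →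
  (∀ i j → δ * δ ∣ dot (Mate.P m₁ i) (Mate.P m₂ j)) → Isomorphic H₁ H₂
isomorphic {n} H₁ H₂ {A} {δ} δ≢0 m₁ m₂ div = permutation σ τ στ τσ , λ i j → bool-injective (adj H₂ (σ i) (σ j)) (adj H₁ i j) (sym (conjugate i j))
  where
  R : Mat n
  R i j = _∣_.quotient (div i j)
  R≡ : ∀ i j → dot (Mate.P m₁ i) (Mate.P m₂ j) ≡ δ * δ * R i j
  R≡ i j = trans (_∣_.equality (div i j)) (*-comm (R i j) (δ * δ))
  module F = Permute δ≢0 m₁ m₂ R R≡
  -- Exchanging the mates gives Rᵀ, whose rows supply the inverse permutation.
  module G = Permute δ≢0 m₂ m₁ (R ᵀ) (λ i j → trans (dot-comm (Mate.P m₂ i) (Mate.P m₁ j)) (R≡ j i))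
  σ τ : Fin n → Fin n
  σ i = proj₁ (F.row i)
  τ j = proj₁ (G.row j)
  στ : ∀ j → σ (τ j) ≡ j
  στ j = idMat-one (trans (sym (proj₂ (F.row (τ j)) j)) (trans (proj₂ (G.row j) (τ j)) (id-diag (τ j))))
  τσ : ∀ i → τ (σ i) ≡ i
  τσ i = idMat-one (trans (sym (proj₂ (G.row (σ i)) i)) (trans (proj₂ (F.row i) (σ i)) (id-diag (σ i))))
  conjugate : ∀ i j → adjMat H₁ i j ≡ adjMat H₂ (σ i) (σ j)
  conjugate i j = trans (sym (mulVec-unit (adjMat H₁) j i)) (trans (mulVec-cong (adjMat H₁) (λ k → trans (cong (λ l → idMat l k) (sym (τσ j))) (trans (sym (proj₂ (G.row (σ j)) k)) (sym (mulVec-unit R (σ j) k)))) i)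
    (trans (F.intertwine (idMat (σ j)) i) (trans (dot-cong (proj₂ (F.row i)) (mulVec-unit (adjMat H₂) (σ j))) (unit-dot (σ i) _))))
  bool-injective : ∀ a b → (if a then ℤ.+ 1 else (ℤ.+ 0)) ≡ (if b then ℤ.+ 1 else (ℤ.+ 0)) → a ≡ b
  bool-injective true  true  _ = refl
  bool-injective false false _ = refl

-- Prime factorizations and the number of possible levels.

prime∤1 : ∀ {p} → Prime p → ¬ p ℕᵈ.∣ 1
prime∤1 pr d = ℕ.nonTrivial⇒≢1 {{prime⇒nonTrivial pr}} (ℕᵈ.∣1⇒≡1 d)

prime∣^ : ∀ {p} → Prime p → ∀ q k → p ℕᵈ.∣ q ℕ.^ k → p ℕᵈ.∣ q
prime∣^ pr q zero    d = ⊥-elim (prime∤1 pr d)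
prime∣^ pr q (suc k) d with euclidsLemma q (q ℕ.^ k) pr d
... | inj₁ e = e
... | inj₂ e = prime∣^ pr q k e

prime∣prime : ∀ {p q} → Prime p → Prime q → p ℕᵈ.∣ q → p ≡ q
prime∣prime pp pq d with prime⇒irreducible pq d
... | inj₁ refl = ⊥-elim (prime∤1 pp (ℕᵈ.∣-refl))
... | inj₂ eq   = eq

valuation : ∀ {p} → Prime p → ∀ x → x ≢ 0 → Σ ℕ λ i → Σ ℕ λ y → x ≡ p ℕ.^ i ℕ.* y × ¬ p ℕᵈ.∣ y
valuation {p} pr x x≢0 = go x x x≢0 ℕ.≤-refl
  where
  go : ∀ m x → x ≢ 0 → x ℕ.≤ m → Σ ℕ λ i → Σ ℕ λ y → x ≡ p ℕ.^ i ℕ.* y × ¬ p ℕᵈ.∣ y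
  go m x x≢0 le with p ℕᵈ.∣? x
  ... | no ∤ = 0 , x , sym (ℕ.+-identityʳ x) , ∤
  go zero x x≢0 le | yes _ = ⊥-elim (x≢0 (ℕ.n≤0⇒n≡0 le))
  go (suc m) x x≢0 le | yes (ℕᵈ.divides y refl) with go m y y≢0 (ℕ.≤-pred (ℕ.<-≤-trans (ℕ.m<m*n y p {{ℕ.≢-nonZero y≢0}} (ℕ.nonTrivial⇒n>1 p {{prime⇒nonTrivial pr}})) le))
    where
    y≢0 : y ≢ 0
    y≢0 refl = x≢0 refl
  ... | i , z , refl , ∤ = suc i , z , ℕS.solve 3 (λ a z p → a ℕS.:* z ℕS.:* p ℕS.:= p ℕS.:* a ℕS.:* z) refl (p ℕ.^ i) z p , ∤

cancel-prime : ∀ {p x y} → Prime p → ¬ p ℕᵈ.∣ x → x ℕᵈ.∣ p ℕ.* y → x ℕᵈ.∣ y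
cancel-prime {p} {x} {y} pr ∤ (ℕᵈ.divides q eq) with euclidsLemma q x pr (subst (p ℕᵈ.∣_) eq (ℕᵈ.m∣m*n y))
... | inj₂ d = ⊥-elim (∤ d)
... | inj₁ (ℕᵈ.divides r refl) = ℕᵈ.divides r (ℕ.*-cancelˡ-≡ y (r ℕ.* x) p {{prime⇒nonZero pr}}
  (trans eq (ℕS.solve 3 (λ r p x → r ℕS.:* p ℕS.:* x ℕS.:= p ℕS.:* (r ℕS.:* x)) refl r p x)))

cancel-prime^ : ∀ {p x} → Prime p → ¬ p ℕᵈ.∣ x → ∀ k {y} → x ℕᵈ.∣ p ℕ.^ k ℕ.* y → x ℕᵈ.∣ y
cancel-prime^ pr ∤ zero    {y} d = subst (_ ℕᵈ.∣_) (ℕ.+-identityʳ y) d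
cancel-prime^ {p} {x} pr ∤ (suc k) {y} d = cancel-prime^ pr ∤ k (cancel-prime pr ∤ (subst (x ℕᵈ.∣_) (ℕ.*-assoc p (p ℕ.^ k) y) d))

exponent-≤ : ∀ {p R} → Prime p → ¬ p ℕᵈ.∣ R → ∀ j k → p ℕ.^ j ℕᵈ.∣ p ℕ.^ k ℕ.* R → j ℕ.≤ k
exponent-≤ pr ∤ zero    k       d = ℕ.z≤n
exponent-≤ {p} {R} pr ∤ (suc j) zero d = ⊥-elim (∤ (ℕᵈ.∣-trans (ℕᵈ.m∣m*n (p ℕ.^ j)) (subst (p ℕ.* p ℕ.^ j ℕᵈ.∣_) (ℕ.+-identityʳ R) d)))
exponent-≤ {p} {R} pr ∤ (suc j) (suc k) d = ℕ.s≤s (exponent-≤ pr ∤ j k (ℕᵈ.*-cancelˡ-∣ p {{prime⇒nonZero pr}} (subst (p ℕ.* p ℕ.^ j ℕᵈ.∣_) (ℕ.*-assoc p (p ℕ.^ k) R) d)))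

-- Peels one prime off ℓ and leaves a condition of the same shape on the cofactor, as the recursion
-- in `level-candidate` requires.
square-exponent : ∀ {p ℓ R} → Prime p → ℓ ≢ 0 → ¬ p ℕᵈ.∣ R → ∀ k → ℓ ℕ.* ℓ ℕᵈ.∣ p ℕ.^ k ℕ.* R →
  Σ ℕ λ i → Σ ℕ λ y → ℓ ≡ p ℕ.^ i ℕ.* y × i ℕ.+ i ℕ.≤ k × y ℕ.* y ℕᵈ.∣ R
square-exponent {p} {ℓ} {R} pr ℓ≢0 ∤R k d with valuation pr ℓ ℓ≢0
... | i , y , refl , ∤y = i , y , refl
    , exponent-≤ pr ∤R (i ℕ.+ i) k (ℕᵈ.∣-trans (ℕᵈ.m∣m*n (y ℕ.* y)) factored)
    , cancel-prime^ pr (λ e → ∤y (either (euclidsLemma y y pr e))) k (ℕᵈ.∣-trans (ℕᵈ.n∣m*n (p ℕ.^ (i ℕ.+ i))) factored)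
  where
  either : ∀ {A : Set} → A ⊎ A → A
  either (inj₁ a) = a
  either (inj₂ a) = a
  factored : p ℕ.^ (i ℕ.+ i) ℕ.* (y ℕ.* y) ℕᵈ.∣ p ℕ.^ k ℕ.* R
  factored = subst (ℕᵈ._∣ p ℕ.^ k ℕ.* R) (trans (ℕS.solve 2 (λ a y → a ℕS.:* y ℕS.:* (a ℕS.:* y) ℕS.:= a ℕS.:* a ℕS.:* (y ℕS.:* y)) refl (p ℕ.^ i) y)
    (cong (ℕ._* (y ℕ.* y)) (sym (ℕ.^-distribˡ-+-* p i i)))) d

-- The numbers 2^i ∏ p^j with i < m and j ≤ ⌊k/2⌋ for each pair (p, k).
candidates : ℕ → List (ℕ × ℕ) → List ℕ
candidates m [] = map (2 ℕ.^_) (upTo m)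
candidates m ((p , k) ∷ ps) = cartesianProductWith (λ i y → p ℕ.^ i ℕ.* y) (upTo (k ℕ./ 2 ℕ.+ 1)) (candidates m ps)

length-cartesian : ∀ {A B C : Set} (f : A → B → C) xs ys → length (cartesianProductWith f xs ys) ≡ length xs ℕ.* length ys
length-cartesian f []       ys = refl
length-cartesian f (x ∷ xs) ys = trans (List.length-++ (map (f x) ys)) (cong₂ ℕ._+_ (List.length-map (f x) ys) (length-cartesian f xs ys))

length-candidates : ∀ m ps → length (candidates m ps) ≡ m ℕ.* product (map (λ { (p , k) → k ℕ./ 2 ℕ.+ 1 }) ps)
length-candidates m [] = trans (List.length-map (2 ℕ.^_) (upTo m)) (trans (List.length-upTo m) (sym (ℕ.*-identityʳ m)))
length-candidates m ((p , k) ∷ ps) = trans (length-cartesian (λ i y → p ℕ.^ i ℕ.* y) (upTo (k ℕ./ 2 ℕ.+ 1)) (candidates m ps))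
  (trans (cong₂ ℕ._*_ (List.length-upTo (k ℕ./ 2 ℕ.+ 1)) (length-candidates m ps)) (ℕS.solve 3 (λ a m r → a ℕS.:* (m ℕS.:* r) ℕS.:= m ℕS.:* (a ℕS.:* r)) refl (k ℕ./ 2 ℕ.+ 1) m _))

OddPrimes : List (ℕ × ℕ) → Set
OddPrimes = All (λ pm → Prime (proj₁ pm) × Odd (proj₁ pm) × 1 ℕ.≤ proj₂ pm)

primePart : List (ℕ × ℕ) → ℕ
primePart ps = product (map (λ pm → proj₁ pm ℕ.^ proj₂ pm) ps)

prime∤primePart : ∀ {q} → Prime q → ∀ ps → OddPrimes ps → All (λ pm → q ≢ proj₁ pm) ps → ¬ q ℕᵈ.∣ primePart ps
prime∤primePart pq [] _ _ d = prime∤1 pq d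
prime∤primePart pq ((p , k) ∷ ps) ((pp , _) ∷ op) (q≢p ∷ ne) d with euclidsLemma (p ℕ.^ k) (primePart ps) pq d
... | inj₁ e = q≢p (prime∣prime pq pp (prime∣^ pq p k e))
... | inj₂ e = prime∤primePart pq ps op ne e

odd≢2 : ∀ {ps} → OddPrimes ps → All (λ pm → 2 ≢ proj₁ pm) ps
odd≢2 = All.map (λ { (_ , odd , _) refl → odd ℕᵈ.∣-refl })

odd-primePart : ∀ {ps} → OddPrimes ps → ¬ 2 ℕᵈ.∣ primePart ps
odd-primePart {ps} op = prime∤primePart prime[2] ps op (odd≢2 op)

unmap : ∀ {q : ℕ} (ps : List (ℕ × ℕ)) → All (q ≢_) (map proj₁ ps) → All (λ pm → q ≢ proj₁ pm) ps
unmap []       []       = []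
unmap (_ ∷ ps) (h ∷ hs) = h ∷ unmap ps hs

half-≤ : ∀ {i k} → i ℕ.+ i ℕ.≤ k → i ℕ.< k ℕ./ 2 ℕ.+ 1
half-≤ {i} {k} le = subst (i ℕ.<_) (ℕ.+-comm 1 (k ℕ./ 2)) (ℕ.s≤s (subst (ℕ._≤ k ℕ./ 2) (ℕ.m*n/n≡m i 2) (ℕ./-monoˡ-≤ 2 (subst (ℕ._≤ k) (trans (cong (i ℕ.+_) (sym (ℕ.+-identityʳ i))) (ℕ.*-comm 2 i)) le))))

power-of-two : ∀ N y → y ℕ.* y ℕᵈ.∣ 2 ℕ.^ N → y ≢ 0 → Σ ℕ λ i → y ≡ 2 ℕ.^ i × i ℕ.+ i ℕ.≤ N
power-of-two N y d y≢0 with square-exponent {R = 1} prime[2] y≢0 (prime∤1 prime[2]) N (subst (y ℕ.* y ℕᵈ.∣_) (sym (ℕ.*-identityʳ _)) d)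
... | i , z , refl , le , zz = i , trans (cong (2 ℕ.^ i ℕ.*_) (ℕᵈ.∣1⇒≡1 (ℕᵈ.∣-trans (ℕᵈ.m∣m*n z) zz))) (ℕ.*-identityʳ _) , le

-- The inequality alone gives i < m unless m = 1, where i = 1 must be excluded by the parity of the
-- level.
small-exponent : ∀ i m → 1 ℕ.≤ m → i ℕ.+ i ℕ.≤ suc m → (m ≡ 1 → i ≡ 0) → i ℕ.< m
small-exponent zero    m 1≤m le h = 1≤m
small-exponent (suc i) (suc zero) _ le h with () ← h refl
small-exponent (suc zero) (suc (suc m)) _ le h = ℕ.s≤s (ℕ.s≤s ℕ.z≤n)
small-exponent (suc (suc i)) (suc (suc m)) _ le h = ℕ.s≤s (ℕ.≤-trans (ℕ.m≤n+m (suc (suc i)) i) (ℕ.≤-pred (ℕ.≤-pred le)))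

level-candidate : ∀ m → 1 ℕ.≤ m → ∀ ps → OddPrimes ps → Unique (map proj₁ ps) → ∀ ℓ → ℓ ≢ 0 →
  ℓ ℕ.* ℓ ℕᵈ.∣ 2 ℕ.^ suc m ℕ.* primePart ps → (m ≡ 1 → ¬ 2 ℕᵈ.∣ ℓ) → ℓ ∈ candidates m ps
level-candidate m 1≤m [] op u ℓ ℓ≢0 d h with power-of-two (suc m) ℓ (subst (ℓ ℕ.* ℓ ℕᵈ.∣_) (ℕ.*-identityʳ _) d) ℓ≢0
... | i , refl , le = ∈-map⁺ (2 ℕ.^_) (∈-upTo⁺ (small-exponent i m 1≤m le (λ eq → zero-exponent i (h eq))))
  where
  zero-exponent : ∀ i → ¬ 2 ℕᵈ.∣ 2 ℕ.^ i → i ≡ 0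
  zero-exponent zero    _ = refl
  zero-exponent (suc i) ∤ = ⊥-elim (∤ (ℕᵈ.m∣m*n (2 ℕ.^ i)))
level-candidate m 1≤m ((p , k) ∷ ps) ((pp , odd , _) ∷ op) (p∉ ∷ u) ℓ ℓ≢0 d h
  with square-exponent {p} {ℓ} {2 ℕ.^ suc m ℕ.* primePart ps} pp ℓ≢0 coprime k (subst (ℓ ℕ.* ℓ ℕᵈ.∣_) (ℕS.solve 3 (λ a b c → a ℕS.:* (b ℕS.:* c) ℕS.:= b ℕS.:* (a ℕS.:* c)) refl (2 ℕ.^ suc m) (p ℕ.^ k) (primePart ps)) d)
  where
  coprime : ¬ p ℕᵈ.∣ 2 ℕ.^ suc m ℕ.* primePart ps
  coprime e with euclidsLemma (2 ℕ.^ suc m) (primePart ps) pp e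
  ... | inj₁ f = odd (subst (2 ℕᵈ.∣_) (sym (prime∣prime pp prime[2] (prime∣^ pp 2 (suc m) f))) ℕᵈ.∣-refl)
  ... | inj₂ f = prime∤primePart pp ps op (unmap ps p∉) f
... | i , y , refl , le , yy = ∈-cartesianProductWith⁺ (λ i y → p ℕ.^ i ℕ.* y) (∈-upTo⁺ (half-≤ {i} {k} le))
  (level-candidate m 1≤m ps op u y (λ { refl → ℓ≢0 (ℕ.*-zeroʳ (p ℕ.^ i)) }) yy (λ eq e → h eq (ℕᵈ.∣n⇒∣m*n (p ℕ.^ i) e)))

unique-length : ∀ {A : Set} (xs ys : List A) → AllPairs _≢_ xs → All (_∈ ys) xs → length xs ℕ.≤ length ys
unique-length []       ys u h = ℕ.z≤n
unique-length (x ∷ xs) ys (x∉ ∷ u) (x∈ ∷ h) with ∈-∃++ x∈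
... | as , bs , refl = subst (suc (length xs) ℕ.≤_) (sym (trans (List.length-++ as) (trans (ℕ.+-suc (length as) (length bs)) (cong suc (sym (List.length-++ as))))))
  (ℕ.s≤s (unique-length xs (as ++ bs) u (All.zipWith (λ (ne , mem) → remove ne (∈-++⁻ as mem)) (x∉ , h))))
  where
  remove : ∀ {y} → x ≢ y → y ∈ as ⊎ y ∈ (x ∷ bs) → y ∈ as ++ bs
  remove ne (inj₁ p)           = ∈-++⁺ˡ p
  remove ne (inj₂ (here eq))   = ⊥-elim (ne (sym eq))
  remove ne (inj₂ (there p))   = ∈-++⁺ʳ as p

-- The invariant `f` takes the proof of `P x` as argument because the level of a graph is computed
-- from its proof of generalized cospectrality.
count-by : ∀ {A : Set} {P : A → Set} {_~_ : A → A → Set} (f : ∀ {x} → P x → ℕ) →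
  (∀ {x y} (p : P x) (q : P y) → f p ≡ f q → x ~ y) → ∀ ys → (∀ {x} (p : P x) → f p ∈ ys) →
  ∀ xs → All P xs → AllPairs (λ x y → ¬ x ~ y) xs → length xs ℕ.≤ length ys
count-by {A} {P} {_~_} f inj ys mem xs ps ne = subst (ℕ._≤ length ys) (len xs ps) (unique-length (values xs ps) ys (unique xs ps ne) (members xs ps))
  where
  values : ∀ xs → All P xs → List ℕ
  values []       []       = []
  values (x ∷ xs) (p ∷ ps) = f p ∷ values xs ps
  len : ∀ xs ps → length (values xs ps) ≡ length xs
  len []       []       = refl
  len (x ∷ xs) (p ∷ ps) = cong suc (len xs ps)
  members : ∀ xs ps → All (_∈ ys) (values xs ps)
  members []       []       = []
  members (x ∷ xs) (p ∷ ps) = mem p ∷ members xs ps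
  distinct : ∀ {x} (p : P x) xs (ps : All P xs) → All (λ y → ¬ x ~ y) xs → All (f p ≢_) (values xs ps)
  distinct p []       []       []       = []
  distinct p (y ∷ xs) (q ∷ ps) (n ∷ ns) = (λ eq → n (inj p q eq)) ∷ distinct p xs ps ns
  unique : ∀ xs ps → AllPairs (λ x y → ¬ x ~ y) xs → AllPairs _≢_ (values xs ps)
  unique []       []       []       = []
  unique (x ∷ xs) (p ∷ ps) (n ∷ ns) = distinct p xs ps n ∷ unique xs ps ns

-- Assembly for graphs.

adj-symmetric : ∀ {n} (G : Graph n) → Symmetric (adjMat G)
adj-symmetric G i j = cong (λ b → if b then ℤ.+ 1 else (ℤ.+ 0)) (Graph.sym G i j)

adj-zero : ∀ {n} (G : Graph n) i → adjMat G i i ≡ 0ℤ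
adj-zero G i = cong (λ b → if b then ℤ.+ 1 else (ℤ.+ 0)) (Graph.irrefl G i)

chain : ∀ {n} (d : Fin n → ℕ) → (∀ i j → suc (toℕ i) ≡ toℕ j → d i ℕᵈ.∣ d j) → ∀ i j → toℕ i ≤ toℕ j → d i ℕᵈ.∣ d j
chain {n} d step i j le = go (toℕ j) j refl le
  where
  go : ∀ m j → toℕ j ≡ m → toℕ i ≤ m → d i ℕᵈ.∣ d j
  go m j eq le with ℕ.m≤n⇒m<n∨m≡n le
  ... | inj₂ i≡m = subst (λ k → d i ℕᵈ.∣ d k) (toℕ-injective (trans i≡m (sym eq))) ℕᵈ.∣-refl
  go (suc m) j eq le | inj₁ (ℕ.s≤s i≤m) = ℕᵈ.∣-trans (go m (fromℕ< m<n) (toℕ-fromℕ< m<n) i≤m) (step (fromℕ< m<n) j (trans (cong suc (toℕ-fromℕ< m<n)) (sym eq)))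
    where
    m<n : m ℕ.< n
    m<n = ℕ.<-trans (ℕ.n<1+n m) (subst (ℕ._< n) eq (toℕ<n j))

-- An index exhibits n as a successor; `mate` needs this because e is column zero of the walk
-- matrix.
mate-at : ∀ {n} → Fin n → {A B : Mat n} → Symmetric A → Symmetric B → (∀ k → walks A k ≡ walks B k) → ∀ {δ} → δ ≢ 0ℤ → (X : Mat n) →
  (∀ x → mulVec (walk A) (mulVec X x) ≗ λ i → δ * x i) → (∀ x → mulVec X (mulVec (walk A) x) ≗ λ i → δ * x i) → Mate A B δ
mate-at {suc n} _ = mate

module Counting {n} (h ε : ℕ) (n≡ : n ≡ (ε ℕ.+ h) ℕ.+ h) (ε≤1 : ε ≡ 0 ⊎ ε ≡ 1) (G : Graph n) (d : Fin n → ℕ)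
  (factors : IsInvariantFactors (walkMat G) d) (d-low : ∀ i → toℕ i ℕ.< ε ℕ.+ h → d i ≡ 1) (last : Fin n) (last≡ : suc (toℕ last) ≡ n)
  (low : ∀ i → i ≢ last → d i ℕᵈ.∣ 2) (d∣δ : ∀ i → d i ℕᵈ.∣ d last) (δ≢0 : d last ≢ 0) where

  A : Mat n
  A = adjMat G

  dℤ : V n
  dℤ i = ℤ.+ d i

  δℤ : ℤ
  δℤ = dℤ last

  δℤ≢0 : δℤ ≢ 0ℤ
  δℤ≢0 = δ≢0 ∘ ℤ.+-injective

  S : Smith (walk A) dℤ
  S = smith G d factors

  module M = Main h ε n≡ ε≤1 (adj-symmetric G) (adj-zero G) S (λ i lt → cong ℤ.+_ (d-low i lt)) last (λ i ne → pos-∣ (low i ne)) δℤ≢0 (λ i → pos-∣ (d∣δ i)) last≡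
  module SP = SmithProperties S

  mate-of : ∀ H → GenCospectral G H → Mate A (adjMat H) δℤ
  mate-of H gc = mate-at last (adj-symmetric G) (adj-symmetric H) (genCospectral⇒walks G H gc) δℤ≢0 (SP.X c cd) (SP.WX c cd) (SP.XW c cd)
    where
    c : V n
    c i = _∣_.quotient (pos-∣ (d∣δ i))
    cd : ∀ i → c i * dℤ i ≡ δℤ
    cd i = sym (_∣_.equality (pos-∣ (d∣δ i)))

  level-of : ∀ H (gc : GenCospectral G H) → M.MateLevel (mate-of H gc) (adj-symmetric H)
  level-of H gc = M.level (mate-of H gc) (adj-symmetric H)

  levelℕ : ∀ H → GenCospectral G H → ℕ
  levelℕ H gc = M.MateLevel.ℓ (level-of H gc)

  same-level⇒isomorphic : ∀ H₁ H₂ gc₁ gc₂ → levelℕ H₁ gc₁ ≡ levelℕ H₂ gc₂ → Isomorphic H₁ H₂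
  same-level⇒isomorphic H₁ H₂ gc₁ gc₂ same = isomorphic H₁ H₂ δℤ≢0 m₁ m₂ λ i j →
      subst (δℤ * δℤ ∣_) (dot-cong (mulVec-unit (Mate.P m₁ ᵀ) i) (mulVec-unit (Mate.P m₂ ᵀ) j))
        (Glue.glue δℤ≢0 m₁ m₂ (adj-symmetric G) (adj-symmetric H₁) (adj-symmetric H₂) (M.MateLevel.u L₁) (M.MateLevel.u L₂) (M.MateLevel.gen L₁) (M.MateLevel.gen L₂)
          (M.align m₁ m₂ (adj-symmetric H₁) (adj-symmetric H₂) L₁ L₂ same) (M.align m₂ m₁ (adj-symmetric H₂) (adj-symmetric H₁) L₂ L₁ (sym same)) (idMat i) (idMat j))
    where
    m₁ = mate-of H₁ gc₁
    m₂ = mate-of H₂ gc₂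
    L₁ = level-of H₁ gc₁
    L₂ = level-of H₂ gc₂

  level≢0 : ∀ H gc → levelℕ H gc ≢ 0
  level≢0 H gc eq = M.Order.λL≢0 (mate-of H gc) (adj-symmetric H) (level-of H gc) (cong ℤ.+_ eq)

  level-bound : ∀ H gc → levelℕ H gc ℕ.* levelℕ H gc ℕᵈ.∣ 2 ℕ.* d last
  level-bound H gc = ∣-pos (subst₂ _∣_ (sym (pos-* (levelℕ H gc) (levelℕ H gc))) (sym (pos-* 2 (d last))) (M.Order.order-bound (mate-of H gc) (adj-symmetric H) (level-of H gc)))

  level-odd : ∀ r → d last ≡ 2 ℕ.* r → ¬ 2 ℕᵈ.∣ r → ∀ H gc → ¬ 2 ℕᵈ.∣ levelℕ H gc
  level-odd r δ≡ ∤r H gc e = odd-not-even (M.Order.odd-order (mate-of H gc) (adj-symmetric H) (level-of H gc) half) (pos-∣ e)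
    where
    half : ∀ y → 4ℤ ∣ δℤ * y → 2ℤ ∣ y
    half y p = odd*even (not-even⇒odd (λ q → ∤r (∣-pos q))) (∣-cancelˡ 2ℤ 2≢0 (subst₂ _∣_ (pos-* 2 2) (trans (cong (_* y) (trans (cong ℤ.+_ δ≡) (pos-* 2 r))) (*-assoc 2ℤ (ℤ.+ r) y)) p))

  genCospectral-refl : GenCospectral G G
  genCospectral-refl = (λ _ → refl) , (λ _ → refl)

  -- G is put in front of the list, which accounts for the subtraction of one in the bound; its
  -- level differs from the others because no mate is isomorphic to G.
  at-most : ∀ ys → (∀ H gc → levelℕ H gc ∈ ys) → ∀ Hs → All (IsGCMate G) Hs → AllPairs (λ H H′ → ¬ Isomorphic H H′) Hs → suc (length Hs) ≤ length ys
  at-most ys mem Hs mates apart = count-by {P = GenCospectral G} {Isomorphic} (λ {H} → levelℕ H) (λ {H₁} {H₂} → same-level⇒isomorphic H₁ H₂) ys (λ {H} → mem H)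
    (G ∷ Hs) (genCospectral-refl ∷ All.map proj₁ mates) (All.map proj₂ mates ∷ apart)

theorem4p2 : (n : ℕ) → 2 ≤ n → (G : Graph n) → Controllable G →
    (d : Fin n → ℕ) → IsInvariantFactors (walkMat G) d →
    (∀ i → suc (toℕ i) ≡ ⌈ n /2⌉ → d i ≡ 1) →
    (∀ i → suc (toℕ i) ≡ n ∸ 1 → d i ≡ 2) →
    (m₁ : ℕ) → (ps : List (ℕ × ℕ)) →
    All (λ pm → Prime (proj₁ pm) × Odd (proj₁ pm) × 1 ≤ proj₂ pm) ps →
    Unique (map proj₁ ps) →
    (∀ i → suc (toℕ i) ≡ n → d i ≡ 2 ℕ.^ m₁ ℕ.* product (map (λ pm → proj₁ pm ℕ.^ proj₂ pm) ps)) →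
    AtMostMates G (bound m₁ ps)
theorem4p2 (suc zero) (ℕ.s≤s ())
theorem4p2 n@(suc (suc k)) 2≤n G _ d factors d-half d-two m₁ ps primes unique d-last Hs mates apart =
  bound-from (parity-split (halve n))
  where
  steps : ∀ i j → suc (toℕ i) ≡ toℕ j → d i ℕᵈ.∣ d j
  steps = proj₂ (proj₂ (proj₂ (proj₂ (proj₂ factors))))
  last : Fin n
  last = fromℕ< (ℕ.n<1+n (suc k))
  last≡ : suc (toℕ last) ≡ n
  last≡ = cong suc (toℕ-fromℕ< (ℕ.n<1+n (suc k)))
  k<n : k ℕ.< n
  k<n = ℕ.m<n⇒m<1+n (ℕ.n<1+n k)
  -- Zero-based index n - 2, the position of d_{n-1}.
  second : Fin n
  second = fromℕ< k<n
  d-second : d second ≡ 2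
  d-second = d-two second (cong suc (toℕ-fromℕ< k<n))
  δ≡ : d last ≡ 2 ℕ.^ m₁ ℕ.* primePart ps
  δ≡ = d-last last last≡
  below : ∀ i → toℕ i ≤ suc k
  below i = ℕ.≤-pred (toℕ<n i)
  d∣δ : ∀ i → d i ℕᵈ.∣ d last
  d∣δ i = chain d steps i last (subst (toℕ i ≤_) (sym (ℕ.suc-injective last≡)) (below i))
  low : ∀ i → i ≢ last → d i ℕᵈ.∣ 2
  low i i≢ = subst (d i ℕᵈ.∣_) d-second (chain d steps i second (subst (toℕ i ≤_) (sym (toℕ-fromℕ< k<n))
    (ℕ.≤-pred (ℕ.≤∧≢⇒< (below i) (λ eq → i≢ (toℕ-injective (trans eq (sym (ℕ.suc-injective last≡)))))))))
  odd-part : ¬ 2 ℕᵈ.∣ primePart ps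
  odd-part = odd-primePart primes
  -- d_{n-1} = 2 divides d_n, whose prime part over the listed primes is odd.
  1≤m₁ : 1 ≤ m₁
  1≤m₁ = positive m₁ (subst₂ ℕᵈ._∣_ d-second δ≡ (d∣δ second))
    where
    positive : ∀ m → 2 ℕᵈ.∣ 2 ℕ.^ m ℕ.* primePart ps → 1 ≤ m
    positive zero    e = ⊥-elim (odd-part (subst (2 ℕᵈ.∣_) (ℕ.+-identityʳ _) e))
    positive (suc m) e = ℕ.s≤s ℕ.z≤n
  part≢0 : primePart ps ≢ 0
  part≢0 eq = odd-part (subst (2 ℕᵈ.∣_) (sym eq) (2 ℕᵈ.∣0))
  δ≢0 : d last ≢ 0
  δ≢0 eq = absurd (ℕ.m*n≡0⇒m≡0∨n≡0 (2 ℕ.^ m₁) (trans (sym δ≡) eq))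
    where
    absurd : ¬ (2 ℕ.^ m₁ ≡ 0 ⊎ primePart ps ≡ 0)
    absurd (inj₁ e) with () ← ℕ.m^n≡0⇒m≡0 2 m₁ e
    absurd (inj₂ e) = part≢0 e
  Split : Set
  Split = Σ ℕ λ h → Σ ℕ λ ε → n ≡ (ε ℕ.+ h) ℕ.+ h × (ε ≡ 0 ⊎ ε ≡ 1) × ⌈ n /2⌉ ≡ ε ℕ.+ h
  parity-split : (Σ ℕ λ h → (n ≡ h ℕ.+ h) ⊎ (n ≡ suc (h ℕ.+ h))) → Split
  parity-split (h , inj₁ eq) = h , 0 , eq , inj₁ refl , trans (cong ⌈_/2⌉ eq) (sym (ℕ.n≡⌈n+n/2⌉ h))
  parity-split (h , inj₂ eq) = h , 1 , eq , inj₂ refl , trans (cong ⌈_/2⌉ eq) (cong suc (sym (ℕ.n≡⌊n+n/2⌋ h)))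
  bound-from : Split → length Hs ≤ bound m₁ ps
  bound-from (h , ε , n≡ , ε≤1 , half≡) = subst (λ b → length Hs ≤ b ∸ 1) (length-candidates m₁ ps) (ℕ.∸-monoˡ-≤ 1 (C.at-most (candidates m₁ ps) candidate Hs mates apart))
    where
    d-low : ∀ i → toℕ i ℕ.< ε ℕ.+ h → d i ≡ 1
    d-low i lt = ℕᵈ.∣1⇒≡1 (subst (d i ℕᵈ.∣_) (d-half mid mid≡) (chain d steps i mid (subst (toℕ i ≤_) (sym (toℕ-fromℕ< mid<)) (ℕ.≤-pred (subst (toℕ i ℕ.<_) (sym r≡) lt)))))
      where
      -- Zero-based index of d_⌈n/2⌉; all earlier invariant factors divide it and so equal 1.
      r = ℕ.pred (ε ℕ.+ h)
      r≡ : suc r ≡ ε ℕ.+ h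
      r≡ = ℕ.suc-pred (ε ℕ.+ h) {{ℕ.>-nonZero (ℕ.≤-<-trans ℕ.z≤n lt)}}
      mid< : r ℕ.< n
      mid< = subst₂ _≤_ (sym r≡) (sym n≡) (ℕ.m≤m+n (ε ℕ.+ h) h)
      mid : Fin n
      mid = fromℕ< mid<
      mid≡ : suc (toℕ mid) ≡ ⌈ n /2⌉
      mid≡ = trans (cong suc (toℕ-fromℕ< mid<)) (trans r≡ (sym half≡))
    module C = Counting h ε n≡ ε≤1 G d factors d-low last last≡ low d∣δ δ≢0
    candidate : ∀ H gc → C.levelℕ H gc ∈ candidates m₁ ps
    candidate H gc = level-candidate m₁ 1≤m₁ ps primes unique (C.levelℕ H gc) (C.level≢0 H gc)
      (subst (C.levelℕ H gc ℕ.* C.levelℕ H gc ℕᵈ.∣_) (trans (cong (2 ℕ.*_) δ≡) (sym (ℕ.*-assoc 2 (2 ℕ.^ m₁) (primePart ps)))) (C.level-bound H gc))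
      (λ m≡1 → C.level-odd (primePart ps) (trans δ≡ (cong (λ m → 2 ℕ.^ m ℕ.* primePart ps) m≡1)) odd-part H gc)
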